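{- Every signed graph $(G,\sigma)$ with ${\rm mad}(G)<\frac{14}{5}$ admits a homomorphism to $(K_6,M)$. Moreover, the bound $\frac{14}{5}$ is the best possible, in the sense that there is a signed graph of maximum average degree $\frac{14}{5}$ admitting no homomorphism to $(K_6,M)$.
   Context: A signed graph $(G,\sigma)$ is a finite simple graph $G$ together with a signature $\sigma:E(G)\to\{+,-\}$. The sign of a closed walk is the product of the signs of its edges (with multiplicity). A homomorphism of $(G,\sigma)$ to $(H,\pi)$ is a mapping of the vertices and edges of $G$ to the vertices and edges of $H$, respectively, preserving adjacencies and incidences and such that every closed walk of $G$ has the same sign (w.r.t. $\sigma$) as its image (w.r.t. $\pi$). $(K_6,M)$ denotes the complete graph on vertices $1,\dots,6$ in which the edges of the perfect matching $M=\{12,34,56\}$ are negative and all other edges are positive. ${\rm mad}(G)$, the maximum average degree, is the maximum of $2|E(H)|/|V(H)|$ over all nonempty subgraphs $H$ of $G$. -}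

module Defs where

open import Data.Nat using (ℕ; zero; suc; _+_; _*_; _<ᵇ_; _≤_; _<_)
open import Data.Fin using (Fin; zero; suc; toℕ; _≟_)
open import Data.Bool using (Bool; true; false; if_then_else_; _∧_)
open import Data.Maybe using (Maybe; just; nothing)
open import Data.Product using (Σ; ∃; _×_; _,_)
open import Relation.Nullary using (¬_)
open import Relation.Nullary.Decidable using (⌊_⌋)
open import Relation.Binary.PropositionalEquality using (_≡_; refl)

data Sign : Set where
  pos neg : Sign

_·_ : Sign → Sign → Sign
pos · s = s
neg · pos = neg
neg · neg = pos

-- A signed graph (G, σ): a finite simple graph on vertex set Fin n,
-- encoded by  sig i j = nothing  (i, j non-adjacent) or  just s
-- (ij is an edge with sign s).  Symmetric and loopless = simple.

record SignedGraph : Set where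
  field
    n       : ℕ
    sig     : Fin n → Fin n → Maybe Sign
    sym     : ∀ i j → sig i j ≡ sig j i
    noloop  : ∀ i → sig i i ≡ nothing
open SignedGraph public

Adj : (G : SignedGraph) → Fin (n G) → Fin (n G) → Set
Adj G u v = Σ Sign λ s → sig G u v ≡ just s

data Walk (G : SignedGraph) : Fin (n G) → Fin (n G) → Set where
  [_]  : ∀ u → Walk G u u
  step : ∀ {u v w} (s : Sign) → sig G u v ≡ just s → Walk G v w → Walk G u w

walkSign : ∀ {G u v} → Walk G u v → Sign
walkSign [ u ]          = pos
walkSign (step s _ W)   = s · walkSign W

mapWalk : ∀ {G H : SignedGraph} (f : Fin (n G) → Fin (n H))
          (e : ∀ {u v} → Adj G u v → Adj H (f u) (f v))
          {u v} → Walk G u v → Walk H (f u) (f v)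
mapWalk f e [ u ] = [ f u ]
mapWalk f e (step s p W) with e (s , p)
... | (s' , p') = step s' p' (mapWalk f e W)

record Hom (G H : SignedGraph) : Set where
  field
    vmap      : Fin (n G) → Fin (n H)
    emap      : ∀ {u v} → Adj G u v → Adj H (vmap u) (vmap v)
    closedWalkSign : ∀ u (W : Walk G u u) → walkSign W ≡ walkSign (mapWalk {G} {H} vmap emap W)

-- (K6, M): vertices 0..5 (standing for 1..6), M = {01, 23, 45}
-- (i.e. {12,34,56}) negative, all other edges positive.

pair : Fin 6 → Fin 3
pair zero = zero
pair (suc zero) = zero
pair (suc (suc zero)) = suc zero
pair (suc (suc (suc zero))) = suc zero
pair (suc (suc (suc (suc zero)))) = suc (suc zero)
pair (suc (suc (suc (suc (suc zero))))) = suc (suc zero)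

k6-sig : Fin 6 → Fin 6 → Maybe Sign
k6-sig i j = if ⌊ i ≟ j ⌋ then nothing
             else (if ⌊ pair i ≟ pair j ⌋ then just neg else just pos)

k6-sym : ∀ i j → k6-sig i j ≡ k6-sig j i
k6-sym zero zero = refl
k6-sym zero (suc zero) = refl
k6-sym zero (suc (suc zero)) = refl
k6-sym zero (suc (suc (suc zero))) = refl
k6-sym zero (suc (suc (suc (suc zero)))) = refl
k6-sym zero (suc (suc (suc (suc (suc zero))))) = refl
k6-sym (suc zero) zero = refl
k6-sym (suc zero) (suc zero) = refl
k6-sym (suc zero) (suc (suc zero)) = refl
k6-sym (suc zero) (suc (suc (suc zero))) = refl
k6-sym (suc zero) (suc (suc (suc (suc zero)))) = refl
k6-sym (suc zero) (suc (suc (suc (suc (suc zero))))) = refl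
k6-sym (suc (suc zero)) zero = refl
k6-sym (suc (suc zero)) (suc zero) = refl
k6-sym (suc (suc zero)) (suc (suc zero)) = refl
k6-sym (suc (suc zero)) (suc (suc (suc zero))) = refl
k6-sym (suc (suc zero)) (suc (suc (suc (suc zero)))) = refl
k6-sym (suc (suc zero)) (suc (suc (suc (suc (suc zero))))) = refl
k6-sym (suc (suc (suc zero))) zero = refl
k6-sym (suc (suc (suc zero))) (suc zero) = refl
k6-sym (suc (suc (suc zero))) (suc (suc zero)) = refl
k6-sym (suc (suc (suc zero))) (suc (suc (suc zero))) = refl
k6-sym (suc (suc (suc zero))) (suc (suc (suc (suc zero)))) = refl
k6-sym (suc (suc (suc zero))) (suc (suc (suc (suc (suc zero))))) = refl
k6-sym (suc (suc (suc (suc zero)))) zero = refl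
k6-sym (suc (suc (suc (suc zero)))) (suc zero) = refl
k6-sym (suc (suc (suc (suc zero)))) (suc (suc zero)) = refl
k6-sym (suc (suc (suc (suc zero)))) (suc (suc (suc zero))) = refl
k6-sym (suc (suc (suc (suc zero)))) (suc (suc (suc (suc zero)))) = refl
k6-sym (suc (suc (suc (suc zero)))) (suc (suc (suc (suc (suc zero))))) = refl
k6-sym (suc (suc (suc (suc (suc zero))))) zero = refl
k6-sym (suc (suc (suc (suc (suc zero))))) (suc zero) = refl
k6-sym (suc (suc (suc (suc (suc zero))))) (suc (suc zero)) = refl
k6-sym (suc (suc (suc (suc (suc zero))))) (suc (suc (suc zero))) = refl
k6-sym (suc (suc (suc (suc (suc zero))))) (suc (suc (suc (suc zero)))) = refl
k6-sym (suc (suc (suc (suc (suc zero))))) (suc (suc (suc (suc (suc zero))))) = refl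

k6-noloop : ∀ i → k6-sig i i ≡ nothing
k6-noloop zero = refl
k6-noloop (suc zero) = refl
k6-noloop (suc (suc zero)) = refl
k6-noloop (suc (suc (suc zero))) = refl
k6-noloop (suc (suc (suc (suc zero)))) = refl
k6-noloop (suc (suc (suc (suc (suc zero))))) = refl

K6M : SignedGraph
K6M = record { n = 6 ; sig = k6-sig ; sym = k6-sym ; noloop = k6-noloop }

count : ∀ {m} → (Fin m → Bool) → ℕ
count {zero}  p = 0
count {suc m} p = (if p zero then 1 else 0) + count (λ i → p (suc i))

record Subgraph (G : SignedGraph) : Set where
  field
    vs     : Fin (n G) → Bool
    es     : Fin (n G) → Fin (n G) → Bool
    es-sym : ∀ i j → es i j ≡ es j i
    es-ok  : ∀ i j → es i j ≡ true → Adj G i j × vs i ≡ true × vs j ≡ true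
open Subgraph public

|V| : ∀ {G} → Subgraph G → ℕ
|V| H = count (vs H)

sumFin : ∀ {m} → (Fin m → ℕ) → ℕ
sumFin {zero}  f = 0
sumFin {suc m} f = f zero + sumFin (λ i → f (suc i))

-- each edge counted once, as an unordered pair {i, j} with i < j
|E| : ∀ {G} → Subgraph G → ℕ
|E| H = sumFin λ i → count λ j → (toℕ i <ᵇ toℕ j) ∧ es H i j

-- Maximum average degree, compared with a fraction p/q (q > 0):
-- mad(G) = max { 2|E(H)|/|V(H)| : H nonempty subgraph of G }.
-- mad(G) < p/q  iff every nonempty subgraph H has 2|E(H)|·q < p·|V(H)|.
MadLess : SignedGraph → ℕ → ℕ → Set
MadLess G p q = ∀ (H : Subgraph G) → 1 ≤ |V| H → 2 * |E| H * q < p * |V| H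

MadEq : SignedGraph → ℕ → ℕ → Set
MadEq G p q =
  (∀ (H : Subgraph G) → 1 ≤ |V| H → 2 * |E| H * q ≤ p * |V| H)
  × (Σ (Subgraph G) λ H → 1 ≤ |V| H × 2 * |E| H * q ≡ p * |V| H)

{-# OPTIONS --safe #-}
-- Switching turns a homomorphism to (K₆, M) into a colouring of the vertices by twelve colours: a class
-- (a pair of matched vertices of K₆ together with a switching sign) and a bit.  A coloured vertex leaves
-- three of the six classes to a neighbour, one of them only in part; a path through a vertex of degree 2
-- forbids exactly one class.  So vertices of degree 2 are replaced by "thread" constraints, and a piece of
-- a minimal counterexample is measured by the number of classes it can forbid at the next vertex.
--
-- Call a vertex of degree 3 a Y if one of its neighbours has degree 2, and an X if none has.  A pair of
-- adjacent Ys, or an X with three Y neighbours, is a source: a path Y X Y X ... leaving it forbids at most one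
-- class after each Y and at most two after each X, whatever the colours outside.  Two such paths
-- never collide in a minimal counterexample, nor does a path ever close up on itself: an edge back into the
-- path gives a colour choice that frees the path.  Discharging with average 14/5 then succeeds, every Y drawing
-- the charge it lacks from the neighbour towards which the path through it is directed.
module Submission where

open import Defs hiding (sym)
open import Data.Bool using (Bool; true; false; not; T; _∧_; if_then_else_) renaming (_≟_ to _≟ᵇ_)
open import Data.Bool.Properties using (T?)
open import Data.Empty using (⊥; ⊥-elim)
open import Data.Fin using (Fin; zero; suc; toℕ; remQuot; _≟_)
open import Data.Fin.Patterns using (0F; 1F; 2F; 3F; 4F)
import Data.Fin.Properties as F
open import Data.List using (List; []; _∷_; length; lookup; filter; allFin; tabulate; map)
import Data.List.Membership.DecPropositional as DecMembership
open import Data.List.Membership.Propositional using (_∈_)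
open import Data.List.Membership.Propositional.Properties using (∈-filter⁺; ∈-filter⁻; ∈-allFin)
open import Data.List.Relation.Unary.All as All using (All; []; _∷_)
open import Data.List.Relation.Unary.All.Properties using (¬Any⇒All¬)
open import Data.List.Relation.Unary.AllPairs using (_∷_)
open import Data.List.Relation.Unary.Any as Any using (here; there)
open import Data.List.Relation.Unary.Any.Properties using (lookup-index)
open import Data.List.Relation.Unary.Unique.Propositional using (Unique)
import Data.List.Relation.Unary.Unique.Propositional.Properties as Unique
open import Data.Maybe using (Maybe; just; nothing; is-just)
import Data.Maybe.Properties as Maybe
open import Data.Nat using (ℕ; zero; suc; _+_; _*_; _∸_; _≤_; _<_; _≤?_; z≤n; s≤s; s≤s⁻¹; _<ᵇ_) renaming (_≟_ to _≟ⁿ_)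
open import Data.Nat.ListAction using (sum)
import Data.Nat.Properties as ℕ
open import Data.Nat.Solver using (module +-*-Solver)
open import Data.Product using (Σ; ∃; ∃₂; _×_; _,_; proj₁; proj₂)
open import Data.Sum using (_⊎_; inj₁; inj₂)
open import Data.Unit using (tt)
open import Function using (_∘_; id)
open import Relation.Binary using (DecidableEquality)
open import Relation.Binary.PropositionalEquality using (_≡_; _≢_; refl; sym; cong; cong₂; trans; subst; ≢-sym; module ≡-Reasoning)
open import Relation.Nullary using (¬_; Dec; yes; no; does)
open import Relation.Nullary.Decidable using (⌊_⌋; map′; ¬?; _×-dec_; _→-dec_; _⊎-dec_; dec-true; dec-false)
open import Relation.Unary using (Decidable)
open +-*-Solver using (solve; _:+_; _:*_; _:=_; con)

-- Colours and the finite facts about them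

-- Every step is a count among the six classes. The classes that a colour leaves to a neighbour lie
-- in three different pairs. Four free classes at a vertex forbid nothing beyond it, three forbid at
-- most one, two at most two. A Y that loses two classes to the path and one to its thread forbids
-- one; an X that loses one class beside a coloured vertex forbids two. So the alternation is
-- stable. The obstacle is that the remaining edges of a path may end anywhere, even twice at one
-- vertex, so the colours around a path are not independent. Each path therefore also carries what
-- it gains when an outside vertex that it meets again is recoloured. The charges: in tenths, each
-- end of an edge starts with 10, and a vertex of degree 2 takes 4 more from either neighbour. A Y
-- is left with 26 and an X with 30, against a need of 28, so an X can pay for one Y. On a path it
-- pays the Y before it, and the Y after it draws further on. A Y on no path draws 1 on either side.
-- Three such Ys would exhaust an X, and two adjacent Ys have nothing to give each other: these two
-- configurations have to be sources.

_≟ˢ_ : DecidableEquality Sign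
pos ≟ˢ pos = yes refl
pos ≟ˢ neg = no λ ()
neg ≟ˢ pos = no λ ()
neg ≟ˢ neg = yes refl

Class : Set
Class = Fin 3 × Sign

Color : Set
Color = Class × Bool

cls : Color → Class
cls = proj₁

_≟ᵏ_ : DecidableEquality Class
(p , s) ≟ᵏ (q , t) = map′ (λ { (refl , refl) → refl }) (λ { refl → refl , refl }) (p ≟ q ×-dec s ≟ˢ t)

open DecMembership _≟ᵏ_ using (_∈?_)

decided : ∀ {A : Set} (d : Dec A) → does d ≡ true → A
decided (yes a) refl = a

_≢?_ : (a b : Class) → Dec (a ≢ b)
a ≢? b = ¬? (a ≟ᵏ b)

-- A thread constrains the two neighbours of a vertex of degree 2; its sign is the product of the two edge signs.
data Kind : Set where
  plain thread : Sign → Kind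

isPos : Sign → Bool
isPos pos = true
isPos neg = false

isXor : Bool → Bool → Bool
isXor true b = not b
isXor false b = b

-- For (p , s) , b the colour is vertex b of the pair p of K₆, reached after switching by s.
sat : Kind → Color → Color → Bool
sat (plain e)  ((p , s) , b) ((q , t) , d) =
  if ⌊ p ≟ q ⌋ then (if isPos (e · (s · t)) then false else isXor b d) else isPos (e · (s · t))
sat (thread e) ((p , s) , b) ((q , t) , d) =
  if ⌊ p ≟ q ⌋ then isPos (e · (s · t)) else true

Sat : Kind → Color → Color → Set
Sat k x y = T (sat k x y)

Sat? : ∀ k x y → Dec (Sat k x y)
Sat? k x y = T? _

record Search (A : Set) : Set₁ where
  field
    all? : ∀ {P : A → Set} → (∀ a → Dec (P a)) → Dec (∀ a → P a)
    any? : ∀ {P : A → Set} → (∀ a → Dec (P a)) → Dec (∃ P)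
open Search {{...}} public

instance
  searchSign : Search Sign
  searchSign = record
    { all? = λ d → map′ (λ { (p , q) → λ { pos → p ; neg → q } }) (λ f → f pos , f neg) (d pos ×-dec d neg)
    ; any? = λ d → map′ (λ { (inj₁ p) → pos , p ; (inj₂ p) → neg , p })
                        (λ { (pos , p) → inj₁ p ; (neg , p) → inj₂ p }) (d pos ⊎-dec d neg) }
  searchBool : Search Bool
  searchBool = record
    { all? = λ d → map′ (λ { (p , q) → λ { false → p ; true → q } }) (λ f → f false , f true) (d false ×-dec d true)
    ; any? = λ d → map′ (λ { (inj₁ p) → false , p ; (inj₂ p) → true , p })
                        (λ { (false , p) → inj₁ p ; (true , p) → inj₂ p }) (d false ⊎-dec d true) }
  search3 : Search (Fin 3)
  search3 = record
    { all? = λ d → map′ (λ { (p , q , r) → λ { zero → p ; (suc zero) → q ; (suc (suc zero)) → r } })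
                        (λ f → f zero , f (suc zero) , f (suc (suc zero)))
                        (d zero ×-dec d (suc zero) ×-dec d (suc (suc zero)))
    ; any? = λ d → map′ (λ { (inj₁ p) → zero , p ; (inj₂ (inj₁ p)) → suc zero , p ; (inj₂ (inj₂ p)) → suc (suc zero) , p })
                        (λ { (zero , p) → inj₁ p ; (suc zero , p) → inj₂ (inj₁ p) ; (suc (suc zero) , p) → inj₂ (inj₂ p) })
                        (d zero ⊎-dec d (suc zero) ⊎-dec d (suc (suc zero))) }
  search× : ∀ {A B} → {{Search A}} → {{Search B}} → Search (A × B)
  search× = record
    { all? = λ d → map′ (λ f (a , b) → f a b) (λ f a b → f (a , b)) (all? λ a → all? λ b → d (a , b))
    ; any? = λ d → map′ (λ { (a , b , p) → (a , b) , p }) (λ { ((a , b) , p) → a , b , p }) (any? λ a → any? λ b → d (a , b)) }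

-- A vertex whose own colour must satisfy P forbids at most k classes across an edge of sign e.
Msg₀ Msg₁ Msg₂ : Sign → (Color → Set) → Set
Msg₀ e P = ∀ (c : Color) → ∃ λ a → P a × Sat (plain e) a c
Msg₁ e P = ∃ λ κ → ∀ (c : Color) → cls c ≢ κ → ∃ λ a → P a × Sat (plain e) a c
Msg₂ e P = ∃₂ λ κ₁ κ₂ → ∀ (c : Color) → cls c ≢ κ₁ → cls c ≢ κ₂ → ∃ λ a → P a × Sat (plain e) a c

Msg₀? : ∀ e {P} → (∀ a → Dec (P a)) → Dec (Msg₀ e P)
Msg₀? e d = all? λ c → any? λ a → d a ×-dec Sat? (plain e) a c
Msg₁? : ∀ e {P} → (∀ a → Dec (P a)) → Dec (Msg₁ e P)
Msg₁? e d = any? λ κ → all? λ c → cls c ≢? κ →-dec any? λ a → d a ×-dec Sat? (plain e) a c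
Msg₂? : ∀ e {P} → (∀ a → Dec (P a)) → Dec (Msg₂ e P)
Msg₂? e d = any? λ κ₁ → any? λ κ₂ → all? λ c → cls c ≢? κ₁ →-dec (cls c ≢? κ₂ →-dec any? λ a → d a ×-dec Sat? (plain e) a c)

_⋆_ : Sign → Color → Color
e ⋆ ((p , s) , b) = (p , e · s) , b

_⋆ᵏ_ : Sign → Class → Class
e ⋆ᵏ (p , s) = p , e · s

-- Only the product of the edge sign with the two switching signs counts, so an edge sign can be
-- moved into the colour of an endpoint. The finite checks below then need positive signs at one or
-- more of their edges only.
sat-⋆ : ∀ e a c → sat (plain pos) a (e ⋆ c) ≡ sat (plain e) a c
sat-⋆ pos ((p , s) , b) ((q , t) , d) = refl
sat-⋆ neg ((p , pos) , b) ((q , pos) , d) = refl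
sat-⋆ neg ((p , pos) , b) ((q , neg) , d) = refl
sat-⋆ neg ((p , neg) , b) ((q , pos) , d) = refl
sat-⋆ neg ((p , neg) , b) ((q , neg) , d) = refl

⋆→ : ∀ e a c → Sat (plain pos) a (e ⋆ c) → Sat (plain e) a c
⋆→ e a c = subst T (sat-⋆ e a c)

⋆-inv : ∀ e c κ → cls c ≢ e ⋆ᵏ κ → cls (e ⋆ c) ≢ κ
⋆-inv pos c κ n = n
⋆-inv neg ((p , pos) , b) _ n refl = n refl
⋆-inv neg ((p , neg) , b) _ n refl = n refl

msg₀-sign : ∀ {P} e → Msg₀ pos P → Msg₀ e P
msg₀-sign e m c with m (e ⋆ c)
... | a , p , q = a , p , ⋆→ e a c q
msg₁-sign : ∀ {P} e → Msg₁ pos P → Msg₁ e P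
msg₁-sign e (κ , m) = e ⋆ᵏ κ , λ c n → let a , p , q = m (e ⋆ c) (⋆-inv e c κ n) in a , p , ⋆→ e a c q
msg₂-sign : ∀ {P} e → Msg₂ pos P → Msg₂ e P
msg₂-sign e (κ , κ' , m) = e ⋆ᵏ κ , e ⋆ᵏ κ' ,
  λ c n n' → let a , p , q = m (e ⋆ c) (⋆-inv e c κ n) (⋆-inv e c κ' n') in a , p , ⋆→ e a c q

msg₀-map : ∀ {P Q} e → (∀ a → P a → Q a) → Msg₀ e P → Msg₀ e Q
msg₀-map e f m c with m c
... | a , p , q = a , f a p , q
msg₁-map : ∀ {P Q} e → (∀ a → P a → Q a) → Msg₁ e P → Msg₁ e Q
msg₁-map e f (κ , m) = κ , λ c n → let a , p , q = m c n in a , f a p , q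
msg₂-map : ∀ {P Q} e → (∀ a → P a → Q a) → Msg₂ e P → Msg₂ e Q
msg₂-map e f (κ , κ' , m) = κ , κ' , λ c n n' → let a , p , q = m c n n' in a , f a p , q

-- The only class that a thread forbids opposite a given colour.
tcls : Sign → Color → Class
tcls e ((p , s) , _) = p , neg · (e · s)

next : Fin 3 → Fin 3
next zero = suc zero
next (suc zero) = suc (suc zero)
next (suc (suc zero)) = zero

-- A pair different from both arguments, also when these coincide.
third : Fin 3 → Fin 3 → Fin 3
third p q = if ⌊ next p ≟ q ⌋ then next (next p) else next p

opp : Class → Class
opp (p , s) = p , neg · s

-- Otherwise the positions of the six classes in `l` would give an injection into fewer than six
-- places.
avoid : (l : List Class) → length l < 6 → ∃ λ (a : Class) → All (a ≢_) l
avoid l h with any? (λ a → All.all? (a ≢?_) l)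
... | yes p = p
... | no ¬p = ⊥-elim (F.<⇒notInjective h (λ {i} {j} → inj i j))
  where
  class : Fin 6 → Class
  class i = proj₁ (remQuot 2 i) , (if ⌊ proj₂ (remQuot {3} 2 i) ≟ zero ⌋ then pos else neg)
  class-inj : ∀ i j → class i ≡ class j → i ≡ j
  class-inj = decided (F.all? λ i → F.all? λ j → (class i ≟ᵏ class j) →-dec (i ≟ j)) refl
  ∈l : ∀ a → a ∈ l
  ∈l a with a ∈? l
  ... | yes p = p
  ... | no ¬q = ⊥-elim (¬p (a , ¬Any⇒All¬ l ¬q))
  inj : ∀ i j → Any.index (∈l (class i)) ≡ Any.index (∈l (class j)) → i ≡ j
  inj i j e = class-inj i j (trans (lookup-index (∈l (class i))) (trans (cong (lookup l) e) (sym (lookup-index (∈l (class j))))))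

abstract
  sat-sym⁺ : (∀ e (x y : Color) → Sat (plain e) x y → Sat (plain e) y x) × (∀ e (x y : Color) → Sat (thread e) x y → Sat (thread e) y x)
  sat-sym⁺ = decided (all? λ e → all? λ x → all? λ y → Sat? (plain e) x y →-dec Sat? (plain e) y x) refl
           , decided (all? λ e → all? λ x → all? λ y → Sat? (thread e) x y →-dec Sat? (thread e) y x) refl

  tcls-sat : ∀ e (x y : Color) → cls x ≢ tcls e y → Sat (thread e) x y
  tcls-sat = decided (all? λ e → all? λ x → all? λ y → (cls x ≢? tcls e y) →-dec Sat? (thread e) x y) refl

  -- With the converse `thread-of`, a thread constraint says exactly that the vertex in the middle
  -- can be coloured.
  thread-fill : ∀ e₁ e₂ (x y : Color) → Sat (thread (e₁ · e₂)) x y → ∃ λ w → Sat (plain e₁) w x × Sat (plain e₂) w y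
  thread-fill = decided (all? λ e₁ → all? λ e₂ → all? λ x → all? λ y →
     Sat? (thread (e₁ · e₂)) x y →-dec any? λ w → Sat? (plain e₁) w x ×-dec Sat? (plain e₂) w y) refl

  thread-of : ∀ e₁ e₂ (w x y : Color) → Sat (plain e₁) w x → Sat (plain e₂) w y → Sat (thread (e₁ · e₂)) x y
  thread-of = decided (all? λ e₁ → all? λ e₂ → all? λ w → all? λ x → all? λ y →
     Sat? (plain e₁) w x →-dec (Sat? (plain e₂) w y →-dec Sat? (thread (e₁ · e₂)) x y)) refl

  nbrs⁺ : ∀ (l : Color) → Msg₁ pos (λ a → Sat (plain pos) a l)
  nbrs⁺ = decided (all? λ l → Msg₁? pos λ a → Sat? (plain pos) a l) refl

  -- If `l` has class `(p , s)`, its neighbours have the classes `(q , s)` and `(r , s)` in full and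
  -- `opp (p , s)` in part. The class opposite to `l` is never reachable over a neighbour; once
  -- `(q , s)` is lost, neither remaining class reaches `(r , s)`, with `r` the pair given by
  -- `third`.
  nbrs-avoid⁺ : ∀ (l : Color) (κ : Class) (c : Color) →
    cls c ≢ opp (cls l) → cls c ≢ (third (proj₁ (cls l)) (proj₁ κ) , proj₂ (cls l)) →
    ∃ λ (a : Color) → (cls a ≢ κ × Sat (plain pos) a l) × Sat (plain pos) a c
  nbrs-avoid⁺ = decided (all? λ l → all? λ κ → all? λ c → (cls c ≢? _) →-dec ((cls c ≢? _) →-dec
    any? λ a → ((cls a ≢? κ) ×-dec Sat? (plain pos) a l) ×-dec Sat? (plain pos) a c)) refl

  -- A class fails to be reached only when all free classes belong to one triple, which takes one
  -- class from each pair. Different classes have different triples, so three free classes forbid at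
  -- most one. Four fit into no triple (`avoid₂⁺`), and two lie in at most two triples (`among₂⁺`).
  avoid₃⁺ : ∀ k₁ k₂ t → Msg₁ pos (λ a → cls a ≢ k₁ × cls a ≢ k₂ × cls a ≢ t)
  avoid₃⁺ = decided (all? λ k₁ → all? λ k₂ → all? λ t → Msg₁? pos λ a →
    (cls a ≢? k₁) ×-dec (cls a ≢? k₂) ×-dec (cls a ≢? t)) refl

  avoid₂⁺ : ∀ k t → Msg₀ pos (λ a → cls a ≢ k × cls a ≢ t)
  avoid₂⁺ = decided (all? λ k → all? λ t → Msg₀? pos λ a → (cls a ≢? k) ×-dec (cls a ≢? t)) refl

  among₂⁺ : ∀ u v → v ≢ u → Msg₂ pos (λ a → cls a ≡ u ⊎ cls a ≡ v)
  among₂⁺ = decided (all? λ u → all? λ v → (v ≢? u) →-dec Msg₂? pos λ a → (cls a ≟ᵏ u) ⊎-dec (cls a ≟ᵏ v)) refl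

  -- The complement of a triple again has one class from each pair. Given `k₁` and `k₂`, the third
  -- lost class can do harm only in the pair that these two miss.
  avoid₃-pending⁺ : ∀ k₁ k₂ → ∃ λ p₀ → ∀ t → proj₁ t ≢ p₀ → Msg₀ pos (λ a → cls a ≢ k₁ × cls a ≢ k₂ × cls a ≢ t)
  avoid₃-pending⁺ = decided (all? λ k₁ → all? λ k₂ → any? λ p₀ → all? λ t → ¬? (proj₁ t ≟ p₀) →-dec
    Msg₀? pos λ a → (cls a ≢? k₁) ×-dec (cls a ≢? k₂) ×-dec (cls a ≢? t)) refl

  nbrs-pending⁺ : ∀ κ e (c : Color) → cls c ≢ (next (proj₁ κ) , e · proj₂ κ) → cls c ≢ (next (next (proj₁ κ)) , e · proj₂ κ) →
    Msg₁ pos (λ a → cls a ≢ κ × Sat (plain e) a c)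
  nbrs-pending⁺ = decided (all? λ κ → all? λ e → all? λ c → (cls c ≢? _) →-dec ((cls c ≢? _) →-dec
    Msg₁? pos λ a → (cls a ≢? κ) ×-dec Sat? (plain e) a c)) refl

  -- The class lost to the thread lies in the pair of `d`, where the direct edge leaves only half a
  -- class.
  nbrs-double⁺ : ∀ e θ (d : Color) → Msg₁ pos (λ a → cls a ≢ tcls θ d × Sat (plain e) a d)
  nbrs-double⁺ = decided (all? λ e → all? λ θ → all? λ d → Msg₁? pos λ a → (cls a ≢? tcls θ d) ×-dec Sat? (plain e) a d) refl

  choose⁺ : ∀ (l : Color) k₁ k₂ → ∃ λ (a : Color) → (cls a ≢ k₁ × cls a ≢ k₂) × Sat (plain pos) a l
  choose⁺ = decided (all? λ l → all? λ k₁ → all? λ k₂ → any? λ a → ((cls a ≢? k₁) ×-dec (cls a ≢? k₂)) ×-dec Sat? (plain pos) a l) refl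

  -- The available classes lie in three different pairs, so avoiding a whole pair costs no more than
  -- avoiding one class.
  choose-pair⁺ : ∀ (l : Color) p k → ∃ λ (a : Color) → (proj₁ (cls a) ≢ p × cls a ≢ k) × Sat (plain pos) a l
  choose-pair⁺ = decided (all? λ l → all? λ p → all? λ k → any? λ a →
    (¬? (proj₁ (cls a) ≟ p) ×-dec (cls a ≢? k)) ×-dec Sat? (plain pos) a l) refl

  -- `a` and `a'` are meant as colours of two adjacent Ys, `t` and `t'` as the classes lost to their
  -- threads. The pair `p₀` is found before the end of the second thread has a colour.
  pair-pending⁺ : ∀ (l : Color) t e → ∃ λ p₀ → ∀ t' → proj₁ t' ≢ p₀ →
    Msg₀ pos (λ a → cls a ≢ t × ∃ λ a' → cls a' ≢ t' × Sat (plain pos) a' l × Sat (plain e) a' a)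
  pair-pending⁺ = decided (all? λ l → all? λ t → all? λ e → any? λ p₀ → all? λ t' → ¬? (proj₁ t' ≟ p₀) →-dec
    Msg₀? pos λ a → (cls a ≢? t) ×-dec any? λ a' → (cls a' ≢? t') ×-dec Sat? (plain pos) a' l ×-dec Sat? (plain e) a' a) refl

  pair-double⁺ : ∀ (l : Color) e θ → Msg₀ pos (λ a → ∃ λ a' → Sat (plain pos) a' l × Sat (plain e) a' a × Sat (thread θ) a' a)
  pair-double⁺ = decided (all? λ l → all? λ e → all? λ θ → Msg₀? pos λ a → any? λ a' →
    Sat? (plain pos) a' l ×-dec Sat? (plain e) a' a ×-dec Sat? (thread θ) a' a) refl

  adjacent-twos⁺ : ∀ (l m : Color) e → ∃ λ (x : Color) → ∃ λ y → Sat (plain pos) x l × Sat (plain e) x y × Sat (plain pos) y m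
  adjacent-twos⁺ = decided (all? λ l → all? λ m → all? λ e → any? λ x → any? λ y →
    Sat? (plain pos) x l ×-dec Sat? (plain e) x y ×-dec Sat? (plain pos) y m) refl

  four-three⁺ : ∀ (l : Color) e θ → ∃ λ κ → ∀ (x : Color) → cls x ≢ κ →
    ∃ λ y → Sat (plain pos) y l × Sat (plain e) y x × Sat (thread θ) y x
  four-three⁺ = decided (all? λ l → all? λ e → all? λ θ → any? λ κ → all? λ x → (cls x ≢? κ) →-dec any? λ y →
    Sat? (plain pos) y l ×-dec Sat? (plain e) y x ×-dec Sat? (thread θ) y x) refl

  nbrs-avoid-same⁺ : ∀ (l : Color) s (c : Color) → cls c ≢ opp (cls l) →
    ∃ λ (a : Color) → (cls a ≢ (proj₁ (cls l) , s) × Sat (plain pos) a l) × Sat (plain pos) a c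
  nbrs-avoid-same⁺ = decided (all? λ l → all? λ s → all? λ c → (cls c ≢? _) →-dec
    any? λ a → ((cls a ≢? _) ×-dec Sat? (plain pos) a l) ×-dec Sat? (plain pos) a c) refl

  avoid₄-either⁺ : ∀ p s k₁ k₂ →
    Msg₁ pos (λ a → (cls a ≢ k₁ × cls a ≢ k₂) × cls a ≢ (p , neg · s) × cls a ≢ (next (next p) , s)) ⊎
    Msg₁ pos (λ a → (cls a ≢ k₁ × cls a ≢ k₂) × cls a ≢ (p , neg · s) × cls a ≢ (next p , s))
  avoid₄-either⁺ = decided (all? λ p → all? λ s → all? λ k₁ → all? λ k₂ →
    (Msg₁? pos λ a → ((cls a ≢? k₁) ×-dec (cls a ≢? k₂)) ×-dec (cls a ≢? _) ×-dec (cls a ≢? _)) ⊎-dec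
    (Msg₁? pos λ a → ((cls a ≢? k₁) ×-dec (cls a ≢? k₂)) ×-dec (cls a ≢? _) ×-dec (cls a ≢? _))) refl

-- Class u is possible at a vertex with neighbours a and b that are themselves joined by a thread.
Linked : Color → Color → Sign → Sign → Sign → Class → Set
Linked l m e f θ u = ∃ λ a → Sat (plain pos) a l × Sat (plain e) a (u , false) ×
  ∃ λ b → Sat (plain pos) b m × Sat (plain f) b (u , false) × Sat (thread θ) a b

Linked? : ∀ l m e f θ u → Dec (Linked l m e f θ u)
Linked? l m e f θ u = any? λ a → Sat? (plain pos) a l ×-dec Sat? (plain e) a (u , false) ×-dec
  any? λ b → Sat? (plain pos) b m ×-dec Sat? (plain f) b (u , false) ×-dec Sat? (thread θ) a b

abstract
  -- Three different classes are needed because a further leaf at the same vertex may forbid two.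
  three-linked⁺ : ∀ (l m : Color) e f θ → ∃ λ u → Linked l m e f θ u × ∃ λ v → v ≢ u × Linked l m e f θ v ×
    ∃ λ w → w ≢ u × w ≢ v × Linked l m e f θ w
  three-linked⁺ = decided (all? λ l → all? λ m → all? λ e → all? λ f → all? λ θ →
    any? λ u → Linked? l m e f θ u ×-dec any? λ v → (v ≢? u) ×-dec Linked? l m e f θ v ×-dec
    any? λ w → (w ≢? u) ×-dec (w ≢? v) ×-dec Linked? l m e f θ w) refl

-- Messages across edges of either sign

sat-sym : ∀ k x y → Sat k x y → Sat k y x
sat-sym (plain e) = proj₁ sat-sym⁺ e
sat-sym (thread e) = proj₂ sat-sym⁺ e

msg-neighbour : ∀ e l e' → Msg₁ e' (λ a → Sat (plain e) a l)
msg-neighbour e l e' = msg₁-map e' (λ a → ⋆→ e a l) (msg₁-sign e' (nbrs⁺ (e ⋆ l)))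

msg-neighbour-avoid : ∀ e l κ e' → Msg₂ e' (λ a → cls a ≢ κ × Sat (plain e) a l)
msg-neighbour-avoid e l κ e' = msg₂-map e' (λ { a (p , q) → p , ⋆→ e a l q }) (msg₂-sign e' (_ , _ , nbrs-avoid⁺ (e ⋆ l) κ))

msg-avoid₃ : ∀ k₁ k₂ t e → Msg₁ e (λ a → cls a ≢ k₁ × cls a ≢ k₂ × cls a ≢ t)
msg-avoid₃ k₁ k₂ t e = msg₁-sign e (avoid₃⁺ k₁ k₂ t)

msg-avoid₂ : ∀ k t e → Msg₀ e (λ a → cls a ≢ k × cls a ≢ t)
msg-avoid₂ k t e = msg₀-sign e (avoid₂⁺ k t)

msg-avoid₄ : ∀ f₁ f₂ g₁ g₂ e → Msg₂ e (λ a → (cls a ≢ f₁ × cls a ≢ f₂) × (cls a ≢ g₁ × cls a ≢ g₂))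
msg-avoid₄ f₁ f₂ g₁ g₂ e with avoid (f₁ ∷ f₂ ∷ g₁ ∷ g₂ ∷ []) (ℕ.≤ᵇ⇒≤ 5 6 tt)
... | u , nu₁ ∷ nu₂ ∷ nu₃ ∷ nu₄ ∷ [] with avoid (u ∷ f₁ ∷ f₂ ∷ g₁ ∷ g₂ ∷ []) (ℕ.≤ᵇ⇒≤ 6 6 tt)
... | v , vu ∷ nv₁ ∷ nv₂ ∷ nv₃ ∷ nv₄ ∷ [] =
  msg₂-map e (λ { a (inj₁ refl) → (nu₁ , nu₂) , nu₃ , nu₄ ; a (inj₂ refl) → (nv₁ , nv₂) , nv₃ , nv₄ })
           (msg₂-sign e (among₂⁺ u v vu))

msg-avoid₃-pending : ∀ k₁ k₂ e → ∃ λ p₀ → ∀ t → proj₁ t ≢ p₀ → Msg₀ e (λ a → cls a ≢ k₁ × cls a ≢ k₂ × cls a ≢ t)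
msg-avoid₃-pending k₁ k₂ e = proj₁ (avoid₃-pending⁺ k₁ k₂) , λ t n → msg₀-sign e (proj₂ (avoid₃-pending⁺ k₁ k₂) t n)

msg-neighbour-pending : ∀ κ e e' → ∃₂ λ k₁ k₂ → ∀ c → cls c ≢ k₁ → cls c ≢ k₂ → Msg₁ e' (λ a → cls a ≢ κ × Sat (plain e) a c)
msg-neighbour-pending κ e e' = _ , _ , λ c n n' → msg₁-sign e' (nbrs-pending⁺ κ e c n n')

msg-neighbour-double : ∀ e θ e' d → Msg₁ e' (λ a → cls a ≢ tcls θ d × Sat (plain e) a d)
msg-neighbour-double e θ e' d = msg₁-sign e' (nbrs-double⁺ e θ d)

msg-pair-pending : ∀ e₀ l t e e' → ∃ λ p₀ → ∀ t' → proj₁ t' ≢ p₀ →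
  Msg₀ e' (λ a → cls a ≢ t × ∃ λ a' → cls a' ≢ t' × Sat (plain e₀) a' l × Sat (plain e) a' a)
msg-pair-pending e₀ l t e e' = proj₁ (pair-pending⁺ (e₀ ⋆ l) t e) , λ t' n → msg₀-sign e'
  (msg₀-map pos (λ { a (p , a' , q , r , s) → p , a' , q , ⋆→ e₀ a' l r , s }) (proj₂ (pair-pending⁺ (e₀ ⋆ l) t e) t' n))

msg-pair-double : ∀ e₀ l e θ e' → Msg₀ e' (λ a → ∃ λ a' → Sat (plain e₀) a' l × Sat (plain e) a' a × Sat (thread θ) a' a)
msg-pair-double e₀ l e θ e' = msg₀-sign e' (msg₀-map pos (λ { a (a' , p , q) → a' , ⋆→ e₀ a' l p , q }) (pair-double⁺ (e₀ ⋆ l) e θ))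

neighbour-avoiding : ∀ e l k₁ k₂ → ∃ λ a → (cls a ≢ k₁ × cls a ≢ k₂) × Sat (plain e) a l
neighbour-avoiding e l k₁ k₂ = let a , p , q = choose⁺ (e ⋆ l) k₁ k₂ in a , p , ⋆→ e a l q

neighbour-avoiding-pair : ∀ e l p k → ∃ λ a → (proj₁ (cls a) ≢ p × cls a ≢ k) × Sat (plain e) a l
neighbour-avoiding-pair e l p k = let a , u , q = choose-pair⁺ (e ⋆ l) p k in a , u , ⋆→ e a l q

fill-adjacent-twos : ∀ e₀ l e e₁ m → ∃ λ x → ∃ λ y → Sat (plain e₀) x l × Sat (plain e) x y × Sat (plain e₁) y m
fill-adjacent-twos e₀ l e e₁ m = let x , y , p , q , r = adjacent-twos⁺ (e₀ ⋆ l) (e₁ ⋆ m) e in x , y , ⋆→ e₀ x l p , q , ⋆→ e₁ y m r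

msg-triangle : ∀ e₀ l e θ → ∃ λ κ → ∀ x → cls x ≢ κ → ∃ λ y → Sat (plain e₀) y l × Sat (plain e) y x × Sat (thread θ) y x
msg-triangle e₀ l e θ = let κ , f = four-three⁺ (e₀ ⋆ l) e θ in κ , λ x n → let y , p , q = f x n in y , ⋆→ e₀ y l p , q

fill-threaded-star : ∀ e₀ l e₁ m e f θ k₁ k₂ → ∃ λ x → (cls x ≢ k₁ × cls x ≢ k₂) × ∃ λ a → Sat (plain e₀) a l × Sat (plain e) a x ×
     ∃ λ b → Sat (plain e₁) b m × Sat (plain f) b x × Sat (thread θ) a b
fill-threaded-star e₀ l e₁ m e f θ k₁ k₂ = pick (three-linked⁺ (e₀ ⋆ l) (e₁ ⋆ m) e f θ)
  where
  Good : Color → Set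
  Good x = ∃ λ a → Sat (plain e₀) a l × Sat (plain e) a x × ∃ λ b → Sat (plain e₁) b m × Sat (plain f) b x × Sat (thread θ) a b
  good : ∀ u → Linked (e₀ ⋆ l) (e₁ ⋆ m) e f θ u → Good (u , false)
  good u (a , p , q , b , r , s) = a , ⋆→ e₀ a l p , q , b , ⋆→ e₁ b m r , s
  pick : (∃ λ u → Linked (e₀ ⋆ l) (e₁ ⋆ m) e f θ u × ∃ λ v → v ≢ u × Linked (e₀ ⋆ l) (e₁ ⋆ m) e f θ v ×
    ∃ λ w → w ≢ u × w ≢ v × Linked (e₀ ⋆ l) (e₁ ⋆ m) e f θ w) → ∃ λ x → (cls x ≢ k₁ × cls x ≢ k₂) × Good x
  pick (u , gu , v , vu , gv , w , wu , wv , gw) with u ≟ᵏ k₁ | u ≟ᵏ k₂ | v ≟ᵏ k₁ | v ≟ᵏ k₂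
  ... | no a     | no b     | _        | _        = (u , false) , (a , b) , good u gu
  ... | _        | _        | no a     | no b     = (v , false) , (a , b) , good v gv
  ... | yes refl | _        | yes refl | _        = ⊥-elim (vu refl)
  ... | _        | yes refl | _        | yes refl = ⊥-elim (vu refl)
  ... | yes refl | _        | no _     | yes refl = (w , false) , (wu , wv) , good w gw
  ... | no _     | yes refl | yes refl | no _     = (w , false) , (wv , wu) , good w gw

·-neg : ∀ e s → e · (neg · s) ≡ neg · (e · s)
·-neg pos s = refl
·-neg neg s = refl

next-cover : ∀ p q → q ≡ p ⊎ q ≡ next p ⊎ q ≡ next (next p)
next-cover = decided (all? λ p → all? λ q → (q ≟ p) ⊎-dec (q ≟ next p) ⊎-dec (q ≟ next (next p))) refl

third-next : ∀ p → third p (next p) ≡ next (next p) × third p (next (next p)) ≡ next p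
third-next = decided (all? λ p → (third p (next p) ≟ next (next p)) ×-dec (third p (next (next p)) ≟ next p)) refl

-- The leaf `a` forbids at `x` the class opposite to `l`, and a second one that depends only on the
-- pair of `t`. If `t` is in the pair of `l`, there is no second one. Otherwise it has two possible
-- values; `avoid₄-either⁺` makes one of them harmless, and `p₀` is the pair of `t` that yields the
-- other.
msg-star-pending : ∀ e₀ l k₁ k₂ e e' → ∃ λ p₀ → ∀ t → proj₁ t ≢ p₀ → Msg₁ e' (λ x → (cls x ≢ k₁ × cls x ≢ k₂) ×
       ∃ λ a → cls a ≢ t × Sat (plain e₀) a l × Sat (plain e) a x)
msg-star-pending e₀ ((p , s₀) , b) k₁ k₂ e e' = pick (avoid₄-either⁺ p (e · s) k₁ k₂)
  where
  l = ((p , s₀) , b)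
  s = e₀ · s₀
  Q : Class → Color → Set
  Q t x = (cls x ≢ k₁ × cls x ≢ k₂) × ∃ λ a → cls a ≢ t × Sat (plain e₀) a l × Sat (plain e) a x
  back : ∀ t x → cls x ≢ (p , neg · (e · s)) → cls x ≢ (third p (proj₁ t) , e · s) →
         ∃ λ a → cls a ≢ t × Sat (plain e₀) a l × Sat (plain e) a x
  back t x n m = let a , (u , v) , w = nbrs-avoid⁺ (e₀ ⋆ l) t (e ⋆ x)
                                         (⋆-inv e x _ (subst (λ z → cls x ≢ (p , z)) (sym (·-neg e s)) n)) (⋆-inv e x _ m)
                 in a , u , ⋆→ e₀ a l v , ⋆→ e a x w
  back-same : ∀ s' x → cls x ≢ (p , neg · (e · s)) → ∃ λ a → cls a ≢ (p , s') × Sat (plain e₀) a l × Sat (plain e) a x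
  back-same s' x n = let a , (u , v) , w = nbrs-avoid-same⁺ (e₀ ⋆ l) s' (e ⋆ x)
                                             (⋆-inv e x _ (subst (λ z → cls x ≢ (p , z)) (sym (·-neg e s)) n))
                     in a , u , ⋆→ e₀ a l v , ⋆→ e a x w
  same : ∀ s' → Msg₁ e' (Q (p , s'))
  same s' = msg₁-map e' (λ { x (n , m , o) → (n , m) , back-same s' x o }) (msg-avoid₃ k₁ k₂ (p , neg · (e · s)) e')
  pick : _ → ∃ λ p₀ → ∀ t → proj₁ t ≢ p₀ → Msg₁ e' (Q t)
  pick (inj₁ m) = next (next p) , go
    where
    go : ∀ t → proj₁ t ≢ next (next p) → Msg₁ e' (Q t)
    go (q , s') n with next-cover p q
    ... | inj₁ refl = same s'
    ... | inj₂ (inj₁ refl) = msg₁-map e' (λ { x (f , o , r) → f , back (q , s') x o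
                               (subst (λ z → cls x ≢ (z , e · s)) (sym (proj₁ (third-next p))) r) }) (msg₁-sign e' m)
    ... | inj₂ (inj₂ r) = ⊥-elim (n r)
  pick (inj₂ m) = next p , go
    where
    go : ∀ t → proj₁ t ≢ next p → Msg₁ e' (Q t)
    go (q , s') n with next-cover p q
    ... | inj₁ refl = same s'
    ... | inj₂ (inj₂ refl) = msg₁-map e' (λ { x (f , o , r) → f , back (q , s') x o
                               (subst (λ z → cls x ≢ (z , e · s)) (sym (proj₂ (third-next p))) r) }) (msg₁-sign e' m)
    ... | inj₂ (inj₁ r) = ⊥-elim (n r)

-- Critical systems of direct and threaded constraints

_≟ᵏⁱ_ : DecidableEquality Kind
plain e ≟ᵏⁱ plain f = map′ (cong plain) (λ { refl → refl }) (e ≟ˢ f)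
plain e ≟ᵏⁱ thread f = no λ ()
thread e ≟ᵏⁱ plain f = no λ ()
thread e ≟ᵏⁱ thread f = map′ (cong thread) (λ { refl → refl }) (e ≟ˢ f)

anyKind? : ∀ {P : Kind → Set} → (∀ k → Dec (P k)) → Dec (∃ P)
anyKind? d = map′ (λ { (inj₁ (e , p)) → plain e , p ; (inj₂ (e , p)) → thread e , p })
                  (λ { (plain e , p) → inj₁ (e , p) ; (thread e , p) → inj₂ (e , p) })
                  (any? (λ e → d (plain e)) ⊎-dec any? (λ e → d (thread e)))

module _ {n : ℕ} where

  infixl 20 _[_≔_]
  _[_≔_] : ∀ {A : Set} → (Fin n → A) → Fin n → A → Fin n → A
  (ψ [ o ≔ c ]) i with i ≟ o
  ... | yes _ = c
  ... | no  _ = ψ i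

  upd-same : ∀ {A : Set} (ψ : Fin n → A) o c → (ψ [ o ≔ c ]) o ≡ c
  upd-same ψ o c with o ≟ o
  ... | yes _ = refl
  ... | no ¬p = ⊥-elim (¬p refl)

  upd-other : ∀ {A : Set} (ψ : Fin n → A) {o i} c → i ≢ o → (ψ [ o ≔ c ]) i ≡ ψ i
  upd-other ψ {o} {i} c ne with i ≟ o
  ... | yes p = ⊥-elim (ne p)
  ... | no _  = refl

  ∅ : Fin n → Bool
  ∅ _ = false

  ins : Fin n → (Fin n → Bool) → Fin n → Bool
  ins u R = R [ u ≔ true ]

  ins-here : ∀ u R → ins u R u ≡ true
  ins-here u R = upd-same R u true

  ins-there : ∀ u R i → R i ≡ true → ins u R i ≡ true
  ins-there u R i h with i ≟ u
  ... | yes _ = refl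
  ... | no _  = h

  ins-case : ∀ u R i → ins u R i ≡ true → i ≡ u ⊎ (i ≢ u × R i ≡ true)
  ins-case u R i h with i ≟ u
  ... | yes p = inj₁ p
  ... | no p  = inj₂ (p , h)

  ins-out : ∀ u R i → ins u R i ≡ false → i ≢ u × R i ≡ false
  ins-out u R i h with i ≟ u
  ins-out u R i () | yes p
  ... | no p  = p , h

  out-ins : ∀ u R i → i ≢ u → R i ≡ false → ins u R i ≡ false
  out-ins u R i ne h = trans (upd-other R true ne) h

in≢out : ∀ {b : Bool} → b ≡ true → b ≡ false → ⊥
in≢out refl ()

inOrOut : (b : Bool) → b ≡ true ⊎ b ≡ false
inOrOut true = inj₁ refl
inOrOut false = inj₂ refl

not-pair : ∀ (c : Class) p → c ≢ (p , pos) → c ≢ (p , neg) → proj₁ c ≢ p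
not-pair (p , pos) _ n m refl = n refl
not-pair (p , neg) _ n m refl = m refl

choose-avoiding : ∀ k (d : Color) k₁ k₂ → ∃ λ a → (cls a ≢ k₁ × cls a ≢ k₂) × Sat k a d
choose-avoiding (plain e) d k₁ k₂ = neighbour-avoiding e d k₁ k₂
choose-avoiding (thread e) d k₁ k₂ with avoid (k₁ ∷ k₂ ∷ tcls e d ∷ []) (ℕ.≤ᵇ⇒≤ 4 6 tt)
... | u , n₁ ∷ n₂ ∷ n₃ ∷ [] = (u , false) , (n₁ , n₂) , tcls-sat e (u , false) d n₃

module Critical {n : ℕ} (Edge : Fin n → Fin n → Kind → Set)
  (edge-sym : ∀ {i j k} → Edge i j k → Edge j i k)
  (edge-irr : ∀ {i j k} → Edge i j k → i ≢ j)
  (edge? : ∀ i j k → Dec (Edge i j k))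
  (crit : ∀ {v j k} → Edge v j k → ∃ λ (φ : Fin n → Color) → ∀ i j k → i ≢ v → j ≢ v → Edge i j k → Sat k (φ i) (φ j))
  (noncol : ¬ ∃ λ (φ : Fin n → Color) → ∀ i j k → Edge i j k → Sat k (φ i) (φ j))
  where

  Region : Set
  Region = Fin n → Bool

  Coloring : Set
  Coloring = Fin n → Color

  Extendable : Region → Coloring → Set
  Extendable R ψ = ∃ λ (χ : Coloring) → (∀ i → R i ≡ false → χ i ≡ ψ i) ×
    (∀ r j k → R r ≡ true → Edge r j k → Sat k (χ r) (χ j))

  irreducible : ∀ {R v j k} → R v ≡ true → Edge v j k → (∀ ψ → Extendable R ψ) → ⊥
  irreducible {R} {v} Rv e ext with crit e
  ... | φ , ok with ext φ
  ... | χ , off , sats = noncol (χ , valid)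
    where
    valid : ∀ i j k → Edge i j k → Sat k (χ i) (χ j)
    valid i j k ij with inOrOut (R i) | inOrOut (R j)
    ... | inj₁ Ri | _       = sats i j k Ri ij
    ... | inj₂ _  | inj₁ Rj = sat-sym k (χ j) (χ i) (sats j i k Rj (edge-sym ij))
    ... | inj₂ ¬i | inj₂ ¬j rewrite off i ¬i | off j ¬j =
      ok i j k (λ { refl → in≢out Rv ¬i }) (λ { refl → in≢out Rv ¬j }) ij

  Main : Fin n → Fin n → Sign → Fin n → Fin n → Kind → Set
  Main v z e r j k = r ≡ v × j ≡ z × k ≡ plain e

  main? : ∀ v z e r j k → Dec (Main v z e r j k)
  main? v z e r j k = (r ≟ v) ×-dec (j ≟ z) ×-dec (k ≟ᵏⁱ plain e)

  -- R can be coloured around ψ when v sees the colour c across its edge to z, while all other edges from R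
  -- to z see ψ z.  Keeping c apart from ψ z makes the statements below independent of whether R touches z again.
  Ext : Region → Fin n → Fin n → Sign → Coloring → Color → Set
  Ext R v z e ψ c = ∃ λ (χ : Coloring) → (∀ i → R i ≡ false → χ i ≡ ψ i) ×
    (∀ r j k → R r ≡ true → Edge r j k → Main v z e r j k ⊎ Sat k (χ r) (χ j)) ×
    Sat (plain e) (χ v) c

  Touch : Region → Fin n → Fin n → Sign → Fin n → Set
  Touch R v z e o = ∃₂ λ r k → R r ≡ true × Edge r o k × ¬ Main v z e r o k

  touch? : ∀ R v z e o → Dec (Touch R v z e o)
  touch? R v z e o = F.any? λ r → anyKind? λ k → (R r ≟ᵇ true) ×-dec edge? r o k ×-dec ¬? (main? v z e r o k)

  ThreadOnly : Region → Fin n → Fin n → Sign → Fin n → Set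
  ThreadOnly R v z e o = ∀ r k → R r ≡ true → Edge r o k → ¬ Main v z e r o k → ∃ λ θ → k ≡ thread θ

  -- A vertex of degree 3 with its complete list of constraints.
  record Node (u a : Fin n) (e : Sign) (b : Fin n) (f : Sign) (c : Fin n) (k : Kind) : Set where
    field
      edge₁ : Edge u a (plain e)
      edge₂ : Edge u b (plain f)
      edge₃ : Edge u c k
      -- `c` may still equal `a` or `b`: a thread can run parallel to an edge.
      a≢b   : a ≢ b
      only  : ∀ j k' → Edge u j k' → (j ≡ a × k' ≡ plain e) ⊎ (j ≡ b × k' ≡ plain f) ⊎ (j ≡ c × k' ≡ k)
  open Node

  swap : ∀ {u a e b f c k} → Node u a e b f c k → Node u b f a e c k
  swap N = record
    { edge₁ = edge₂ N ; edge₂ = edge₁ N ; edge₃ = edge₃ N ; a≢b = ≢-sym (a≢b N)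
    ; only = λ j k' e → rot (only N j k' e) }
    where
    rot : ∀ {A B C : Set} → A ⊎ B ⊎ C → B ⊎ A ⊎ C
    rot (inj₁ x) = inj₂ (inj₁ x)
    rot (inj₂ (inj₁ x)) = inj₁ x
    rot (inj₂ (inj₂ x)) = inj₂ (inj₂ x)

  Cubic : Fin n → Set
  Cubic o = ∃ λ a → ∃ λ e → ∃ λ b → ∃ λ f → ∃ λ c → ∃ λ k → Node o a e b f c k

  IsY : Fin n → Fin n → Sign → Fin n → Sign → Fin n → Sign → Set
  IsY u a e b f o θ = Node u a e b f o (thread θ)

  IsX : Fin n → Fin n → Sign → Fin n → Sign → Fin n → Sign → Set
  IsX u a e b f c g = Node u a e b f c (plain g) × a ≢ c × b ≢ c

  swapX : ∀ {u a e b f c g} → IsX u a e b f c g → IsX u b f a e c g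
  swapX (N , p , q) = swap N , q , p

  rotX : ∀ {u a e b f c g} → IsX u a e b f c g → IsX u b f c g a e
  rotX (N , p , q) = record
    { edge₁ = edge₂ N ; edge₂ = edge₃ N ; edge₃ = edge₁ N ; a≢b = q
    ; only = λ j k' e → rot (only N j k' e) } , ≢-sym (a≢b N) , ≢-sym p
    where
    rot : ∀ {A B C : Set} → A ⊎ B ⊎ C → B ⊎ C ⊎ A
    rot (inj₁ x) = inj₂ (inj₂ x)
    rot (inj₂ (inj₁ x)) = inj₁ x
    rot (inj₂ (inj₂ x)) = inj₂ (inj₁ x)

  -- Recolouring a region around fixed outside colours

  empty : ∀ ψ → Extendable ∅ ψ
  empty ψ = ψ , (λ i _ → refl) , λ r j k ()

  -- `b` is coloured before `R` is extended, so the extension already respects the edges between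
  -- them. Only the edges from `b` that leave both remain to be checked.
  absorb : ∀ {R ψ b} c → R b ≡ false → Extendable R (ψ [ b ≔ c ]) →
    (∀ j k → Edge b j k → R j ≡ false → Sat k c (ψ j)) → Extendable (ins b R) ψ
  absorb {R} {ψ} {b} c Rb (χ , off , sats) h = χ , off' , sats'
    where
    χb : χ b ≡ c
    χb = trans (off b Rb) (upd-same ψ b c)
    off' : ∀ i → ins b R i ≡ false → χ i ≡ ψ i
    off' i q = let ne , o = ins-out b R i q in trans (off i o) (upd-other ψ c ne)
    sats' : ∀ r j k → ins b R r ≡ true → Edge r j k → Sat k (χ r) (χ j)
    sats' r j k q ed with ins-case b R r q
    ... | inj₂ (_ , Rr) = sats r j k Rr ed
    ... | inj₁ refl with inOrOut (R j)
    ... | inj₁ Rj = sat-sym k (χ j) (χ r) (sats j r k Rj (edge-sym ed))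
    ... | inj₂ ¬j rewrite χb | off j ¬j | upd-other ψ c (≢-sym (edge-irr ed)) = h j k ed ¬j

  absorbExt : ∀ {R v z e ψ d b} c → R b ≡ false → b ≢ z → Ext R v z e (ψ [ b ≔ c ]) d →
    (∀ j k → Edge b j k → R j ≡ false → Sat k c (ψ j)) → Ext (ins b R) v z e ψ d
  absorbExt {R} {v} {z} {e} {ψ} {d} {b} c Rb b≢z (χ , off , sats , hit) h = χ , off' , sats' , hit
    where
    χb : χ b ≡ c
    χb = trans (off b Rb) (upd-same ψ b c)
    off' : ∀ i → ins b R i ≡ false → χ i ≡ ψ i
    off' i q = let ne , o = ins-out b R i q in trans (off i o) (upd-other ψ c ne)
    sats' : ∀ r j k → ins b R r ≡ true → Edge r j k → Main v z e r j k ⊎ Sat k (χ r) (χ j)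
    sats' r j k q ed with ins-case b R r q
    ... | inj₂ (_ , Rr) = sats r j k Rr ed
    ... | inj₁ refl with inOrOut (R j)
    ... | inj₂ ¬j rewrite χb | off j ¬j | upd-other ψ c (≢-sym (edge-irr ed)) = inj₂ (h j k ed ¬j)
    ... | inj₁ Rj with sats j r k Rj (edge-sym ed)
    ...   | inj₁ (_ , p , _) = ⊥-elim (b≢z p)
    ...   | inj₂ s = inj₂ (sat-sym k (χ j) (χ r) s)

  single : ∀ {v z e ψ c} a → Sat (plain e) a c →
    (∀ j k → Edge v j k → (j ≡ z × k ≡ plain e) ⊎ Sat k a (ψ j)) → Ext (ins v ∅) v z e ψ c
  single {v} {z} {e} {ψ} {c} a s h = ψ [ v ≔ a ] , off , sats , subst (λ x → Sat (plain e) x c) (sym (upd-same ψ v a)) s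
    where
    off : ∀ i → ins v ∅ i ≡ false → (ψ [ v ≔ a ]) i ≡ ψ i
    off i q = upd-other ψ a (proj₁ (ins-out v ∅ i q))
    sats : ∀ r j k → ins v ∅ r ≡ true → Edge r j k → Main v z e r j k ⊎ Sat k ((ψ [ v ≔ a ]) r) ((ψ [ v ≔ a ]) j)
    sats r j k q ed with ins-case v ∅ r q
    ... | inj₂ (_ , ())
    ... | inj₁ refl rewrite upd-same ψ r a | upd-other ψ a (≢-sym (edge-irr ed)) with h j k ed
    ...   | inj₁ (p , q') = inj₁ (refl , p , q')
    ...   | inj₂ t = inj₂ t

  -- As `z` and `j₃` lie outside `R`, the only edge between `u` and `R` is the one to `v`, across
  -- which `R` has been told the colour `a`.
  extend : ∀ {R v u e z f j₃ k₃ ψ c} a → Node u v e z f j₃ k₃ → R v ≡ true → R u ≡ false → R z ≡ false → R j₃ ≡ false →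
    Sat (plain f) a c → Sat k₃ a (ψ j₃) → Ext R v u e ψ a → Ext (ins u R) u z f ψ c
  extend {R} {v} {u} {e} {z} {f} {j₃} {k₃} {ψ} {c} a N Rv Ru Rz R₃ sc s₃ (χ , off , sats , hit) =
    χ [ u ≔ a ] , off' , sats' , subst (λ x → Sat (plain f) x c) (sym (upd-same χ u a)) sc
    where
    off' : ∀ i → ins u R i ≡ false → (χ [ u ≔ a ]) i ≡ ψ i
    off' i q = let ne , o = ins-out u R i q in trans (upd-other χ a ne) (off i o)
    hit' : Sat (plain e) ((χ [ u ≔ a ]) v) ((χ [ u ≔ a ]) u)
    hit' rewrite upd-same χ u a | upd-other χ {u} {v} a (λ { refl → in≢out Rv Ru }) = hit
    sats' : ∀ r j k → ins u R r ≡ true → Edge r j k → Main u z f r j k ⊎ Sat k ((χ [ u ≔ a ]) r) ((χ [ u ≔ a ]) j)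
    sats' r j k q ed with ins-case u R r q
    sats' r j k q ed | inj₁ refl with only N j k ed
    ... | inj₁ (refl , refl) = inj₂ (sat-sym k ((χ [ u ≔ a ]) v) ((χ [ u ≔ a ]) u) hit')
    ... | inj₂ (inj₁ (refl , refl)) = inj₁ (refl , refl , refl)
    ... | inj₂ (inj₂ (refl , refl)) rewrite upd-same χ r a | upd-other χ a (≢-sym (edge-irr ed)) | off j R₃ = inj₂ s₃
    sats' r j k q ed | inj₂ (ne , Rr) with j ≟ u
    ... | yes refl with only N r k (edge-sym ed)
    ...   | inj₁ (refl , refl) = inj₂ (subst (λ x → Sat k x a) (sym (upd-other χ a ne)) hit)
    ...   | inj₂ (inj₁ (refl , refl)) = ⊥-elim (in≢out Rr Rz)
    ...   | inj₂ (inj₂ (refl , refl)) = ⊥-elim (in≢out Rr R₃)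
    sats' r j k q ed | inj₂ (ne , Rr) | no j≢u rewrite upd-other χ a ne with sats r j k Rr ed
    ... | inj₁ (_ , p , _) = ⊥-elim (j≢u p)
    ... | inj₂ s = inj₂ s

  -- If `R` sees `o` at all, then across its main edge, and there it uses `c` in place of `ψ o`.
  independent : ∀ {R v z e ψ c o} d → R v ≡ true → ¬ Touch R v z e o → R o ≡ false → Ext R v z e ψ c → Ext R v z e (ψ [ o ≔ d ]) c
  independent {R} {v} {z} {e} {ψ} {c} {o} d Rv ¬t Ro (χ , off , sats , hit) = χ [ o ≔ d ] , off' , sats' , hit'
    where
    off' : ∀ i → R i ≡ false → (χ [ o ≔ d ]) i ≡ (ψ [ o ≔ d ]) i
    off' i q with i ≟ o
    ... | yes _ = refl
    ... | no _ = off i q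
    sats' : ∀ r j k → R r ≡ true → Edge r j k → Main v z e r j k ⊎ Sat k ((χ [ o ≔ d ]) r) ((χ [ o ≔ d ]) j)
    sats' r j k Rr ed with j ≟ o
    ... | yes refl with main? v z e r j k
    ...   | yes m = inj₁ m
    ...   | no ¬m = ⊥-elim (¬t (r , k , Rr , ed , ¬m))
    sats' r j k Rr ed | no _ rewrite upd-other χ {o} {r} d (λ { refl → in≢out Rr Ro }) = sats r j k Rr ed
    hit' : Sat (plain e) ((χ [ o ≔ d ]) v) c
    hit' with v ≟ o
    ... | no _ = hit
    ... | yes refl = ⊥-elim (in≢out Rv Ro)

  close : ∀ {R v z e ψ c} → R z ≡ false → ψ z ≡ c → Ext R v z e ψ c → Extendable R ψ
  close {R} {v} {z} {e} {ψ} {c} Rz refl (χ , off , sats , hit) = χ , off , sats'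
    where
    sats' : ∀ r j k → R r ≡ true → Edge r j k → Sat k (χ r) (χ j)
    sats' r j k Rr ed with sats r j k Rr ed
    ... | inj₁ (refl , refl , refl) rewrite off j Rz = hit
    ... | inj₂ s = s

  -- Mid and Src say how little a path with vertex set R forbids at its next vertex, after a Y and after an X
  -- respectively.  The pend fields describe an outside vertex o that R meets again: except for two classes
  -- of its colour (of one pair, if it is met by threads only), R forbids one class fewer than in general.
  record Mid (R : Region) (y z : Fin n) (e : Sign) : Set where
    field
      inR  : R y ≡ true
      out  : R z ≡ false
      edge : Edge y z (plain e)
      weak : ∀ ψ → ∃ λ κ → ∀ c → cls c ≢ κ → Ext R y z e ψ c
      pend : ∀ o → R o ≡ false → Cubic o → Touch R y z e o → ∀ ψ → ∃₂ λ k₁ k₂ →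
        (ThreadOnly R y z e o → proj₁ k₁ ≡ proj₁ k₂) ×
        (∀ d → cls d ≢ k₁ → cls d ≢ k₂ → ∀ c → Ext R y z e (ψ [ o ≔ d ]) c)

  record Src (R : Region) (v y : Fin n) (e : Sign) : Set where
    field
      inR  : R v ≡ true
      out  : R y ≡ false
      edge : Edge v y (plain e)
      semi : ∀ ψ → ∃₂ λ k₁ k₂ → ∀ c → cls c ≢ k₁ → cls c ≢ k₂ → Ext R v y e ψ c
      pend : ∀ o → R o ≡ false → Cubic o → Touch R v y e o → ∀ ψ → ∃₂ λ k₁ k₂ →
        (ThreadOnly R v y e o → proj₁ k₁ ≡ proj₁ k₂) ×
        (∀ d → cls d ≢ k₁ → cls d ≢ k₂ → ∃ λ κ → ∀ c → cls c ≢ κ → Ext R v y e (ψ [ o ≔ d ]) c)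
      -- Here `y` is both the next vertex and the one met again. Its colour `d` must itself avoid
      -- `κ`, so `κ` is fixed before `d`.
      pend-main : Cubic y → Touch R v y e y → ∀ ψ → ∃₂ λ k₁ k₂ → ∃ λ κ →
        (ThreadOnly R v y e y → proj₁ k₁ ≡ proj₁ k₂) ×
        (∀ d → cls d ≢ k₁ → cls d ≢ k₂ → ∀ c → cls c ≢ κ → Ext R v y e (ψ [ y ≔ d ]) c)

  -- The single constraint of `o` outside `R` leaves at least three classes, hence a colour outside
  -- `k₁` and `k₂`. With that colour at `o` the region extends whatever the colour of `z`.
  touched-irreducible : ∀ {R y z e o l k} → Mid R y z e → R o ≡ false → Cubic o → Touch R y z e o →
    (∀ j k' → Edge o j k' → R j ≡ true ⊎ (j ≡ l × k' ≡ k)) → ⊥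
  touched-irreducible {R} {y} {z} {e} {o} {l} {k} M Ro cub t h =
    irreducible {ins o R} (ins-here o R) (edge-sym (proj₁ (proj₂ (proj₂ (proj₂ t))))) ext
    where
    open Mid M
    ext : ∀ ψ → Extendable (ins o R) ψ
    ext ψ with pend o Ro cub t ψ
    ... | k₁ , k₂ , _ , f with choose-avoiding k (ψ l) k₁ k₂
    ... | a , (n₁ , n₂) , s = absorb a Ro (close out refl (f a n₁ n₂ _)) sats
      where
      sats : ∀ j k' → Edge o j k' → R j ≡ false → Sat k' a (ψ j)
      sats j k' ed ¬j with h j k' ed
      ... | inj₁ Rj = ⊥-elim (in≢out Rj ¬j)
      ... | inj₂ (refl , refl) = s

  touched-next : ∀ {R y z e p f q k} → Mid R y z e → Node z y e p f q k → Touch R y z e z → ⊥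
  touched-next {R} {y} {z} {e} {p} {f} {q} {k} M N t@(r , k' , Rr , ed , ¬m) with only N r k' (edge-sym ed)
  ... | inj₁ (refl , refl) = ¬m (refl , refl , refl)
  ... | inj₂ (inj₁ (refl , refl)) = touched-irreducible {l = q} {k = k} M (Mid.out M) (_ , _ , _ , _ , _ , _ , N) t h
    where
    h : ∀ j k' → Edge z j k' → R j ≡ true ⊎ (j ≡ q × k' ≡ k)
    h j k' ed with only N j k' ed
    ... | inj₁ (refl , _) = inj₁ (Mid.inR M)
    ... | inj₂ (inj₁ (refl , _)) = inj₁ Rr
    ... | inj₂ (inj₂ x) = inj₂ x
  ... | inj₂ (inj₂ (refl , refl)) = touched-irreducible {l = p} {k = plain f} M (Mid.out M) (_ , _ , _ , _ , _ , _ , N) t h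
    where
    h : ∀ j k' → Edge z j k' → R j ≡ true ⊎ (j ≡ p × k' ≡ plain f)
    h j k' ed with only N j k' ed
    ... | inj₁ (refl , _) = inj₁ (Mid.inR M)
    ... | inj₂ (inj₁ x) = inj₂ x
    ... | inj₂ (inj₂ (refl , _)) = inj₁ Rr

  -- One step along a path

  untouched-out : ∀ {R v z e p k} → ¬ Touch R v z e z → Edge z p k → ¬ Main v z e p z k → R p ≡ false
  untouched-out {R} {v} {z} {e} {p} {k} ¬t ed ¬m with inOrOut (R p)
  ... | inj₁ Rp = ⊥-elim (¬t (p , k , Rp , edge-sym ed , ¬m))
  ... | inj₂ o = o

  new-touch : ∀ {R v u e z f j k o} → Node u v e z f j k → R v ≡ true → R o ≡ false → o ≢ u →
    Touch (ins u R) u z f o → ¬ Touch R v u e o → ∃ λ k' → k' ≡ k × o ≡ j × Edge u o k' × ¬ Main u z f u o k'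
  new-touch {R} {v} {u} {e} {z} {f} {j} {k} {o} N Rv Ro o≢u (r , k' , q , ed , ¬m) ¬t with ins-case u R r q
  ... | inj₂ (_ , Rr) = ⊥-elim (¬t (r , k' , Rr , ed , λ { (_ , p , _) → o≢u p }))
  ... | inj₁ refl with only N o k' ed
  ...   | inj₁ (refl , _) = ⊥-elim (in≢out Rv Ro)
  ...   | inj₂ (inj₁ (refl , refl)) = ⊥-elim (¬m (refl , refl , refl))
  ...   | inj₂ (inj₂ (refl , refl)) = k' , refl , refl , ed , ¬m

  thread-only-shrink : ∀ {R v u e z f o} → R u ≡ false → o ≢ u → ThreadOnly (ins u R) u z f o → ThreadOnly R v u e o
  thread-only-shrink {R} {u = u} Ru _ to r k Rr ed ¬m = to r k (ins-there u R r Rr) ed λ { (refl , _) → in≢out Rr Ru }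

  -- The colour of `y` must avoid `k₁`, `k₂` and `κ`. If `z` lies in `R`, the thread is the only
  -- other constraint and at most four classes are lost. If not, `y` is met by its thread only, so
  -- `k₁` and `k₂` share a pair; of the classes left by `z`, one in each pair, one avoids both that
  -- pair and `κ`. This is the purpose of the `ThreadOnly` clauses.
  src-touched : ∀ {R v y e z f o θ} → Src R v y e → Node y v e z f o (thread θ) → Touch R v y e y → ⊥
  src-touched {R} {v} {y} {e} {z} {f} {o} {θ} S N t = irreducible {ins y R} (ins-here y R) (edge₁ N) ext
    where
    open Src S
    pair-avoid : ∀ {k₁ k₂ : Class} (a : Color) → proj₁ k₁ ≡ proj₁ k₂ → proj₁ (cls a) ≢ proj₁ k₁ → cls a ≢ k₁ × cls a ≢ k₂
    pair-avoid a q n = (λ { refl → n refl }) , λ { refl → n (sym q) }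
    ext : ∀ ψ → Extendable (ins y R) ψ
    ext ψ with pend-main (_ , _ , _ , _ , _ , _ , N) t ψ
    ... | k₁ , k₂ , κ , flag , F with inOrOut (R z)
    ... | inj₁ Rz with avoid (k₁ ∷ k₂ ∷ κ ∷ tcls θ (ψ o) ∷ []) (ℕ.≤ᵇ⇒≤ 5 6 tt)
    ...   | u , n₁ ∷ n₂ ∷ n₃ ∷ n₄ ∷ [] = absorb a out (close out (upd-same ψ y a) (F a n₁ n₂ a n₃)) sats
      where
      a : Color
      a = u , false
      sats : ∀ j k → Edge y j k → R j ≡ false → Sat k a (ψ j)
      sats j k ed ¬j with only N j k ed
      ... | inj₁ (refl , _) = ⊥-elim (in≢out inR ¬j)
      ... | inj₂ (inj₁ (refl , _)) = ⊥-elim (in≢out Rz ¬j)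
      ... | inj₂ (inj₂ (refl , refl)) = tcls-sat θ a (ψ j) n₄
    ext ψ | k₁ , k₂ , κ , flag , F | inj₂ ¬z with neighbour-avoiding-pair f (ψ z) (proj₁ k₁) κ
    ... | a , (n , n') , s = absorb a out (close out (upd-same ψ y a) (F a (proj₁ av) (proj₂ av) a n')) sats
      where
      thread-only : ThreadOnly R v y e y
      thread-only r k Rr ed ¬m with only N r k (edge-sym ed)
      ... | inj₁ (refl , refl) = ⊥-elim (¬m (refl , refl , refl))
      ... | inj₂ (inj₁ (refl , refl)) = ⊥-elim (in≢out Rr ¬z)
      ... | inj₂ (inj₂ (refl , refl)) = θ , refl
      Ro : R o ≡ true
      Ro with only N (proj₁ t) (proj₁ (proj₂ t)) (edge-sym (proj₁ (proj₂ (proj₂ (proj₂ t)))))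
      ... | inj₁ (refl , refl) = ⊥-elim (proj₂ (proj₂ (proj₂ (proj₂ t))) (refl , refl , refl))
      ... | inj₂ (inj₁ (refl , _)) = ⊥-elim (in≢out (proj₁ (proj₂ (proj₂ t))) ¬z)
      ... | inj₂ (inj₂ (refl , _)) = proj₁ (proj₂ (proj₂ t))
      av : cls a ≢ k₁ × cls a ≢ k₂
      av = pair-avoid a (flag thread-only) n
      sats : ∀ j k → Edge y j k → R j ≡ false → Sat k a (ψ j)
      sats j k ed ¬j with only N j k ed
      ... | inj₁ (refl , _) = ⊥-elim (in≢out inR ¬j)
      ... | inj₂ (inj₁ (refl , refl)) = s
      ... | inj₂ (inj₂ (refl , _)) = ⊥-elim (in≢out Ro ¬j)

  -- If `R` met `o` before, a good colour there frees `z` from `R`, and beside `q` it forbids one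
  -- class. If `o` is met for the first time, then `o` is `q`, and outside two classes of its colour
  -- the loss of `κ` costs nothing. For `pend-main` the second case cannot occur, the neighbours of
  -- an X being distinct.
  to-src : ∀ {R y z e p f q g} → Mid R y z e → IsX z y e p f q g → ¬ Touch R y z e z → Src (ins z R) z p f
  to-src {R} {y} {z} {e} {p} {f} {q} {g} M (N , y≢q , p≢q) ¬tz = record
    { inR = ins-here z R
    ; out = out-ins z R p (≢-sym (edge-irr (edge₂ N))) Rp
    ; edge = edge₂ N
    ; semi = λ ψ → let κ , w = M.weak ψ ; k₁ , k₂ , m = msg-neighbour-avoid g (ψ q) κ f in
        k₁ , k₂ , λ c n n' → let a , (na , s₃) , s = m c n n' in ext a s s₃ (w a na)
    ; pend = λ o Ro' cub t ψ → pend' o Ro' cub t ψ (touch? R y z e o)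
    ; pend-main = λ cub t ψ → pend-main' cub t ψ (touch? R y z e p) }
    where
    module M = Mid M
    Rp : R p ≡ false
    Rp = untouched-out ¬tz (edge₂ N) (λ { (refl , _) → a≢b N refl })
    Rq : R q ≡ false
    Rq = untouched-out ¬tz (edge₃ N) (λ { (refl , _) → y≢q refl })
    ext : ∀ {ψ c} a → Sat (plain f) a c → Sat (plain g) a (ψ q) → Ext R y z e ψ a → Ext (ins z R) z p f ψ c
    ext a s s₃ x = extend a N M.inR M.out Rp Rq s s₃ x
    pend' : ∀ o → ins z R o ≡ false → Cubic o → Touch (ins z R) z p f o → ∀ ψ → Dec (Touch R y z e o) → ∃₂ λ k₁ k₂ →
        (ThreadOnly (ins z R) z p f o → proj₁ k₁ ≡ proj₁ k₂) ×
        (∀ d → cls d ≢ k₁ → cls d ≢ k₂ → ∃ λ κ → ∀ c → cls c ≢ κ → Ext (ins z R) z p f (ψ [ o ≔ d ]) c)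
    pend' o Ro' cub t ψ (yes t') with ins-out z R o Ro'
    ... | o≢z , Ro with M.pend o Ro cub t' ψ
    ... | k₁ , k₂ , flag , F = k₁ , k₂ , (λ to → flag (thread-only-shrink M.out o≢z to)) , λ d n n' →
      let κ , m = msg-neighbour g ((ψ [ o ≔ d ]) q) f in κ , λ c nc → let a , s₃ , s = m c nc in ext a s s₃ (F d n n' a)
    pend' o Ro' cub t ψ (no ¬t') with ins-out z R o Ro'
    ... | o≢z , Ro with new-touch N M.inR Ro o≢z t ¬t' | M.weak ψ
    ... | _ , refl , refl , ed , ¬m | κ , w with msg-neighbour-pending κ g f
    ... | k₁ , k₂ , m = k₁ , k₂ , (λ to → ⊥-elim (absurd (to z (plain g) (ins-here z R) ed ¬m))) , λ d n n' →
      let κ' , m' = m d n n' in κ' , λ c nc → let a , (na , s₃) , s = m' c nc in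
        ext a s (subst (Sat (plain g) a) (sym (upd-same ψ o d)) s₃) (independent d M.inR ¬t' Ro (w a na))
      where
      absurd : (∃ λ θ → plain g ≡ thread θ) → ⊥
      absurd (_ , ())
    pend-main' : Cubic p → Touch (ins z R) z p f p → ∀ ψ → Dec (Touch R y z e p) → ∃₂ λ k₁ k₂ → ∃ λ κ →
        (ThreadOnly (ins z R) z p f p → proj₁ k₁ ≡ proj₁ k₂) ×
        (∀ d → cls d ≢ k₁ → cls d ≢ k₂ → ∀ c → cls c ≢ κ → Ext (ins z R) z p f (ψ [ p ≔ d ]) c)
    pend-main' cub t ψ (yes t') with M.pend p Rp cub t' ψ | msg-neighbour g (ψ q) f
    ... | k₁ , k₂ , flag , F | κ , m = k₁ , k₂ , κ ,
      (λ to → flag (thread-only-shrink M.out (≢-sym (edge-irr (edge₂ N))) to)) , λ d n n' c nc →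
        let a , s₃ , s = m c nc in ext a s (subst (Sat (plain g) a) (sym (upd-other ψ d (≢-sym p≢q))) s₃) (F d n n' a)
    pend-main' cub t ψ (no ¬t') with new-touch N M.inR Rp (≢-sym (edge-irr (edge₂ N))) t ¬t'
    ... | _ , _ , p≡q , _ = ⊥-elim (p≢q p≡q)

  next-src : ∀ {R y z e p f q g} → Mid R y z e → IsX z y e p f q g → Src (ins z R) z p f
  next-src {R} {y} {z} {e} M X with touch? R y z e z
  ... | yes t = ⊥-elim (touched-next M (proj₁ X) t)
  ... | no ¬t = to-src M X ¬t

  -- If `x` was met before, a good colour there reduces the loss at `y` to one class and the one of
  -- the thread, and four free classes forbid nothing. A new meeting is the end of the thread
  -- itself; its two exceptional classes fill one pair.
  to-mid : ∀ {R v y e z f o θ} → Src R v y e → Node y v e z f o (thread θ) → ¬ Touch R v y e y → Mid (ins y R) y z f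
  to-mid {R} {v} {y} {e} {z} {f} {o} {θ} S N ¬ty = record
    { inR = ins-here y R
    ; out = out-ins y R z (≢-sym (edge-irr (edge₂ N))) Rz
    ; edge = edge₂ N
    ; weak = λ ψ → let k₁ , k₂ , sm = S.semi ψ ; κ , m = msg-avoid₃ k₁ k₂ (tcls θ (ψ o)) f in
        κ , λ c n → let a , (n₁ , n₂ , n₃) , s = m c n in ext a s (tcls-sat θ a (ψ o) n₃) (sm a n₁ n₂)
    ; pend = λ x Rx' cub t ψ → pend' x Rx' cub t ψ (touch? R v y e x) }
    where
    module S = Src S
    Rz : R z ≡ false
    Rz = untouched-out ¬ty (edge₂ N) (λ { (refl , _) → a≢b N refl })
    Ro : R o ≡ false
    Ro = untouched-out ¬ty (edge₃ N) (λ { (_ , _ , ()) })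
    ext : ∀ {ψ c} a → Sat (plain f) a c → Sat (thread θ) a (ψ o) → Ext R v y e ψ a → Ext (ins y R) y z f ψ c
    ext a s s₃ x = extend a N S.inR S.out Rz Ro s s₃ x
    pend' : ∀ x → ins y R x ≡ false → Cubic x → Touch (ins y R) y z f x → ∀ ψ → Dec (Touch R v y e x) → ∃₂ λ k₁ k₂ →
        (ThreadOnly (ins y R) y z f x → proj₁ k₁ ≡ proj₁ k₂) ×
        (∀ d → cls d ≢ k₁ → cls d ≢ k₂ → ∀ c → Ext (ins y R) y z f (ψ [ x ≔ d ]) c)
    pend' x Rx' cub t ψ (yes t') with ins-out y R x Rx'
    ... | x≢y , Rx with S.pend x Rx cub t' ψ
    ... | k₁ , k₂ , flag , F = k₁ , k₂ , (λ to → flag (thread-only-shrink S.out x≢y to)) , λ d n n' c →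
      let κ , G = F d n n' ; a , (n₁ , n₂) , s = msg-avoid₂ κ (tcls θ ((ψ [ x ≔ d ]) o)) f c
      in ext a s (tcls-sat θ a ((ψ [ x ≔ d ]) o) n₂) (G a n₁)
    pend' x Rx' cub t ψ (no ¬t') with ins-out y R x Rx'
    ... | x≢y , Rx with new-touch N S.inR Rx x≢y t ¬t' | S.semi ψ
    ... | _ , refl , refl , ed , ¬m | k₁ , k₂ , sm with msg-avoid₃-pending k₁ k₂ f
    ... | p₀ , m = (p₀ , pos) , (p₀ , neg) , (λ _ → refl) , λ d n n' c →
      let a , (n₁ , n₂ , n₃) , s = m (tcls θ d) (not-pair (cls d) p₀ n n') c in
        ext a s (subst (Sat (thread θ) a) (sym (upd-same ψ x d)) (tcls-sat θ a d n₃)) (independent d S.inR ¬t' Rx (sm a n₁ n₂))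

  next-mid : ∀ {R v y e z f o θ} → Src R v y e → Node y v e z f o (thread θ) → Mid (ins y R) y z f
  next-mid {R} {v} {y} {e} S N with touch? R v y e y
  ... | yes t = ⊥-elim (src-touched S N t)
  ... | no ¬t = to-mid S N ¬t

  -- The coloured `p` leaves three classes at `z`; the path takes one and the thread another.
  meets-Y : ∀ {R y z e p f o θ} → Mid R y z e → IsY z y e p f o θ → ⊥
  meets-Y {R} {y} {z} {e} {p} {f} {o} {θ} M N with touch? R y z e z
  ... | yes t = touched-next M N t
  ... | no ¬t = irreducible {ins z R} (ins-here z R) (edge₁ N) ext
    where
    open Mid M
    ext : ∀ ψ → Extendable (ins z R) ψ
    ext ψ with weak ψ
    ... | κ , w with neighbour-avoiding f (ψ p) κ (tcls θ (ψ o))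
    ... | a , (n₁ , n₂) , s = absorb a out (close out (upd-same ψ z a) (independent a inR ¬t out (w a n₁))) sats
      where
      sats : ∀ j k → Edge z j k → R j ≡ false → Sat k a (ψ j)
      sats j k ed ¬j with only N j k ed
      ... | inj₁ (refl , _) = ⊥-elim (in≢out inR ¬j)
      ... | inj₂ (inj₁ (refl , refl)) = s
      ... | inj₂ (inj₂ (refl , refl)) = tcls-sat θ a (ψ j) n₂

  Leaf : Coloring → Sign → Fin n → Sign → Fin n → Sign → Color → Set
  Leaf ψ f α θ o e X = ∃ λ A → Sat (plain f) A (ψ α) × Sat (thread θ) A (ψ o) × Sat (plain e) A X

  leaf-semi : ∀ ψ f α θ o e → ∃₂ λ k₁ k₂ → ∀ X → cls X ≢ k₁ → cls X ≢ k₂ → Leaf ψ f α θ o e X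
  leaf-semi ψ f α θ o e = let k₁ , k₂ , m = msg-neighbour-avoid f (ψ α) (tcls θ (ψ o)) e in k₁ , k₂ , λ X n n' →
    let A , (na , s) , s' = m X n n' in A , s , tcls-sat θ A (ψ o) na , s'

  -- The path forbids one class at `z` and each of the two leaves forbids two: five of six.
  meets-X : ∀ {R y z e c f d g γ h oc θ δ h' od θ'} → Mid R y z e → IsX z y e c f d g →
    IsY c z f γ h oc θ → IsY d z g δ h' od θ' → ⊥
  meets-X {R} {y} {z} {e} {c} {f} {d} {g} {γ} {h} {oc} {θ} {δ} {h'} {od} {θ'} M X@(N , y≢d , c≢d) Nc Nd
    with touch? R y z e z
  ... | yes t = touched-next M N t
  ... | no ¬tz with touch? (ins z R) z c f c | touch? (ins z R) z d g d
  ... | yes t | _ = src-touched (to-src M X ¬tz) Nc t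
  ... | no _ | yes t = src-touched (to-src M (rotX (swapX X)) ¬tz) Nd t
  ... | no ¬tc | no ¬td with anyKind? (edge? c d)
  -- The leaves see each other. The path prolonged through `z` and `c` then has two edges to `d`,
  -- which keeps one constraint outside.
  ... | yes (k , cd) = touched-irreducible {l = proj₁ far} {k = proj₁ (proj₂ far)} M₂ Rd (_ , _ , _ , _ , _ , _ , Nd)
          (z , plain g , ins-there c _ z (ins-here z R) , edge₃ N , λ { (p , _) → edge-irr (edge₂ N) p }) (proj₂ (proj₂ far))
    where
    R₁ R₂ : Region
    R₁ = ins z R
    R₂ = ins c R₁
    M₂ : Mid R₂ c γ h
    M₂ = to-mid (to-src M X ¬tz) Nc ¬tc
    Rd : R₂ d ≡ false
    Rd = out-ins c R₁ d (≢-sym c≢d) (out-ins z R d (≢-sym (edge-irr (edge₃ N)))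
           (untouched-out ¬tz (edge₃ N) (λ { (refl , _) → y≢d refl })))
    far : ∃₂ λ l k' → ∀ j k″ → Edge d j k″ → R₂ j ≡ true ⊎ (j ≡ l × k″ ≡ k')
    far with only Nd c k (edge-sym cd)
    ... | inj₁ (refl , _) = ⊥-elim (edge-irr (edge₂ N) refl)
    ... | inj₂ (inj₁ (refl , refl)) = od , thread θ' , λ j k″ ed → case j k″ (only Nd j k″ ed)
      where
      case : ∀ j k″ → _ → R₂ j ≡ true ⊎ (j ≡ od × k″ ≡ thread θ')
      case j k″ (inj₁ (refl , _)) = inj₁ (ins-there c _ z (ins-here z R))
      case j k″ (inj₂ (inj₁ (refl , _))) = inj₁ (ins-here c R₁)
      case j k″ (inj₂ (inj₂ x)) = inj₂ x
    ... | inj₂ (inj₂ (refl , refl)) = δ , plain h' , λ j k″ ed → case j k″ (only Nd j k″ ed)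
      where
      case : ∀ j k″ → _ → R₂ j ≡ true ⊎ (j ≡ δ × k″ ≡ plain h')
      case j k″ (inj₁ (refl , _)) = inj₁ (ins-there c _ z (ins-here z R))
      case j k″ (inj₂ (inj₁ x)) = inj₂ x
      case j k″ (inj₂ (inj₂ (refl , _))) = inj₁ (ins-here c R₁)
  ... | no ¬cd = irreducible {R₃} (ins-here d _) (edge₁ Nd) ext
    where
    module M = Mid M
    R₃ : Region
    R₃ = ins d (ins c (ins z R))
    Rc : R c ≡ false
    Rc = untouched-out ¬tz (edge₂ N) (λ { (refl , _) → a≢b N refl })
    Rd : R d ≡ false
    Rd = untouched-out ¬tz (edge₃ N) (λ { (refl , _) → y≢d refl })
    lower : ∀ {p k} → ¬ Touch (ins z R) z p k p → ¬ Touch R y z e p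
    lower ¬t (r , k , Rr , ed , _) = ¬t (r , k , ins-there z R r Rr , ed , λ { (refl , _) → in≢out Rr M.out })
    ext : ∀ ψ → Extendable R₃ ψ
    ext ψ with M.weak ψ | leaf-semi ψ h γ θ oc f | leaf-semi ψ h' δ θ' od g
    ... | κ , w | k₁ , k₂ , lc | k₃ , k₄ , ld with avoid (κ ∷ k₁ ∷ k₂ ∷ k₃ ∷ k₄ ∷ []) (ℕ.≤ᵇ⇒≤ 6 6 tt)
    ... | u , n₀ ∷ n₁ ∷ n₂ ∷ n₃ ∷ n₄ ∷ [] with lc (u , false) n₁ n₂ | ld (u , false) n₃ n₄
    ... | C , c₁ , c₂ , c₃ | D , d₁ , d₂ , d₃ =
      absorb D (out-ins c _ d (≢-sym c≢d) (out-ins z R d (≢-sym (edge-irr (edge₃ N))) Rd))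
        (absorb C (out-ins z R c (≢-sym (edge-irr (edge₂ N))) Rc)
          (absorb Z M.out (close M.out (upd-same _ z Z)
            (independent Z M.inR ¬tz M.out (independent C M.inR (lower ¬tc) Rc (independent D M.inR (lower ¬td) Rd (w Z n₀)))))
            satZ) satC) satD
      where
      Z : Color
      Z = u , false
      satZ : ∀ j k → Edge z j k → R j ≡ false → Sat k Z ((ψ [ d ≔ D ] [ c ≔ C ]) j)
      satZ j k ed ¬j with only N j k ed
      ... | inj₁ (refl , _) = ⊥-elim (in≢out M.inR ¬j)
      ... | inj₂ (inj₁ (refl , refl)) rewrite upd-same (ψ [ d ≔ D ]) j C = sat-sym (plain f) C Z c₃
      ... | inj₂ (inj₂ (refl , refl)) rewrite upd-other (ψ [ j ≔ D ]) C (≢-sym c≢d) | upd-same ψ j D = sat-sym (plain g) D Z d₃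
      satC : ∀ j k → Edge c j k → ins z R j ≡ false → Sat k C ((ψ [ d ≔ D ]) j)
      satC j k ed ¬j rewrite upd-other ψ {d} {j} D (λ { refl → ¬cd (k , ed) }) with only Nc j k ed
      ... | inj₁ (refl , _) = ⊥-elim (in≢out (ins-here z R) ¬j)
      ... | inj₂ (inj₁ (refl , refl)) = c₁
      ... | inj₂ (inj₂ (refl , refl)) = c₂
      satD : ∀ j k → Edge d j k → ins c (ins z R) j ≡ false → Sat k D (ψ j)
      satD j k ed ¬j with only Nd j k ed
      ... | inj₁ (refl , _) = ⊥-elim (in≢out (ins-there c _ z (ins-here z R)) ¬j)
      ... | inj₂ (inj₁ (refl , refl)) = d₁
      ... | inj₂ (inj₂ (refl , refl)) = d₂

  -- The two kinds of source

  thread-end-unique : ∀ {x o₁ θ₁ o₂ θ₂} → Cubic x → Edge x o₁ (thread θ₁) → Edge x o₂ (thread θ₂) → o₁ ≡ o₂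
  thread-end-unique (_ , _ , _ , _ , _ , _ , N) e₁ e₂ with only N _ _ e₁ | only N _ _ e₂
  ... | inj₂ (inj₂ (refl , refl)) | inj₂ (inj₂ (refl , _)) = refl
  ... | inj₁ (_ , ()) | _
  ... | inj₂ (inj₁ (_ , ())) | _
  ... | inj₂ (inj₂ _) | inj₁ (_ , ())
  ... | inj₂ (inj₂ _) | inj₂ (inj₁ (_ , ()))

  only-thread : ∀ {u a e b f o θ o' θ'} → IsY u a e b f o θ → Edge u o' (thread θ') → o' ≡ o × θ' ≡ θ
  only-thread N ed with only N _ _ ed
  ... | inj₁ (_ , ())
  ... | inj₂ (inj₁ (_ , ()))
  ... | inj₂ (inj₂ (refl , refl)) = refl , refl

  -- `y'` forbids two classes at `y` and the thread of `y` a third, so at most one is forbidden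
  -- beyond. If both Ys have the same neighbour of degree 2, their threads are one thread parallel
  -- to the edge, and nothing is forbidden.
  pair-mid : ∀ {y y' e z f o θ l g o' θ'} → IsY y y' e z f o θ → IsY y' y e l g o' θ' → Mid (ins y' (ins y ∅)) y z f
  pair-mid {y} {y'} {e} {z} {f} {o} {θ} {l} {g} {o'} {θ'} N N' = record
    { inR = ins-there y' _ y (ins-here y ∅)
    ; out = out-ins y' _ z (≢-sym (a≢b N)) (out-ins y ∅ z (≢-sym (edge-irr (edge₂ N))) refl)
    ; edge = edge₂ N
    ; weak = weak (o ≟ y')
    ; pend = λ x Rx cub t ψ → pend x Rx cub t ψ (o ≟ y') }
    where
    R : Region
    R = ins y' (ins y ∅)
    y≢y' : y ≢ y'
    y≢y' = edge-irr (edge₁ N)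
    ext : ∀ {ψ c} a a' → Sat (plain f) a c → Sat (plain e) a' a → (o ≢ y' → Sat (thread θ) a (ψ o)) →
      (o ≡ y' → Sat (thread θ) a' a) → Sat (plain g) a' (ψ l) → (o' ≢ y → Sat (thread θ') a' (ψ o')) → Ext R y z f ψ c
    ext {ψ} {c} a a' sc sa so so' sl st = absorbExt a' (out-ins y ∅ y' (≢-sym y≢y') refl) (a≢b N) (single a sc sats) sats'
      where
      sats : ∀ j k → Edge y j k → (j ≡ z × k ≡ plain f) ⊎ Sat k a ((ψ [ y' ≔ a' ]) j)
      sats j k ed with only N j k ed
      ... | inj₁ (refl , refl) rewrite upd-same ψ j a' = inj₂ (sat-sym (plain e) a' a sa)
      ... | inj₂ (inj₁ x) = inj₁ x
      ... | inj₂ (inj₂ (refl , refl)) with j ≟ y'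
      ...   | yes refl = inj₂ (sat-sym (thread θ) a' a (so' refl))
      ...   | no ne = inj₂ (so ne)
      sats' : ∀ j k → Edge y' j k → ins y ∅ j ≡ false → Sat k a' (ψ j)
      sats' j k ed ¬j with only N' j k ed
      ... | inj₁ (refl , _) = ⊥-elim (in≢out (ins-here y ∅) ¬j)
      ... | inj₂ (inj₁ (refl , refl)) = sl
      ... | inj₂ (inj₂ (refl , refl)) = st (λ { refl → in≢out (ins-here y ∅) ¬j })
    back-thread : o ≡ y' → o' ≡ y × θ' ≡ θ
    back-thread refl with only-thread N' (edge-sym (edge₃ N))
    ... | refl , refl = refl , refl
    shared : o ≡ y' → ∀ ψ c → Ext R y z f ψ c
    shared q ψ c with back-thread q | msg-pair-double g (ψ l) e θ f c
    ... | refl , refl | a , (a' , s₁ , s₂ , s₃) , s = ext a a' s s₂ (λ n → ⊥-elim (n q)) (λ _ → s₃) s₁ (λ n → ⊥-elim (n refl))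
    unshared : o ≢ y' → ∀ {ψ c} a → Sat (plain f) a c → cls a ≢ tcls θ (ψ o) → Leaf ψ g l θ' o' e a → Ext R y z f ψ c
    unshared n {ψ} a s t (a' , s₁ , s₂ , s₃) =
      ext a a' s s₃ (λ _ → tcls-sat θ a (ψ o) t) (λ q → ⊥-elim (n q)) s₁ (λ _ → s₂)
    weak : Dec (o ≡ y') → ∀ ψ → ∃ λ κ → ∀ c → cls c ≢ κ → Ext R y z f ψ c
    -- An arbitrary class, since nothing is forbidden.
    weak (yes q) ψ = (zero , pos) , λ c _ → shared q ψ c
    weak (no n) ψ with leaf-semi ψ g l θ' o' e
    ... | k₁ , k₂ , lf with msg-avoid₃ k₁ k₂ (tcls θ (ψ o)) f
    ... | κ , m = κ , λ c nc → let a , (n₁ , n₂ , n₃) , s = m c nc in unshared n a s n₃ (lf a n₁ n₂)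
    pend : ∀ x → R x ≡ false → Cubic x → Touch R y z f x → ∀ ψ → Dec (o ≡ y') → ∃₂ λ k₁ k₂ →
        (ThreadOnly R y z f x → proj₁ k₁ ≡ proj₁ k₂) ×
        (∀ d → cls d ≢ k₁ → cls d ≢ k₂ → ∀ c → Ext R y z f (ψ [ x ≔ d ]) c)
    pend x Rx cub t ψ (yes q) = (zero , pos) , (zero , pos) , (λ _ → refl) , λ d _ _ c → shared q _ c
    pend x Rx cub t ψ (no n) with x ≟ l | x ≟ o' | x ≟ o
    ... | yes refl | yes refl | _ = (zero , pos) , (zero , pos) , (λ _ → refl) , λ d _ _ c →
      let ψ' = ψ [ x ≔ d ]
          κ , m = msg-neighbour-double g θ' e d
          a , (n₁ , n₂) , s = msg-avoid₂ κ (tcls θ (ψ' o)) f c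
          a' , (na , s₁) , s₂ = m a n₁
          same = sym (upd-same ψ x d)
      in unshared n a s n₂ (a' , subst (Sat (plain g) a') same s₁ , subst (Sat (thread θ') a') same (tcls-sat θ' a' d na) , s₂)
    ... | yes refl | no x≢o' | _ with msg-neighbour-pending (tcls θ' (ψ o')) g e
    ...   | k₁ , k₂ , G = k₁ , k₂ , (λ to → ⊥-elim (absurd (to y' (plain g) (ins-here y' _) (edge₂ N') (λ { (p , _) → y≢y' (sym p) })))) ,
      λ d d₁ d₂ c →
      let ψ' = ψ [ x ≔ d ]
          κ , m = G d d₁ d₂
          a , (n₁ , n₂) , s = msg-avoid₂ κ (tcls θ (ψ' o)) f c
          a' , (na , s₁) , s₂ = m a n₁
      in unshared n a s n₂ (a' , subst (Sat (plain g) a') (sym (upd-same ψ x d)) s₁ ,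
           subst (Sat (thread θ') a') (sym (upd-other ψ d (≢-sym x≢o'))) (tcls-sat θ' a' (ψ o') na) , s₂)
      where
      absurd : (∃ λ θ → plain g ≡ thread θ) → ⊥
      absurd (_ , ())
    -- Both threads would end at `x`, but a cubic vertex has at most one thread; this is why `pend`
    -- asks for `Cubic`.
    pend x Rx cub t ψ (no n) | no x≢l | yes refl | yes refl =
      ⊥-elim (y≢y' (thread-end-unique cub (edge-sym (edge₃ N)) (edge-sym (edge₃ N'))))
    pend x Rx cub t ψ (no n) | no x≢l | yes refl | no x≢o with msg-pair-pending g (ψ l) (tcls θ (ψ o)) e f
    ... | p₀ , G = (p₀ , pos) , (p₀ , neg) , (λ _ → refl) , λ d d₁ d₂ c →
      let ψ' = ψ [ x ≔ d ]
          a , (na , a' , na' , s₁ , s₂) , s = G (tcls θ' d) (not-pair (cls d) p₀ d₁ d₂) c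
      in unshared n a s (subst (λ w → cls a ≢ tcls θ w) (sym (upd-other ψ d (≢-sym x≢o))) na)
           (a' , subst (Sat (plain g) a') (sym (upd-other ψ d (≢-sym x≢l))) s₁ ,
                 subst (Sat (thread θ') a') (sym (upd-same ψ x d)) (tcls-sat θ' a' d na') , s₂)
    pend x Rx cub t ψ (no n) | no x≢l | no x≢o' | yes refl with leaf-semi ψ g l θ' o' e
    ... | k₁ , k₂ , lf with msg-avoid₃-pending k₁ k₂ f
    ... | p₀ , G = (p₀ , pos) , (p₀ , neg) , (λ _ → refl) , λ d d₁ d₂ c →
      let a , (n₁ , n₂ , n₃) , s = G (tcls θ d) (not-pair (cls d) p₀ d₁ d₂) c
          a' , s₁ , s₂ , s₃ = lf a n₁ n₂
      in unshared n a s (subst (λ w → cls a ≢ tcls θ w) (sym (upd-same ψ x d)) n₃)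
           (a' , subst (Sat (plain g) a') (sym (upd-other ψ d (≢-sym x≢l))) s₁ ,
                 subst (Sat (thread θ') a') (sym (upd-other ψ d (≢-sym x≢o'))) s₂ , s₃)
    pend x Rx cub (r , k , Rr , ed , ¬m) ψ (no n) | no x≢l | no x≢o' | no x≢o with ins-case y' (ins y ∅) r Rr
    ... | inj₁ refl with only N' x k ed
    ...   | inj₁ (refl , _) = ⊥-elim (in≢out (ins-there y' _ y (ins-here y ∅)) Rx)
    ...   | inj₂ (inj₁ (p , _)) = ⊥-elim (x≢l p)
    ...   | inj₂ (inj₂ (p , _)) = ⊥-elim (x≢o' p)
    pend x Rx cub (r , k , Rr , ed , ¬m) ψ (no n) | no x≢l | no x≢o' | no x≢o | inj₂ (_ , Rr') with ins-case y ∅ r Rr'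
    ... | inj₂ (_ , ())
    ... | inj₁ refl with only N x k ed
    ...   | inj₁ (refl , _) = ⊥-elim (in≢out (ins-here y' _) Rx)
    ...   | inj₂ (inj₁ (p , q)) = ⊥-elim (¬m (refl , p , q))
    ...   | inj₂ (inj₂ (p , _)) = ⊥-elim (x≢o p)

  leaf-same : ∀ {ψ x f α θ o e X} d → α ≢ x → o ≢ x → Leaf ψ f α θ o e X → Leaf (ψ [ x ≔ d ]) f α θ o e X
  leaf-same {ψ} {f = f} {θ = θ} d n n' (A , s₁ , s₂ , s₃) =
    A , subst (Sat (plain f) A) (sym (upd-other ψ d n)) s₁ , subst (Sat (thread θ) A) (sym (upd-other ψ d n')) s₂ , s₃

  leaf-plain : ∀ ψ f x θ o e → ∃₂ λ k₁ k₂ → ∀ d → cls d ≢ k₁ → cls d ≢ k₂ → ∃ λ κ → ∀ X → cls X ≢ κ →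
    Leaf (ψ [ x ≔ d ]) f x θ o e X
  leaf-plain ψ f x θ o e with x ≟ o
  ... | yes refl = (zero , pos) , (zero , pos) , λ d _ _ → let κ , m = msg-neighbour-double f θ e d in κ , λ X nX →
    let A , (na , s₁) , s₂ = m X nX ; same = sym (upd-same ψ x d)
    in A , subst (Sat (plain f) A) same s₁ , subst (Sat (thread θ) A) same (tcls-sat θ A d na) , s₂
  ... | no x≢o = let k₁ , k₂ , G = msg-neighbour-pending (tcls θ (ψ o)) f e in k₁ , k₂ , λ d d₁ d₂ → let κ , m = G d d₁ d₂ in κ , λ X nX →
    let A , (na , s₁) , s₂ = m X nX
    in A , subst (Sat (plain f) A) (sym (upd-same ψ x d)) s₁ ,
       subst (Sat (thread θ) A) (sym (upd-other ψ d (≢-sym x≢o))) (tcls-sat θ A (ψ o) na) , s₂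

  -- `a` and `b` would be a source whose path into `x` meets `x` a second time.
  adjacent-Ys-irreducible : ∀ {x a e b f c g α h oa θ β h' ob θ' k} → IsX x a e b f c g → IsY a x e α h oa θ → IsY b x f β h' ob θ' →
    ¬ Edge a b (plain k)
  adjacent-Ys-irreducible {x} {a} {b = b} {k = k} X Na Nb ab with only Na b (plain k) ab | only Nb a (plain k) (edge-sym ab)
  ... | inj₁ (refl , _) | _ = edge-irr (edge₂ (proj₁ X)) refl
  ... | inj₂ (inj₂ (_ , ())) | _
  ... | inj₂ (inj₁ _) | inj₁ (refl , _) = edge-irr (edge₁ (proj₁ X)) refl
  ... | inj₂ (inj₁ _) | inj₂ (inj₂ (_ , ()))
  ... | inj₂ (inj₁ (refl , refl)) | inj₂ (inj₁ (refl , refl)) =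
    touched-next (pair-mid (swap Nb) (swap Na)) (proj₁ (swapX X))
      (a , _ , ins-here a _ , edge-sym (edge₁ (proj₁ X)) , λ { (p , _) → a≢b (proj₁ X) p })

  module Star {x a e b f c g α h oa θ β h' ob θ' γ h″ oc θ″} (X : IsX x a e b f c g)
    (Na : IsY a x e α h oa θ) (Nb : IsY b x f β h' ob θ') (Nc : IsY c x g γ h″ oc θ″) where

    -- The linked leaves leave three classes at `x` that work for both at once; the leaf `c` forbids
    -- at most two.
    linked-Ys-irreducible : ∀ {k} → ¬ Edge a b (thread k)
    linked-Ys-irreducible {k} ab with only-thread Na ab | only-thread Nb (edge-sym ab)
    ... | refl , refl | refl , refl = irreducible {ins c (ins b (ins a (ins x ∅)))} (ins-here c _) (edge₁ Nc) ext
      where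
      c≢a : c ≢ a
      c≢a p = proj₁ (proj₂ X) (sym p)
      c≢b : c ≢ b
      c≢b p = proj₂ (proj₂ X) (sym p)
      ¬ac : ∀ j → ¬ Edge a c j
      ¬ac (plain j) ed = adjacent-Ys-irreducible {k = j} (rotX (swapX X)) Na Nc ed
      ¬ac (thread j) ed = c≢b (proj₁ (only-thread Na ed))
      ¬bc : ∀ j → ¬ Edge b c j
      ¬bc (plain j) ed = adjacent-Ys-irreducible {k = j} (rotX X) Nb Nc ed
      ¬bc (thread j) ed = c≢a (proj₁ (only-thread Nb ed))
      ext : ∀ ψ → Extendable (ins c (ins b (ins a (ins x ∅)))) ψ
      ext ψ with leaf-semi ψ h″ γ θ″ oc g
      ... | k₁ , k₂ , lc with fill-threaded-star h (ψ α) h' (ψ β) e f k k₁ k₂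
      ... | W , (n₁ , n₂) , A , a₁ , a₂ , B , b₁ , b₂ , s with lc W n₁ n₂
      ... | C , c₁ , c₂ , c₃ =
        absorb C (out-ins b _ c c≢b (out-ins a _ c c≢a (out-ins x ∅ c (≢-sym (edge-irr (edge₃ (proj₁ X)))) refl)))
          (absorb B (out-ins a _ b (≢-sym (a≢b (proj₁ X))) (out-ins x ∅ b (≢-sym (edge-irr (edge₂ (proj₁ X)))) refl))
            (absorb A (out-ins x ∅ a (≢-sym (edge-irr (edge₁ (proj₁ X)))) refl)
              (absorb W refl (empty _) satX) satA) satB) satC
        where
        satX : ∀ j k → Edge x j k → false ≡ false → Sat k W ((ψ [ c ≔ C ] [ b ≔ B ] [ a ≔ A ]) j)
        satX j k ed _ with only (proj₁ X) j k ed
        ... | inj₁ (refl , refl) rewrite upd-same (ψ [ c ≔ C ] [ b ≔ B ]) j A = sat-sym (plain e) A W a₂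
        ... | inj₂ (inj₁ (refl , refl)) rewrite upd-other (ψ [ c ≔ C ] [ b ≔ B ]) A (≢-sym (a≢b (proj₁ X))) | upd-same (ψ [ c ≔ C ]) j B =
          sat-sym (plain f) B W b₂
        ... | inj₂ (inj₂ (refl , refl)) rewrite upd-other (ψ [ c ≔ C ] [ b ≔ B ]) A c≢a | upd-other (ψ [ c ≔ C ]) B c≢b | upd-same ψ j C =
          sat-sym (plain g) C W c₃
        satA : ∀ j k → Edge a j k → ins x ∅ j ≡ false → Sat k A ((ψ [ c ≔ C ] [ b ≔ B ]) j)
        satA j k ed ¬j with only Na j k ed
        ... | inj₁ (refl , _) = ⊥-elim (in≢out (ins-here x ∅) ¬j)
        ... | inj₂ (inj₂ (refl , refl)) rewrite upd-same (ψ [ c ≔ C ]) j B = s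
        ... | inj₂ (inj₁ (refl , refl))
          rewrite upd-other (ψ [ c ≔ C ]) {b} {j} B (λ { refl → adjacent-Ys-irreducible X Na Nb ed })
                | upd-other ψ {c} {j} C (λ { refl → ¬ac _ ed }) = a₁
        satB : ∀ j k → Edge b j k → ins a (ins x ∅) j ≡ false → Sat k B ((ψ [ c ≔ C ]) j)
        satB j k ed ¬j with only Nb j k ed
        ... | inj₁ (refl , _) = ⊥-elim (in≢out (ins-there a _ x (ins-here x ∅)) ¬j)
        ... | inj₂ (inj₂ (refl , refl)) = ⊥-elim (in≢out (ins-here a _) ¬j)
        ... | inj₂ (inj₁ (refl , refl)) rewrite upd-other ψ {c} {j} C (λ { refl → ¬bc _ ed }) = b₁
        satC : ∀ j k → Edge c j k → ins b (ins a (ins x ∅)) j ≡ false → Sat k C (ψ j)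
        satC j k ed ¬j with only Nc j k ed
        ... | inj₁ (refl , _) = ⊥-elim (in≢out (ins-there b _ x (ins-there a _ x (ins-here x ∅))) ¬j)
        ... | inj₂ (inj₁ (refl , refl)) = c₁
        ... | inj₂ (inj₂ (refl , refl)) = c₂

    no-edge : ∀ {k} → ¬ Edge a b k
    no-edge {plain k} = adjacent-Ys-irreducible X Na Nb
    no-edge {thread k} = linked-Ys-irreducible

  -- The source consists of `x` and two of its leaves; the path leaves through the third, `y`. Each
  -- leaf in the region forbids two classes at `x`, and two remaining classes forbid at most two at
  -- `y`. As the leaves do not see each other, `y` is not met again and `pend-main` is vacuous.
  star-src : ∀ {x y e a f b g α h oa θ β h' ob θ'} → IsX x y e a f b g → IsY a x f α h oa θ → IsY b x g β h' ob θ' →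
    (∀ k → ¬ Edge a b k) → (∀ k → ¬ Edge a y k) → (∀ k → ¬ Edge b y k) → Src (ins b (ins a (ins x ∅))) x y e
  star-src {x} {y} {e} {a} {f} {b} {g} {α} {h} {oa} {θ} {β} {h'} {ob} {θ'} (N , y≢b , a≢b') Na Nb ¬ab ¬ay ¬by = record
    { inR = xR
    ; out = out-ins b _ y y≢b (out-ins a _ y (a≢b N) (out-ins x ∅ y (≢-sym (edge-irr (edge₁ N))) refl))
    ; edge = edge₁ N
    ; semi = λ ψ → let f₁ , f₂ , la = leaf-semi ψ h α θ oa f
                       g₁ , g₂ , lb = leaf-semi ψ h' β θ' ob g
                       k₁ , k₂ , m = msg-avoid₄ f₁ f₂ g₁ g₂ e
        in k₁ , k₂ , λ c n n' → let X , ((p₁ , p₂) , (q₁ , q₂)) , s = m c n n' in ext X s (la X p₁ p₂) (lb X q₁ q₂)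
    ; pend = λ o Ro cub t ψ → pend o Ro cub t ψ
    ; pend-main = λ cub t → ⊥-elim (untouched t) }
    where
    R : Region
    R = ins b (ins a (ins x ∅))
    xR : R x ≡ true
    xR = ins-there b _ x (ins-there a _ x (ins-here x ∅))
    aR : R a ≡ true
    aR = ins-there b _ a (ins-here a _)
    bR : R b ≡ true
    bR = ins-here b _
    touching : ∀ {o} → R o ≡ false → Touch R x y e o → (o ≡ α ⊎ o ≡ oa) ⊎ (o ≡ β ⊎ o ≡ ob)
    touching {o} Ro (r , k , Rr , ed , ¬m) with ins-case b _ r Rr
    ... | inj₁ refl with only Nb o k ed
    ...   | inj₁ (refl , _) = ⊥-elim (in≢out xR Ro)
    ...   | inj₂ (inj₁ (p , _)) = inj₂ (inj₁ p)
    ...   | inj₂ (inj₂ (p , _)) = inj₂ (inj₂ p)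
    touching {o} Ro (r , k , Rr , ed , ¬m) | inj₂ (_ , Rr') with ins-case a _ r Rr'
    ... | inj₁ refl with only Na o k ed
    ...   | inj₁ (refl , _) = ⊥-elim (in≢out xR Ro)
    ...   | inj₂ (inj₁ (p , _)) = inj₁ (inj₁ p)
    ...   | inj₂ (inj₂ (p , _)) = inj₁ (inj₂ p)
    touching {o} Ro (r , k , Rr , ed , ¬m) | inj₂ _ | inj₂ (_ , Rr″) with ins-case x ∅ r Rr″
    ... | inj₂ (_ , ())
    ... | inj₁ refl with only N o k ed
    ...   | inj₁ (p , q) = ⊥-elim (¬m (refl , p , q))
    ...   | inj₂ (inj₁ (refl , _)) = ⊥-elim (in≢out aR Ro)
    ...   | inj₂ (inj₂ (refl , _)) = ⊥-elim (in≢out bR Ro)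
    untouched : Touch R x y e y → ⊥
    untouched t with touching (out-ins b _ y y≢b (out-ins a _ y (a≢b N) (out-ins x ∅ y (≢-sym (edge-irr (edge₁ N))) refl))) t
    ... | inj₁ (inj₁ refl) = ¬ay _ (edge₂ Na)
    ... | inj₁ (inj₂ refl) = ¬ay _ (edge₃ Na)
    ... | inj₂ (inj₁ refl) = ¬by _ (edge₂ Nb)
    ... | inj₂ (inj₂ refl) = ¬by _ (edge₃ Nb)
    ext : ∀ {ψ c} X → Sat (plain e) X c → Leaf ψ h α θ oa f X → Leaf ψ h' β θ' ob g X → Ext R x y e ψ c
    ext {ψ} {c} X s (A , a₁ , a₂ , a₃) (B , b₁ , b₂ , b₃) =
      absorbExt B (out-ins a _ b (≢-sym a≢b') (out-ins x ∅ b (≢-sym (edge-irr (edge₃ N))) refl)) (≢-sym y≢b)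
        (absorbExt A (out-ins x ∅ a (≢-sym (edge-irr (edge₂ N))) refl) (≢-sym (a≢b N)) (single X s satX) satA) satB
      where
      satX : ∀ j k → Edge x j k → (j ≡ y × k ≡ plain e) ⊎ Sat k X ((ψ [ b ≔ B ] [ a ≔ A ]) j)
      satX j k ed with only N j k ed
      ... | inj₁ p = inj₁ p
      ... | inj₂ (inj₁ (refl , refl)) rewrite upd-same (ψ [ b ≔ B ]) j A = inj₂ (sat-sym (plain f) A X a₃)
      ... | inj₂ (inj₂ (refl , refl)) rewrite upd-other (ψ [ b ≔ B ]) A (≢-sym a≢b') | upd-same ψ j B = inj₂ (sat-sym (plain g) B X b₃)
      satA : ∀ j k → Edge a j k → ins x ∅ j ≡ false → Sat k A ((ψ [ b ≔ B ]) j)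
      satA j k ed ¬j rewrite upd-other ψ {b} {j} B (λ { refl → ¬ab _ ed }) with only Na j k ed
      ... | inj₁ (refl , _) = ⊥-elim (in≢out (ins-here x ∅) ¬j)
      ... | inj₂ (inj₁ (refl , refl)) = a₁
      ... | inj₂ (inj₂ (refl , refl)) = a₂
      satB : ∀ j k → Edge b j k → ins a (ins x ∅) j ≡ false → Sat k B (ψ j)
      satB j k ed ¬j with only Nb j k ed
      ... | inj₁ (refl , _) = ⊥-elim (in≢out (ins-there a _ x (ins-here x ∅)) ¬j)
      ... | inj₂ (inj₁ (refl , refl)) = b₁
      ... | inj₂ (inj₂ (refl , refl)) = b₂
    not-thread : ∀ {k} → (∃ λ θ → plain k ≡ thread θ) → ⊥
    not-thread (_ , ())
    Pend : Fin n → Coloring → Set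
    Pend o ψ = ∃₂ λ k₁ k₂ → (ThreadOnly R x y e o → proj₁ k₁ ≡ proj₁ k₂) ×
        (∀ d → cls d ≢ k₁ → cls d ≢ k₂ → ∃ λ κ → ∀ c → cls c ≢ κ → Ext R x y e (ψ [ o ≔ d ]) c)
    pend : ∀ o → R o ≡ false → Cubic o → Touch R x y e o → ∀ ψ → Pend o ψ
    pend o Ro cub t ψ with o ≟ α | o ≟ β
    ... | yes refl | _ = let k₁ , k₂ , G = leaf-plain ψ h o θ oa f in
      k₁ , k₂ , (λ to → ⊥-elim (not-thread (to a (plain h) aR (edge₂ Na) (λ { (p , _) → edge-irr (edge₂ N) (sym p) })))) , λ d d₁ d₂ →
      let κ , la = G d d₁ d₂ ; g₁ , g₂ , lb = leaf-semi (ψ [ o ≔ d ]) h' β θ' ob g ; κ' , m = msg-avoid₃ g₁ g₂ κ e in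
      κ' , λ c nc → let X , (n₁ , n₂ , n₃) , s = m c nc in ext X s (la X n₃) (lb X n₁ n₂)
    ... | no _ | yes refl = let k₁ , k₂ , G = leaf-plain ψ h' o θ' ob g in
      k₁ , k₂ , (λ to → ⊥-elim (not-thread (to b (plain h') bR (edge₂ Nb) (λ { (p , _) → edge-irr (edge₃ N) (sym p) })))) , λ d d₁ d₂ →
      let κ , lb = G d d₁ d₂ ; f₁ , f₂ , la = leaf-semi (ψ [ o ≔ d ]) h α θ oa f ; κ' , m = msg-avoid₃ f₁ f₂ κ e in
      κ' , λ c nc → let X , (n₁ , n₂ , n₃) , s = m c nc in ext X s (la X n₁ n₂) (lb X n₃)
    ... | no o≢α | no o≢β with touching Ro t
    ... | inj₁ (inj₁ p) = ⊥-elim (o≢α p)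
    ... | inj₂ (inj₁ p) = ⊥-elim (o≢β p)
    ... | inj₁ (inj₂ refl) =
      let f₁ , f₂ , lb = leaf-semi ψ h' β θ' ob g ; p₀ , G = msg-star-pending h (ψ α) f₁ f₂ f e in
      (p₀ , pos) , (p₀ , neg) , (λ _ → refl) , λ d d₁ d₂ → let κ , m = G (tcls θ d) (not-pair (cls d) p₀ d₁ d₂) in
      κ , λ c nc → let X , ((n₁ , n₂) , A , na , s₁ , s₂) , s = m c nc in
        ext X s (A , subst (Sat (plain h) A) (sym (upd-other ψ d (≢-sym o≢α))) s₁ ,
                     subst (Sat (thread θ) A) (sym (upd-same ψ o d)) (tcls-sat θ A d na) , s₂)
                (leaf-same {f = h'} {θ = θ'} {e = g} {X = X} d (≢-sym o≢β) (λ { refl → a≢b' (thread-end-unique cub (edge-sym (edge₃ Na)) (edge-sym (edge₃ Nb))) }) (lb X n₁ n₂))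
    ... | inj₂ (inj₂ refl) =
      let f₁ , f₂ , la = leaf-semi ψ h α θ oa f ; p₀ , G = msg-star-pending h' (ψ β) f₁ f₂ g e in
      (p₀ , pos) , (p₀ , neg) , (λ _ → refl) , λ d d₁ d₂ → let κ , m = G (tcls θ' d) (not-pair (cls d) p₀ d₁ d₂) in
      κ , λ c nc → let X , ((n₁ , n₂) , B , nb , s₁ , s₂) , s = m c nc in
        ext X s (leaf-same {f = h} {θ = θ} {e = f} {X = X} d (≢-sym o≢α) (λ { refl → a≢b' (thread-end-unique cub (edge-sym (edge₃ Na)) (edge-sym (edge₃ Nb))) }) (la X n₁ n₂))
                (B , subst (Sat (plain h') B) (sym (upd-other ψ d (≢-sym o≢β))) s₁ ,
                     subst (Sat (thread θ') B) (sym (upd-same ψ o d)) (tcls-sat θ' B d nb) , s₂)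

  -- W y z: a path from a source passes through y towards z.
  data W : Fin n → Fin n → Set where
    twin : ∀ {y y' e z f o θ l g o' θ'} → IsY y y' e z f o θ → IsY y' y e l g o' θ' → W y z
    star : ∀ {x y e a f b g z k o θ α h oa θ' β h' ob θ″} → IsX x y e a f b g → IsY y x e z k o θ →
           IsY a x f α h oa θ' → IsY b x g β h' ob θ″ → W y z
    pass : ∀ {y z e p f q g z' h o θ} → W y z → IsX z y e p f q g → IsY p z f z' h o θ → W p z'

  W-shape : ∀ {y z} → W y z → ∃ λ x → ∃ λ e → ∃ λ f → ∃ λ o → ∃ λ θ → IsY y x e z f o θ
  W-shape (twin N _) = _ , _ , _ , _ , _ , N
  W-shape (star _ N _ _) = _ , _ , _ , _ , _ , N
  W-shape (pass _ _ N) = _ , _ , _ , _ , _ , N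

  same-edge : ∀ {u a e e' b f c k} → Node u a e b f c k → (∀ g → k ≡ plain g → a ≢ c) → Edge u a (plain e') → e' ≡ e
  same-edge N h ed with only N _ _ ed
  ... | inj₁ (_ , refl) = refl
  ... | inj₂ (inj₁ (p , _)) = ⊥-elim (a≢b N p)
  ... | inj₂ (inj₂ (p , q)) = ⊥-elim (h _ (sym q) p)

  W-mid : ∀ {y z} → W y z → ∃₂ λ R e → Mid R y z e
  W-mid (twin N N') = _ , _ , pair-mid N N'
  W-mid (star X Ny Na Nb) = _ , _ , next-mid (star-src X Na Nb
    (λ k → Star.no-edge (rotX X) Na Nb Ny)
    (λ k → Star.no-edge (swapX X) Na Ny Nb)
    (λ k → Star.no-edge (rotX (rotX X)) Nb Ny Na)) Ny
  W-mid (pass w X N) with W-mid w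
  ... | R , e , M with same-edge (proj₁ X) (λ _ _ → proj₁ (proj₂ X)) (edge-sym (Mid.edge M))
  ... | refl = _ , _ , next-mid (next-src M X) N

  -- Follow the second derivation backwards from the first one: each step either reaches its source,
  -- or moves the collision one cubic vertex further.
  collide : ∀ {R y z e v} → Mid R y z e → W y v → v ≢ z → ⊥
  collide {z = z} M (twin {y' = y'} N N') v≢z with only N z _ (Mid.edge M)
  ... | inj₁ (refl , refl) = meets-Y M N'
  ... | inj₂ (inj₁ (refl , _)) = v≢z refl
  ... | inj₂ (inj₂ (_ , ()))
  collide {z = z} M (star X N Na Nb) v≢z with only N z _ (Mid.edge M)
  ... | inj₁ (refl , refl) = meets-X M X Na Nb
  ... | inj₂ (inj₁ (refl , _)) = v≢z refl
  ... | inj₂ (inj₂ (_ , ()))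
  collide {z = z} M (pass {y = y₀} w X N) v≢z with only N z _ (Mid.edge M)
  ... | inj₂ (inj₁ (refl , _)) = v≢z refl
  ... | inj₂ (inj₂ (_ , ()))
  ... | inj₁ (refl , refl) with W-shape w
  ... | x , e , f , o , θ , N₀ with same-edge (proj₁ X) (λ _ _ → proj₁ (proj₂ X)) (edge-sym (edge₂ N₀))
  ... | refl = collide (next-mid (next-src M (swapX X)) (swap N₀)) w (≢-sym (a≢b N₀))

  -- This makes the side on which a Y draws its charge well defined.
  W-unique : ∀ {y z v} → W y z → W y v → v ≡ z
  W-unique {y} {z} {v} w w' with v ≟ z
  ... | yes p = p
  ... | no n = ⊥-elim (collide (proj₂ (proj₂ (W-mid w))) w' n)

  -- Configurations around one vertex

  one-vertex : ∀ {v j k} → Edge v j k → (∀ ψ → ∃ λ a → ∀ j k → Edge v j k → Sat k a (ψ j)) → ⊥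
  one-vertex {v} ed h = irreducible {ins v ∅} (ins-here v ∅) ed λ ψ →
    let a , s = h ψ in absorb a refl (empty _) λ j k e _ → s j k e

  two-threads : ∀ {v a k o₁ θ₁ o₂ θ₂} → Edge v o₁ (thread θ₁) →
    (∀ j k' → Edge v j k' → (j ≡ a × k' ≡ k) ⊎ (j ≡ o₁ × k' ≡ thread θ₁) ⊎ (j ≡ o₂ × k' ≡ thread θ₂)) → ⊥
  two-threads {v} {a} {k} {o₁} {θ₁} {o₂} {θ₂} ed only = one-vertex ed λ ψ →
    let c , (n₁ , n₂) , s = choose-avoiding k (ψ a) (tcls θ₁ (ψ o₁)) (tcls θ₂ (ψ o₂)) in c , λ j k' e → sats ψ c n₁ n₂ s (only j k' e)
    where
    sats : ∀ ψ c → cls c ≢ tcls θ₁ (ψ o₁) → cls c ≢ tcls θ₂ (ψ o₂) → Sat k c (ψ a) → ∀ {j k'} →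
      (j ≡ a × k' ≡ k) ⊎ (j ≡ o₁ × k' ≡ thread θ₁) ⊎ (j ≡ o₂ × k' ≡ thread θ₂) → Sat k' c (ψ j)
    sats ψ c n₁ n₂ s (inj₁ (refl , refl)) = s
    sats ψ c n₁ n₂ s (inj₂ (inj₁ (refl , refl))) = tcls-sat θ₁ c (ψ o₁) n₁
    sats ψ c n₁ n₂ s (inj₂ (inj₂ (refl , refl))) = tcls-sat θ₂ c (ψ o₂) n₂

  four-threads : ∀ {v o₁ θ₁ o₂ θ₂ o₃ θ₃ o₄ θ₄} → Edge v o₁ (thread θ₁) →
    (∀ j k → Edge v j k → (j ≡ o₁ × k ≡ thread θ₁) ⊎ (j ≡ o₂ × k ≡ thread θ₂) ⊎ (j ≡ o₃ × k ≡ thread θ₃) ⊎ (j ≡ o₄ × k ≡ thread θ₄)) → ⊥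
  four-threads {v} {o₁} {θ₁} {o₂} {θ₂} {o₃} {θ₃} {o₄} {θ₄} ed only = one-vertex ed ext
    where
    ext : ∀ ψ → ∃ λ a → ∀ j k → Edge v j k → Sat k a (ψ j)
    ext ψ with avoid (tcls θ₁ (ψ o₁) ∷ tcls θ₂ (ψ o₂) ∷ tcls θ₃ (ψ o₃) ∷ tcls θ₄ (ψ o₄) ∷ []) (ℕ.≤ᵇ⇒≤ 5 6 tt)
    ... | u , n₁ ∷ n₂ ∷ n₃ ∷ n₄ ∷ [] = a , sats
      where
      a : Color
      a = u , false
      sats : ∀ j k → Edge v j k → Sat k a (ψ j)
      sats j k e with only j k e
      ... | inj₁ (refl , refl) = tcls-sat θ₁ a (ψ o₁) n₁
      ... | inj₂ (inj₁ (refl , refl)) = tcls-sat θ₂ a (ψ o₂) n₂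
      ... | inj₂ (inj₂ (inj₁ (refl , refl))) = tcls-sat θ₃ a (ψ o₃) n₃
      ... | inj₂ (inj₂ (inj₂ (refl , refl))) = tcls-sat θ₄ a (ψ o₄) n₄

  -- The Y forbids two classes at `v` and the threads three, five of six. If the thread of the Y
  -- returns to `v`, the Y forbids only one.
  three-threads-beside-Y : ∀ {v y e o₁ θ₁ o₂ θ₂ o₃ θ₃ l f o θ} → IsY y v e l f o θ →
    (∀ j k → Edge v j k → (j ≡ y × k ≡ plain e) ⊎ (j ≡ o₁ × k ≡ thread θ₁) ⊎ (j ≡ o₂ × k ≡ thread θ₂) ⊎ (j ≡ o₃ × k ≡ thread θ₃)) → ⊥
  three-threads-beside-Y {v} {y} {e} {o₁} {θ₁} {o₂} {θ₂} {o₃} {θ₃} {l} {f} {o} {θ} N lim =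
    irreducible {ins y (ins v ∅)} (ins-here y _) (edge₁ N) ext
    where
    finish : ∀ ψ x y' → Sat (plain e) y' x → Sat (plain f) y' (ψ l) → (o ≢ v → Sat (thread θ) y' (ψ o)) → (o ≡ v → Sat (thread θ) y' x) →
      cls x ≢ tcls θ₁ (ψ o₁) → cls x ≢ tcls θ₂ (ψ o₂) → cls x ≢ tcls θ₃ (ψ o₃) → Extendable (ins y (ins v ∅)) ψ
    finish ψ x y' s₁ s₂ s₃ s₄ n₁ n₂ n₃ =
      absorb y' (out-ins v ∅ y (edge-irr (edge₁ N)) refl) (absorb x refl (empty _) satV) satY
      where
      via : ∀ o' θ' → Edge v o' (thread θ') → cls x ≢ tcls θ' (ψ o') → Sat (thread θ') x ((ψ [ y ≔ y' ]) o')
      via o' θ' ed nx with o' ≟ y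
      ... | no _ = tcls-sat θ' x (ψ o') nx
      ... | yes refl with only-thread N (edge-sym ed)
      ...   | refl , refl = sat-sym (thread θ) y' x (s₄ refl)
      satV : ∀ j k → Edge v j k → false ≡ false → Sat k x ((ψ [ y ≔ y' ]) j)
      satV j k ed _ with lim j k ed
      ... | inj₁ (refl , refl) rewrite upd-same ψ j y' = sat-sym (plain e) y' x s₁
      ... | inj₂ (inj₁ (refl , refl)) = via j θ₁ ed n₁
      ... | inj₂ (inj₂ (inj₁ (refl , refl))) = via j θ₂ ed n₂
      ... | inj₂ (inj₂ (inj₂ (refl , refl))) = via j θ₃ ed n₃
      satY : ∀ j k → Edge y j k → ins v ∅ j ≡ false → Sat k y' (ψ j)
      satY j k ed ¬j with only N j k ed
      ... | inj₁ (refl , _) = ⊥-elim (in≢out (ins-here v ∅) ¬j)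
      ... | inj₂ (inj₁ (refl , refl)) = s₂
      ... | inj₂ (inj₂ (refl , refl)) = s₃ λ { refl → in≢out (ins-here v ∅) ¬j }
    ext : ∀ ψ → Extendable (ins y (ins v ∅)) ψ
    ext ψ with o ≟ v
    ... | yes q with msg-triangle f (ψ l) e θ
    ...   | κ , r with avoid (κ ∷ tcls θ₁ (ψ o₁) ∷ tcls θ₂ (ψ o₂) ∷ tcls θ₃ (ψ o₃) ∷ []) (ℕ.≤ᵇ⇒≤ 5 6 tt)
    ...   | u , n₀ ∷ n₁ ∷ n₂ ∷ n₃ ∷ [] with r (u , false) n₀
    ...   | y' , s₁ , s₂ , s₃ = finish ψ (u , false) y' s₂ s₁ (λ n → ⊥-elim (n q)) (λ _ → s₃) n₁ n₂ n₃
    ext ψ | no n with leaf-semi ψ f l θ o e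
    ... | k₁ , k₂ , lf with avoid (k₁ ∷ k₂ ∷ tcls θ₁ (ψ o₁) ∷ tcls θ₂ (ψ o₂) ∷ tcls θ₃ (ψ o₃) ∷ []) (ℕ.≤ᵇ⇒≤ 6 6 tt)
    ... | u , m₁ ∷ m₂ ∷ n₁ ∷ n₂ ∷ n₃ ∷ [] with lf (u , false) m₁ m₂
    ... | y' , s₁ , s₂ , s₃ = finish ψ (u , false) y' s₃ s₁ (λ _ → s₂) (λ q → ⊥-elim (n q)) n₁ n₂ n₃

-- Minimal counterexamples and discharging

·-comm : ∀ s t → s · t ≡ t · s
·-comm pos pos = refl
·-comm pos neg = refl
·-comm neg pos = refl
·-comm neg neg = refl

-- Induced subgraphs are masks on one vertex set, so that colourings of all of them have the same
-- type.
module Masked (G : SignedGraph) (T : Fin (n G) → Bool) where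

  V : Set
  V = Fin (n G)

  data A (i j : V) (s : Sign) : Set where
    adj : T i ≡ true → T j ≡ true → sig G i j ≡ just s → A i j s

  A-sym : ∀ {i j s} → A i j s → A j i s
  A-sym {i} {j} (adj p q r) = adj q p (trans (SignedGraph.sym G j i) r)

  A-irr : ∀ {i j s} → A i j s → i ≢ j
  A-irr {i} (adj _ _ r) refl with trans (sym (noloop G i)) r
  ... | ()

  A-unique : ∀ {i j s t} → A i j s → A i j t → s ≡ t
  A-unique (adj _ _ p) (adj _ _ q) = Maybe.just-injective (trans (sym p) q)

  A? : ∀ i j s → Dec (A i j s)
  A? i j s = map′ (λ { (p , q , r) → adj p q r }) (λ { (adj p q r) → p , q , r })
    ((T i ≟ᵇ true) ×-dec (T j ≟ᵇ true) ×-dec Maybe.≡-dec _≟ˢ_ (sig G i j) (just s))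

  adj? : ∀ i j → Dec (∃ (A i j))
  adj? i j = any? (A? i j)

  Valid : (V → Color) → Set
  Valid φ = ∀ i j s → A i j s → Sat (plain s) (φ i) (φ j)

  Colorable : Set
  Colorable = ∃ Valid

  nbrs : V → List V
  nbrs i = filter (adj? i) (allFin (n G))

  nbrs-in : ∀ {i j s} → A i j s → j ∈ nbrs i
  nbrs-in {i} {j} a = ∈-filter⁺ (adj? i) (∈-allFin j) (_ , a)

  nbrs-out : ∀ {i j} → j ∈ nbrs i → ∃ (A i j)
  nbrs-out {i} h = proj₂ (∈-filter⁻ (adj? i) {xs = allFin (n G)} h)

  nbrs-unique : ∀ i → Unique (nbrs i)
  nbrs-unique i = Unique.filter⁺ (adj? i) (Unique.allFin⁺ (n G))

  Two : V → Set
  Two w = length (nbrs w) ≡ 2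

  two? : ∀ w → Dec (Two w)
  two? w = length (nbrs w) ≟ⁿ 2

  -- Membership form of a neighbourhood, so that the neighbours can be permuted freely.
  Three : V → V → V → V → Set
  Three v a b c = (∃ (A v a) × ∃ (A v b) × ∃ (A v c)) × (a ≢ b × a ≢ c × b ≢ c) × (∀ j s → A v j s → j ≡ a ⊎ j ≡ b ⊎ j ≡ c)

  three-swap : ∀ {v a b c} → Three v a b c → Three v b a c
  three-swap ((x , y , z) , (p , q , r) , f) = (y , x , z) , (≢-sym p , r , q) , λ j s h → sw (f j s h)
    where
    sw : ∀ {X Y Z : Set} → X ⊎ Y ⊎ Z → Y ⊎ X ⊎ Z
    sw (inj₁ x) = inj₂ (inj₁ x)
    sw (inj₂ (inj₁ x)) = inj₁ x
    sw (inj₂ (inj₂ x)) = inj₂ (inj₂ x)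

  three-rot : ∀ {v a b c} → Three v a b c → Three v b c a
  three-rot ((x , y , z) , (p , q , r) , f) = (y , z , x) , (r , ≢-sym p , ≢-sym q) , λ j s h → sw (f j s h)
    where
    sw : ∀ {X Y Z : Set} → X ⊎ Y ⊎ Z → Y ⊎ Z ⊎ X
    sw (inj₁ x) = inj₂ (inj₂ x)
    sw (inj₂ (inj₁ x)) = inj₁ x
    sw (inj₂ (inj₂ x)) = inj₂ (inj₁ x)

  three : ∀ {v a b c} → nbrs v ≡ a ∷ b ∷ c ∷ [] → Three v a b c
  three {v} {a} {b} {c} e with nbrs-unique v
  ... | u rewrite e with u
  ... | (p ∷ q ∷ []) ∷ (r ∷ []) ∷ _ = (mem (here refl) , mem (there (here refl)) , mem (there (there (here refl)))) , (p , q , r) , cover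
    where
    mem : ∀ {j} → j ∈ a ∷ b ∷ c ∷ [] → ∃ (A v j)
    mem h = nbrs-out (subst (_ ∈_) (sym e) h)
    cover : ∀ j s → A v j s → j ≡ a ⊎ j ≡ b ⊎ j ≡ c
    cover j s h with subst (j ∈_) e (nbrs-in h)
    ... | here p = inj₁ p
    ... | there (here p) = inj₂ (inj₁ p)
    ... | there (there (here p)) = inj₂ (inj₂ p)

  record Ends (w : V) : Set where
    field
      {a b}   : V
      {s t}   : Sign
      toA     : A w a s
      toB     : A w b t
      a≢b     : a ≢ b
      cover   : ∀ j s → A w j s → j ≡ a ⊎ j ≡ b

  ends : ∀ {w} → Two w → Ends w
  ends {w} e with nbrs w in eq
  ends {w} () | []
  ends {w} () | _ ∷ []
  ends {w} () | _ ∷ _ ∷ _ ∷ _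
  ... | a ∷ b ∷ [] with nbrs-unique w
  ...   | u rewrite eq with u
  ...     | (p ∷ []) ∷ _ = record { toA = proj₂ (mem (here refl)) ; toB = proj₂ (mem (there (here refl))) ; a≢b = p ; cover = cover }
    where
    mem : ∀ {j} → j ∈ a ∷ b ∷ [] → ∃ (A w j)
    mem h = nbrs-out (subst (_ ∈_) (sym eq) h)
    cover : ∀ j s → A w j s → j ≡ a ⊎ j ≡ b
    cover j s h with subst (j ∈_) eq (nbrs-in h)
    ... | here p = inj₁ p
    ... | there (here p) = inj₂ p

  record Far (w v : V) (s : Sign) : Set where
    field
      {b}   : V
      {t}   : Sign
      toB   : A w b t
      b≢v   : b ≢ v
      cover : ∀ j s → A w j s → j ≡ v ⊎ j ≡ b

  far : ∀ {w v s} → Two w → A w v s → Far w v s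
  far tw h with ends tw
  ... | E with Ends.cover E _ _ h
  ... | inj₁ refl = record { toB = Ends.toB E ; b≢v = ≢-sym (Ends.a≢b E) ; cover = Ends.cover E }
  ... | inj₂ refl = record { toB = Ends.toA E ; b≢v = Ends.a≢b E ; cover = λ j s h → flip (Ends.cover E j s h) }
    where
    flip : ∀ {X Y : Set} → X ⊎ Y → Y ⊎ X
    flip (inj₁ x) = inj₂ x
    flip (inj₂ x) = inj₁ x

module Minimal (G : SignedGraph) (T : Fin (n G) → Bool)
  (noncolorable : ¬ Masked.Colorable G T)
  (minimal : ∀ v → T v ≡ true → Masked.Colorable G (T [ v ≔ false ]))
  where

  open Masked G T

  in-T : ∀ {i j s} → A i j s → T i ≡ true
  in-T (adj p _ _) = p

  ValidOff : V → (V → Color) → Set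
  ValidOff v φ = ∀ i j s → i ≢ v → j ≢ v → A i j s → Sat (plain s) (φ i) (φ j)

  delete : ∀ v → T v ≡ true → ∃ (ValidOff v)
  delete v Tv with minimal v Tv
  ... | φ , ok = φ , λ { i j s i≢ j≢ (adj p q r) →
    ok i j s (Masked.adj (trans (upd-other T false i≢) p) (trans (upd-other T false j≢) q) r) }

  recolor : ∀ {v φ} c → ValidOff v φ → (∀ j s → A v j s → Sat (plain s) c (φ j)) → ⊥
  recolor {v} {φ} c ok h = noncolorable (φ [ v ≔ c ] , valid)
    where
    valid : Valid (φ [ v ≔ c ])
    valid i j s a with i ≟ v | j ≟ v
    ... | yes refl | yes refl = ⊥-elim (A-irr a refl)
    ... | yes refl | no _ = h j s a
    ... | no _ | yes refl = sat-sym (plain s) c (φ i) (h i s (A-sym a))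
    ... | no i≢ | no j≢ = ok i j s i≢ j≢ a

  recolor-off : ∀ {v φ w} c → ValidOff v φ → (∀ j s → A w j s → j ≢ v → Sat (plain s) c (φ j)) → ValidOff v (φ [ w ≔ c ])
  recolor-off {v} {φ} {w} c ok h i j s i≢v j≢v a with i ≟ w | j ≟ w
  ... | yes refl | yes refl = ⊥-elim (A-irr a refl)
  ... | yes refl | no _ = h j s a j≢v
  ... | no _ | yes refl = sat-sym (plain s) c (φ i) (h i s (A-sym a) i≢v)
  ... | no _ | no _ = ok i j s i≢v j≢v a

  no-isolated : ∀ {v} → T v ≡ true → nbrs v ≢ []
  no-isolated {v} Tv e with delete v Tv
  ... | φ , ok = recolor {φ = φ} ((zero , pos) , false) ok λ j s a → ⊥-elim (none (subst (j ∈_) e (nbrs-in a)))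
    where
    none : ∀ {j} → j ∈ [] → ⊥
    none ()

  no-leaf : ∀ {v a} → T v ≡ true → nbrs v ≢ a ∷ []
  no-leaf {v} {a} Tv e with delete v Tv | nbrs-out {v} {a} (subst (a ∈_) (sym e) (here refl))
  ... | φ , ok | s , va with neighbour-avoiding s (φ a) (zero , pos) (zero , pos)
  ... | c , _ , sc = recolor c ok h
    where
    h : ∀ j t → A v j t → Sat (plain t) c (φ j)
    h j t vj with subst (j ∈_) e (nbrs-in vj)
    ... | here refl with A-unique va vj
    ...   | refl = sc

  twos-apart : ∀ {v w s} → Two v → Two w → A v w s → ⊥
  twos-apart {v} {w} {s} tv tw vw = go (far tv vw) (far tw (A-sym vw)) (delete v (in-T vw))
    where
    go : Far v w s → Far w v s → ∃ (ValidOff v) → ⊥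
    go P Q (φ , ok) with fill-adjacent-twos (Far.t P) (φ (Far.b P)) s (Far.t Q) (φ (Far.b Q))
    ... | x , y , p , q , r = recolor x (recolor-off y ok satW) satV
      where
      satW : ∀ j t → A w j t → j ≢ v → Sat (plain t) y (φ j)
      satW j t wj j≢v with Far.cover Q j t wj
      ... | inj₁ j≡v = ⊥-elim (j≢v j≡v)
      ... | inj₂ refl with A-unique (Far.toB Q) wj
      ...   | refl = r
      satV : ∀ j t → A v j t → Sat (plain t) x ((φ [ w ≔ y ]) j)
      satV j t vj with Far.cover P j t vj
      satV j t vj | inj₁ refl rewrite upd-same φ w y with A-unique vw vj
      ...   | refl = q
      satV j t vj | inj₂ refl rewrite upd-other φ {w} {j} y (Far.b≢v P) with A-unique (Far.toB P) vj
      ...   | refl = p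

  -- The constraint system of a minimal counterexample

  data Edge (i j : V) : Kind → Set where
    direct : ∀ {s} → A i j s → ¬ Two i → ¬ Two j → Edge i j (plain s)
    via    : ∀ {w s t θ} → Two w → A w i s → A w j t → i ≢ j → θ ≡ s · t → Edge i j (thread θ)

  edge-sym : ∀ {i j k} → Edge i j k → Edge j i k
  edge-sym (direct a p q) = direct (A-sym a) q p
  edge-sym (via {s = s} {t} tw a b ne refl) = via tw b a (≢-sym ne) (·-comm s t)

  edge-irr : ∀ {i j k} → Edge i j k → i ≢ j
  edge-irr (direct a _ _) = A-irr a
  edge-irr (via _ _ _ ne _) = ne

  edge? : ∀ i j k → Dec (Edge i j k)
  edge? i j (plain s) = map′ (λ { (a , p , q) → direct a p q }) (λ { (direct a p q) → a , p , q })
    (A? i j s ×-dec ¬? (two? i) ×-dec ¬? (two? j))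
  edge? i j (thread θ) = map′ (λ { (w , s , t , tw , a , b , ne , e) → via tw a b ne e }) (λ { (via tw a b ne e) → _ , _ , _ , tw , a , b , ne , e })
    (F.any? λ w → any? λ s → any? λ t → two? w ×-dec A? w i s ×-dec A? w j t ×-dec ¬? (i ≟ j) ×-dec (θ ≟ˢ (s · t)))

  edge-core : ∀ {v j k} → Edge v j k → T v ≡ true × ¬ Two v
  edge-core (direct a p _) = in-T a , p
  edge-core (via tw a _ _ _) = in-T (A-sym a) , λ tv → twos-apart tw tv a

  -- `v` has degree other than 2, so its deletion leaves the middle vertices of all threads
  -- coloured.
  crit : ∀ {v j k} → Edge v j k → ∃ λ (φ : V → Color) → ∀ i j k → i ≢ v → j ≢ v → Edge i j k → Sat k (φ i) (φ j)
  crit {v} e with edge-core e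
  ... | Tv , ¬tv with delete v Tv
  ... | φ , ok = φ , sats
    where
    sats : ∀ i j k → i ≢ v → j ≢ v → Edge i j k → Sat k (φ i) (φ j)
    sats i j _ i≢ j≢ (direct a _ _) = ok i j _ i≢ j≢ a
    sats i j _ i≢ j≢ (via {w} {s} {t} tw a b _ refl) = thread-of s t (φ w) (φ i) (φ j) (ok w i s w≢ i≢ a) (ok w j t w≢ j≢ b)
      where
      w≢ : w ≢ v
      w≢ refl = ¬tv tw

  -- No two vertices of degree 2 are adjacent, so each can be coloured from its own thread alone.
  noncol : ¬ ∃ λ (φ : V → Color) → ∀ i j k → Edge i j k → Sat k (φ i) (φ j)
  noncol (φ , ok) = noncolorable ((λ w → proj₁ (fill w)) , valid)
    where
    fill : ∀ w → ∃ λ c → (Two w → ∀ j s → A w j s → Sat (plain s) c (φ j)) × (¬ Two w → c ≡ φ w)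
    fill w with two? w
    ... | no ¬tw = φ w , (λ tw → ⊥-elim (¬tw tw)) , λ _ → refl
    ... | yes tw = go (ends tw)
      where
      go : Ends w → _
      go E with thread-fill (Ends.s E) (Ends.t E) (φ (Ends.a E)) (φ (Ends.b E))
                  (ok _ _ _ (via tw (Ends.toA E) (Ends.toB E) (Ends.a≢b E) refl))
      ... | c , p , q = c , (λ _ → sats) , λ ¬tw → ⊥-elim (¬tw tw)
        where
        sats : ∀ j s → A w j s → Sat (plain s) c (φ j)
        sats j s wj with Ends.cover E j s wj
        ... | inj₁ refl with A-unique (Ends.toA E) wj
        ...   | refl = p
        sats j s wj | inj₂ refl with A-unique (Ends.toB E) wj
        ...   | refl = q
    valid : Valid (λ w → proj₁ (fill w))
    valid i j s a with two? i | two? j | fill i | fill j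
    ... | yes ti | yes tj | _ | _ = ⊥-elim (twos-apart ti tj a)
    ... | yes ti | no ¬tj | c , f , _ | d , _ , g rewrite g ¬tj = f ti j s a
    ... | no ¬ti | yes tj | c , _ , f | d , g , _ rewrite f ¬ti = sat-sym (plain s) d (φ i) (g tj i s (A-sym a))
    ... | no ¬ti | no ¬tj | c , _ , f | d , _ , g rewrite f ¬ti | g ¬tj = ok i j _ (direct a ¬ti ¬tj)

  open Critical Edge edge-sym edge-irr edge? crit noncol public

  -- The index keeps the neighbour `w` through which a constraint runs, which `Edge` forgets;
  -- constraints can then be listed along a list of neighbours.
  data Dart (v w : V) : V → Kind → Set where
    direct : ∀ {s} → A v w s → ¬ Two w → Dart v w w (plain s)
    via    : ∀ {j s t} → Two w → A w v s → A w j t → v ≢ j → Dart v w j (thread (s · t))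

  dart : ∀ {v w s} → A v w s → ∃₂ (Dart v w)
  dart {v} {w} a with two? w
  ... | no ¬tw = w , _ , direct a ¬tw
  ... | yes tw with far tw (A-sym a)
  ...   | P = _ , _ , via tw (A-sym a) (Far.toB P) (≢-sym (Far.b≢v P))

  dart-edge : ∀ {v w j k} → ¬ Two v → Dart v w j k → Edge v j k
  dart-edge ¬tv (direct a ¬tw) = direct a ¬tv ¬tw
  dart-edge ¬tv (via tw a b ne) = via tw a b ne refl

  dart-unique : ∀ {v w j k j' k'} → Dart v w j k → Dart v w j' k' → j ≡ j' × k ≡ k'
  dart-unique (direct a p) (direct b q) = refl , cong plain (A-unique a b)
  dart-unique (direct a p) (via tw _ _ _) = ⊥-elim (p tw)
  dart-unique (via tw _ _ _) (direct a p) = ⊥-elim (p tw)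
  dart-unique (via tw a b ne) (via _ a' b' ne') with far tw a
  ... | P with Far.cover P _ _ b | Far.cover P _ _ b'
  ... | inj₁ refl | _ = ⊥-elim (ne refl)
  ... | inj₂ _ | inj₁ refl = ⊥-elim (ne' refl)
  ... | inj₂ refl | inj₂ refl = refl , cong thread (cong₂ _·_ (A-unique a a') (A-unique b b'))

  edge-dart : ∀ {v j k} → Edge v j k → ∃ λ w → ∃ (A v w) × Dart v w j k
  edge-dart (direct a _ ¬tj) = _ , (_ , a) , direct a ¬tj
  edge-dart (via tw a b ne refl) = _ , (_ , A-sym a) , via tw a b ne

  limit₃ : ∀ {v a b c j₁ k₁ j₂ k₂ j₃ k₃} → Three v a b c → Dart v a j₁ k₁ → Dart v b j₂ k₂ → Dart v c j₃ k₃ →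
    ∀ j k → Edge v j k → (j ≡ j₁ × k ≡ k₁) ⊎ (j ≡ j₂ × k ≡ k₂) ⊎ (j ≡ j₃ × k ≡ k₃)
  limit₃ (_ , _ , cover) d₁ d₂ d₃ j k e with edge-dart e
  ... | w , (s , a) , d with cover w s a
  ... | inj₁ refl = inj₁ (dart-unique d d₁)
  ... | inj₂ (inj₁ refl) = inj₂ (inj₁ (dart-unique d d₂))
  ... | inj₂ (inj₂ refl) = inj₂ (inj₂ (dart-unique d d₃))

  Four : V → V → V → V → V → Set
  Four v a b c d = (∃ (A v a) × ∃ (A v b) × ∃ (A v c) × ∃ (A v d)) × (∀ j s → A v j s → j ≡ a ⊎ j ≡ b ⊎ j ≡ c ⊎ j ≡ d)

  four-rot : ∀ {v a b c d} → Four v a b c d → Four v b c d a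
  four-rot ((x , y , z , w) , f) = (y , z , w , x) , λ j s h → sw (f j s h)
    where
    sw : ∀ {X Y Z W : Set} → X ⊎ Y ⊎ Z ⊎ W → Y ⊎ Z ⊎ W ⊎ X
    sw (inj₁ x) = inj₂ (inj₂ (inj₂ x))
    sw (inj₂ (inj₁ x)) = inj₁ x
    sw (inj₂ (inj₂ (inj₁ x))) = inj₂ (inj₁ x)
    sw (inj₂ (inj₂ (inj₂ x))) = inj₂ (inj₂ (inj₁ x))

  four : ∀ {v a b c d} → nbrs v ≡ a ∷ b ∷ c ∷ d ∷ [] → Four v a b c d
  four {v} {a} {b} {c} {d} e = (mem (here refl) , mem (there (here refl)) , mem (there (there (here refl))) , mem (there (there (there (here refl))))) , cover
    where
    mem : ∀ {j} → j ∈ a ∷ b ∷ c ∷ d ∷ [] → ∃ (A v j)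
    mem h = nbrs-out (subst (_ ∈_) (sym e) h)
    cover : ∀ j s → A v j s → j ≡ a ⊎ j ≡ b ⊎ j ≡ c ⊎ j ≡ d
    cover j s h with subst (j ∈_) e (nbrs-in h)
    ... | here p = inj₁ p
    ... | there (here p) = inj₂ (inj₁ p)
    ... | there (there (here p)) = inj₂ (inj₂ (inj₁ p))
    ... | there (there (there (here p))) = inj₂ (inj₂ (inj₂ p))

  limit₄ : ∀ {v a b c d j₁ k₁ j₂ k₂ j₃ k₃ j₄ k₄} → Four v a b c d →
    Dart v a j₁ k₁ → Dart v b j₂ k₂ → Dart v c j₃ k₃ → Dart v d j₄ k₄ →
    ∀ j k → Edge v j k → (j ≡ j₁ × k ≡ k₁) ⊎ (j ≡ j₂ × k ≡ k₂) ⊎ (j ≡ j₃ × k ≡ k₃) ⊎ (j ≡ j₄ × k ≡ k₄)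
  limit₄ (_ , cover) d₁ d₂ d₃ d₄ j k e with edge-dart e
  ... | w , (s , a) , d with cover w s a
  ... | inj₁ refl = inj₁ (dart-unique d d₁)
  ... | inj₂ (inj₁ refl) = inj₂ (inj₁ (dart-unique d d₂))
  ... | inj₂ (inj₂ (inj₁ refl)) = inj₂ (inj₂ (inj₁ (dart-unique d d₃)))
  ... | inj₂ (inj₂ (inj₂ refl)) = inj₂ (inj₂ (inj₂ (dart-unique d d₄)))

  thread-dart : ∀ {v w s} → A v w s → Two w → ∃₂ λ j θ → Dart v w j (thread θ)
  thread-dart a tw = let P = far tw (A-sym a) in _ , _ , via tw (A-sym a) (Far.toB P) (≢-sym (Far.b≢v P))

  Y : V → Set
  Y v = ¬ Two v × ∃ λ a → ∃ λ b → ∃ λ w → Three v a b w × ¬ Two a × ¬ Two b × Two w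

  isY : ∀ {v a b w e f} → ¬ Two v → Three v a b w → A v a e → A v b f → ¬ Two a → ¬ Two b → Two w → ∃₂ λ o θ → IsY v a e b f o θ
  isY ¬tv t@((_ , _ , _ , vw) , (a≢b , _) , _) va vb ¬ta ¬tb tw with thread-dart vw tw
  ... | o , θ , d = o , θ , record
    { edge₁ = direct va ¬tv ¬ta ; edge₂ = direct vb ¬tv ¬tb ; edge₃ = dart-edge ¬tv d ; a≢b = a≢b
    ; only = limit₃ t (direct va ¬ta) (direct vb ¬tb) d }

  isX : ∀ {v a b c e f g} → ¬ Two v → Three v a b c → A v a e → A v b f → A v c g → ¬ Two a → ¬ Two b → ¬ Two c → IsX v a e b f c g
  isX ¬tv t@(_ , (a≢b , a≢c , b≢c) , _) va vb vc ¬ta ¬tb ¬tc = record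
    { edge₁ = direct va ¬tv ¬ta ; edge₂ = direct vb ¬tv ¬tb ; edge₃ = direct vc ¬tv ¬tc ; a≢b = a≢b
    ; only = limit₃ t (direct va ¬ta) (direct vb ¬tb) (direct vc ¬tc) } , a≢c , b≢c

  orient : ∀ {y v s} → Y y → A y v s → ¬ Two v → ∃ λ z → ∃ λ f → ∃ λ o → ∃ λ θ → IsY y v s z f o θ
  orient {y} {v} {s} (¬ty , a , b , w , t@(((_ , ya) , (_ , yb) , _) , _ , cover) , ¬ta , ¬tb , tw) yv ¬tv with cover v s yv
  ... | inj₁ refl = _ , _ , isY ¬ty t yv yb ¬ta ¬tb tw
  ... | inj₂ (inj₁ refl) = _ , _ , isY ¬ty (three-swap t) yv ya ¬tb ¬ta tw
  ... | inj₂ (inj₂ refl) = ⊥-elim (¬tv tw)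

  two-twos : ∀ {v a b c} → ¬ Two v → Three v a b c → Two b → Two c → ⊥
  two-twos ¬tv t@(((_ , va) , (_ , vb) , (_ , vc)) , _) tb tc with dart va | thread-dart vb tb | thread-dart vc tc
  ... | _ , _ , da | _ , _ , db | _ , _ , dc = two-threads (dart-edge ¬tv db) (limit₃ t da db dc)

  four-twos : ∀ {v a b c d} → ¬ Two v → Four v a b c d → Two a → Two b → Two c → Two d → ⊥
  four-twos ¬tv t@(((_ , va) , (_ , vb) , (_ , vc) , (_ , vd)) , _) ta tb tc td
    with thread-dart va ta | thread-dart vb tb | thread-dart vc tc | thread-dart vd td
  ... | _ , _ , da | _ , _ , db | _ , _ , dc | _ , _ , dd = four-threads (dart-edge ¬tv da) (limit₄ t da db dc dd)

  three-twos : ∀ {v a b c d} → ¬ Two v → Four v a b c d → ¬ Two a → Two b → Two c → Two d → ¬ Y a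
  three-twos ¬tv t@(((_ , va) , (_ , vb) , (_ , vc) , (_ , vd)) , _) ¬ta tb tc td y
    with thread-dart vb tb | thread-dart vc tc | thread-dart vd td | orient y (A-sym va) ¬tv
  ... | _ , _ , db | _ , _ , dc | _ , _ , dd | _ , _ , _ , _ , N = three-threads-beside-Y N (limit₄ t (direct va ¬ta) db dc dd)

  -- Discharging along the paths

  WOther : V → V → Set
  WOther y j = ∃ λ z → z ≢ j × W y z

  W-adj : ∀ {y z} → W y z → ∃ (A y z)
  W-adj w with W-shape w
  ... | _ , _ , _ , _ , _ , N with Node.edge₂ N
  ... | direct a _ _ = _ , a

  W-target : ∀ {y z} → W y z → ¬ Two z
  W-target w with W-shape w
  ... | _ , _ , _ , _ , _ , N with Node.edge₂ N
  ... | direct _ _ ¬t = ¬t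

  module Discharge (W? : ∀ y z → Dec (W y z)) (WOther? : ∀ y z → Dec (WOther y z)) (Y? : ∀ v → Dec (Y v)) where

    data Status (y j : V) : ℕ → Set where
      zero : (Y y → WOther y j) → Status y j 0
      one  : Y y → ¬ W y j → ¬ WOther y j → Status y j 1
      two  : Y y → W y j → Status y j 2

    abstract
      -- Charges are in units of 1/10, so that an edge carries 20 and a vertex needs 28.  τ y j is what a Y
      -- receives across its edge to j beyond half of the edge.
      τ : V → V → ℕ
      τ y j with Y? y | W? y j | WOther? y j
      ... | no _  | _     | _     = 0
      ... | yes _ | yes _ | _     = 2
      ... | yes _ | no _  | yes _ = 0
      ... | yes _ | no _  | no _  = 1

      status : ∀ y j → Status y j (τ y j)
      status y j with Y? y | W? y j | WOther? y j
      ... | no ¬p | _     | _     = zero λ p → ⊥-elim (¬p p)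
      ... | yes p | yes w | _     = two p w
      ... | yes _ | no _  | yes o = zero λ _ → o
      ... | yes p | no q  | no r  = one p q r

    τ≤2 : ∀ y j → τ y j ≤ 2
    τ≤2 y j with τ y j | status y j
    ... | _ | zero _ = z≤n
    ... | _ | one _ _ _ = s≤s z≤n
    ... | _ | two _ _ = ℕ.≤-refl

    τ-notY : ∀ {y} j → ¬ Y y → τ y j ≡ 0
    τ-notY {y} j ¬y with τ y j | status y j
    ... | _ | zero _ = refl
    ... | _ | one p _ _ = ⊥-elim (¬y p)
    ... | _ | two p _ = ⊥-elim (¬y p)

    τ-other : ∀ {y j} → WOther y j → τ y j ≡ 0
    τ-other {y} {j} o@(z , z≢j , w) with τ y j | status y j
    ... | _ | zero _ = refl
    ... | _ | one _ _ ¬o = ⊥-elim (¬o o)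
    ... | _ | two _ w' = ⊥-elim (z≢j (W-unique w' w))

    -- The bound 2 keeps the truncated subtractions exact, so the edge keeps its charge.
    exchange : ∀ {x y} → x ≤ 2 → y ≤ 2 → (10 + x) ∸ y + ((10 + y) ∸ x) ≡ 20
    exchange z≤n z≤n = refl
    exchange z≤n (s≤s z≤n) = refl
    exchange z≤n (s≤s (s≤s z≤n)) = refl
    exchange (s≤s z≤n) z≤n = refl
    exchange (s≤s z≤n) (s≤s z≤n) = refl
    exchange (s≤s z≤n) (s≤s (s≤s z≤n)) = refl
    exchange (s≤s (s≤s z≤n)) z≤n = refl
    exchange (s≤s (s≤s z≤n)) (s≤s z≤n) = refl
    exchange (s≤s (s≤s z≤n)) (s≤s (s≤s z≤n)) = refl

    abstract
      -- A vertex of degree 2 collects its 28 as 14 from each edge, which leaves 6 for the other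
      -- end. Any other edge is halved and then shifted by the demands at its ends.
      share : V → V → ℕ
      share v j with two? v | two? j
      ... | yes _ | _     = 14
      ... | no _  | yes _ = 6
      ... | no _  | no _  = (10 + τ v j) ∸ τ j v

      share-two : ∀ {v} j → Two v → share v j ≡ 14
      share-two {v} j tv with two? v
      ... | yes _ = refl
      ... | no ¬t = ⊥-elim (¬t tv)

      share-to-two : ∀ {v j} → ¬ Two v → Two j → share v j ≡ 6
      share-to-two {v} {j} ¬tv tj with two? v | two? j
      ... | yes t | _ = ⊥-elim (¬tv t)
      ... | no _ | yes _ = refl
      ... | no _ | no ¬t = ⊥-elim (¬t tj)

      share-core : ∀ {v j} → ¬ Two v → ¬ Two j → share v j ≡ (10 + τ v j) ∸ τ j v
      share-core {v} {j} ¬tv ¬tj with two? v | two? j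
      ... | yes t | _ = ⊥-elim (¬tv t)
      ... | no _ | yes t = ⊥-elim (¬tj t)
      ... | no _ | no _ = refl

      share-sum : ∀ {v j s} → A v j s → share v j + share j v ≡ 20
      share-sum {v} {j} a with two? v | two? j
      ... | yes tv | yes tj = ⊥-elim (twos-apart tv tj a)
      ... | yes _ | no _ = refl
      ... | no _ | yes _ = refl
      ... | no _ | no _ = exchange (τ≤2 v j) (τ≤2 j v)

    share-core≥ : ∀ {v j} → ¬ Two v → ¬ Two j → 10 ∸ τ j v ≤ share v j
    share-core≥ {v} {j} ¬tv ¬tj rewrite share-core ¬tv ¬tj = ℕ.∸-monoˡ-≤ (τ j v) (ℕ.m≤m+n 10 (τ v j))

    share≥8 : ∀ {v j} → ¬ Two v → ¬ Two j → 8 ≤ share v j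
    share≥8 {v} {j} ¬tv ¬tj = ℕ.≤-trans (ℕ.∸-monoʳ-≤ 10 (τ≤2 j v)) (share-core≥ ¬tv ¬tj)

    share≥6 : ∀ {v j} → ¬ Two v → 6 ≤ share v j
    share≥6 {v} {j} ¬tv with two? j
    ... | yes tj = ℕ.≤-reflexive (sym (share-to-two ¬tv tj))
    ... | no ¬tj = ℕ.≤-trans (ℕ.≤ᵇ⇒≤ 6 8 tt) (share≥8 ¬tv ¬tj)

    -- Two adjacent Ys are a source, so the path through `a` is directed away from `v`, and `a`
    -- draws there.
    Y-to-Y : ∀ {v a s} → Y v → A v a s → ¬ Two v → ¬ Two a → τ a v ≡ 0
    Y-to-Y {v} {a} {s} y va ¬tv ¬ta with Y? a
    ... | no ¬y = τ-notY v ¬y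
    ... | yes y' with orient y va ¬ta | orient y' (A-sym va) ¬tv
    ...   | _ , _ , _ , _ , N | z , _ , _ , _ , N' = τ-other (z , ≢-sym (Node.a≢b N') , twin N' N)

    -- The basic income is 10 + 10 + 6, and its demands on `a` and `b` sum to at least 2: one side
    -- gives 2, or both give 1. Demand 0 on both sides would need paths in both directions, against
    -- `W-unique`.
    Y-income : ∀ {v a b w} → ¬ Two v → Three v a b w → ¬ Two a → ¬ Two b → Two w → 28 ≤ share v a + (share v b + share v w)
    Y-income {v} {a} {b} {w} ¬tv t@(((_ , va) , (_ , vb) , _) , (a≢b , _) , cover) ¬ta ¬tb tw = goal
      where
      y : Y v
      y = ¬tv , a , b , w , t , ¬ta , ¬tb , tw
      target : ∀ {z} → W v z → z ≡ a ⊎ z ≡ b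
      target {z} h with cover z _ (proj₂ (W-adj h))
      ... | inj₁ p = inj₁ p
      ... | inj₂ (inj₁ p) = inj₂ p
      ... | inj₂ (inj₂ refl) = ⊥-elim (W-target h tw)
      total : 2 ≤ τ v a + τ v b
      total with τ v a | τ v b | status v a | status v b
      ... | _ | _ | two _ _ | _ = s≤s (s≤s z≤n)
      ... | _ | _ | one _ _ _ | one _ _ _ = ℕ.≤-refl
      ... | _ | _ | one _ _ _ | two _ _ = s≤s (s≤s z≤n)
      ... | _ | _ | zero _ | two _ _ = ℕ.≤-refl
      ... | _ | _ | one _ ¬w ¬o | zero f = ⊥-elim (only-a (f y))
        where
        only-a : WOther v b → ⊥
        only-a (z , z≢b , h) with target h
        ... | inj₁ refl = ¬w h
        ... | inj₂ refl = z≢b refl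
      ... | _ | _ | zero f | one _ ¬w ¬o = ⊥-elim (only-b (f y))
        where
        only-b : WOther v a → ⊥
        only-b (z , z≢a , h) with target h
        ... | inj₁ refl = z≢a refl
        ... | inj₂ refl = ¬w h
      ... | _ | _ | zero f | zero g = ⊥-elim (both (f y) (g y))
        where
        both : WOther v a → WOther v b → ⊥
        both (z , z≢a , h) (z' , z'≢b , h') with target h | target h'
        ... | inj₁ refl | _ = z≢a refl
        ... | inj₂ _ | inj₂ refl = z'≢b refl
        ... | inj₂ refl | inj₁ refl = a≢b (W-unique h h')
      goal : 28 ≤ share v a + (share v b + share v w)
      goal rewrite share-core ¬tv ¬ta | share-core ¬tv ¬tb | share-to-two ¬tv tw | Y-to-Y y va ¬tv ¬ta | Y-to-Y y vb ¬tv ¬tb =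
        arith (τ v a) (τ v b) total
        where
        arith : ∀ p q → 2 ≤ p + q → 28 ≤ (10 + p) + ((10 + q) + 6)
        arith p q h = ℕ.≤-trans (ℕ.+-monoˡ-≤ 26 h) (ℕ.≤-reflexive (solve 2 (λ p q →
          p :+ q :+ con 26 := con 10 :+ p :+ (con 10 :+ q :+ con 6)) refl p q))

    -- The basic income is 30, so 2 may be drawn. If a path enters `v` from one Y, it continues
    -- through every other Y neighbour, which then draws on its far side. Otherwise each neighbour
    -- draws at most 1, and not all three do: three Ys would form a star, with paths directed away
    -- from `v`.
    X-income : ∀ {v a b c} → ¬ Two v → Three v a b c → ¬ Two a → ¬ Two b → ¬ Two c → 28 ≤ share v a + (share v b + share v c)
    X-income {v} {a} {b} {c} ¬tv t@(((_ , va) , (_ , vb) , (_ , vc)) , _) ¬ta ¬tb ¬tc =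
      arith (τ a v) (τ b v) (τ c v) (share-core≥ ¬tv ¬ta) (share-core≥ ¬tv ¬tb) (share-core≥ ¬tv ¬tc) total
      where
      X : IsX v a _ b _ c _
      X = isX ¬tv t va vb vc ¬ta ¬tb ¬tc
      passed : ∀ {p q r e f g} → IsX v p e q f r g → W p v → A v q f → τ q v ≡ 0
      passed {q = q} X w vq with Y? q
      ... | no ¬y = τ-notY v ¬y
      ... | yes y with orient y (A-sym vq) ¬tv
      ...   | z , _ , _ , _ , N = τ-other (z , ≢-sym (Node.a≢b N) , pass w X N)
      total : τ a v + (τ b v + τ c v) ≤ 2
      total = bound (status a v) (status b v) (status c v) refl refl refl
        where
        bound : ∀ {p q r} → Status a v p → Status b v q → Status c v r → p ≡ τ a v → q ≡ τ b v → r ≡ τ c v → p + (q + r) ≤ 2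
        bound (two _ w) _ _ _ q r rewrite q | r | passed X w vb | passed (rotX (rotX (swapX (rotX X)))) w vc = ℕ.≤-refl
        bound _ (two _ w) _ p _ r rewrite p | r | passed (swapX X) w va | passed (rotX X) w vc = ℕ.≤-refl
        bound _ _ (two _ w) p q _ rewrite p | q | passed (rotX (rotX X)) w va | passed (swapX (rotX X)) w vb = ℕ.≤-refl
        bound (zero _) (zero _) (zero _) _ _ _ = z≤n
        bound (zero _) (zero _) (one _ _ _) _ _ _ = s≤s z≤n
        bound (zero _) (one _ _ _) (zero _) _ _ _ = s≤s z≤n
        bound (zero _) (one _ _ _) (one _ _ _) _ _ _ = ℕ.≤-refl
        bound (one _ _ _) (zero _) (zero _) _ _ _ = s≤s z≤n
        bound (one _ _ _) (zero _) (one _ _ _) _ _ _ = ℕ.≤-refl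
        bound (one _ _ _) (one _ _ _) (zero _) _ _ _ = ℕ.≤-refl
        bound (one ya _ ¬o) (one yb _ _) (one yc _ _) _ _ _
          with orient ya (A-sym va) ¬tv | orient yb (A-sym vb) ¬tv | orient yc (A-sym vc) ¬tv
        ... | z , _ , _ , _ , Na | _ , _ , _ , _ , Nb | _ , _ , _ , _ , Nc = ⊥-elim (¬o (z , ≢-sym (Node.a≢b Na) , star X Na Nb Nc))
      arith : ∀ {x y z} p q r → 10 ∸ p ≤ x → 10 ∸ q ≤ y → 10 ∸ r ≤ z → p + (q + r) ≤ 2 → 28 ≤ x + (y + z)
      arith {x} {y} {z} p q r hx hy hz h = ℕ.+-cancelʳ-≤ 2 28 (x + (y + z)) (begin
        30                                ≤⟨ ℕ.+-mono-≤ (lift p hx) (ℕ.+-mono-≤ (lift q hy) (lift r hz)) ⟩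
        (x + p) + ((y + q) + (z + r))     ≡⟨ solve 6 (λ x y z p q r → (x :+ p) :+ ((y :+ q) :+ (z :+ r)) := (x :+ (y :+ z)) :+ (p :+ (q :+ r))) refl x y z p q r ⟩
        (x + (y + z)) + (p + (q + r))     ≤⟨ ℕ.+-monoʳ-≤ (x + (y + z)) h ⟩
        (x + (y + z)) + 2                 ∎)
        where
        open ℕ.≤-Reasoning
        lift : ∀ {x} p → 10 ∸ p ≤ x → 10 ≤ x + p
        lift {x} p h = ℕ.≤-trans (ℕ.m≤n+m∸n 10 p) (ℕ.≤-trans (ℕ.+-monoʳ-≤ p h) (ℕ.≤-reflexive (ℕ.+-comm p x)))

    income₃ : ∀ {v a b c} → ¬ Two v → Three v a b c → 28 ≤ share v a + (share v b + share v c)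
    income₃ {v} {a} {b} {c} ¬tv t with two? a | two? b | two? c
    ... | yes ta | yes tb | _ = ⊥-elim (two-twos ¬tv (three-rot (three-rot t)) ta tb)
    ... | _ | yes tb | yes tc = ⊥-elim (two-twos ¬tv t tb tc)
    ... | yes ta | _ | yes tc = ⊥-elim (two-twos ¬tv (three-rot t) tc ta)
    ... | no ¬ta | no ¬tb | no ¬tc = X-income ¬tv t ¬ta ¬tb ¬tc
    ... | no ¬ta | no ¬tb | yes tc = Y-income ¬tv t ¬ta ¬tb tc
    ... | yes ta | no ¬tb | no ¬tc = subst (28 ≤_) (solve 3 (λ x y z → x :+ (y :+ z) := z :+ (x :+ y)) refl (share v b) (share v c) (share v a))
                                       (Y-income ¬tv (three-rot t) ¬tb ¬tc ta)
    ... | no ¬ta | yes tb | no ¬tc = subst (28 ≤_) (solve 3 (λ x y z → x :+ (y :+ z) := y :+ (z :+ x)) refl (share v c) (share v a) (share v b))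
                                       (Y-income ¬tv (three-rot (three-rot t)) ¬tc ¬ta tb)

    sum₄ : ∀ {x y z w p q r s n} → p ≤ x → q ≤ y → r ≤ z → s ≤ w → n ≤ p + (q + (r + s)) → n ≤ x + (y + (z + w))
    sum₄ a b c d h = ℕ.≤-trans h (ℕ.+-mono-≤ a (ℕ.+-mono-≤ b (ℕ.+-mono-≤ c d)))

    -- Two neighbours of degree other than 2 give 8 + 8 + 6 + 6. A single one is no Y by
    -- `three-twos`, so it draws nothing and the sum is 10 + 6 + 6 + 6.
    income₄ : ∀ {v a b c d} → ¬ Two v → Four v a b c d → 28 ≤ share v a + (share v b + (share v c + share v d))
    income₄ {v} {a} {b} {c} {d} ¬tv t = cases
      where
      six : ∀ {j} → Two j → 6 ≤ share v j
      six tj = ℕ.≤-reflexive (sym (share-to-two ¬tv tj))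
      lone : ∀ {j} → ¬ Two j → ¬ Y j → 10 ≤ share v j
      lone {j} ¬tj ¬y = subst (λ k → 10 ∸ k ≤ share v j) (τ-notY v ¬y) (share-core≥ ¬tv ¬tj)
      cases : 28 ≤ share v a + (share v b + (share v c + share v d))
      cases with two? a | two? b | two? c | two? d
      ... | yes ta | yes tb | yes tc | yes td = ⊥-elim (four-twos ¬tv t ta tb tc td)
      ... | no na  | yes tb | yes tc | yes td = sum₄ (lone na (three-twos ¬tv t na tb tc td)) (six tb) (six tc) (six td) ℕ.≤-refl
      ... | yes ta | no nb  | yes tc | yes td = sum₄ (six ta) (lone nb (three-twos ¬tv (four-rot t) nb tc td ta)) (six tc) (six td) ℕ.≤-refl
      ... | yes ta | yes tb | no nc  | yes td = sum₄ (six ta) (six tb) (lone nc (three-twos ¬tv (four-rot (four-rot t)) nc td ta tb)) (six td) ℕ.≤-refl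
      ... | yes ta | yes tb | yes tc | no nd  = sum₄ (six ta) (six tb) (six tc) (lone nd (three-twos ¬tv (four-rot (four-rot (four-rot t))) nd ta tb tc)) ℕ.≤-refl
      ... | no na  | no nb  | _      | _      = sum₄ (share≥8 ¬tv na) (share≥8 ¬tv nb) (share≥6 ¬tv) (share≥6 ¬tv) ℕ.≤-refl
      ... | no na  | _      | no nc  | _      = sum₄ (share≥8 ¬tv na) (share≥6 ¬tv) (share≥8 ¬tv nc) (share≥6 ¬tv) ℕ.≤-refl
      ... | no na  | _      | _      | no nd  = sum₄ (share≥8 ¬tv na) (share≥6 ¬tv) (share≥6 ¬tv) (share≥8 ¬tv nd) ℕ.≤-refl
      ... | _      | no nb  | no nc  | _      = sum₄ (share≥6 ¬tv) (share≥8 ¬tv nb) (share≥8 ¬tv nc) (share≥6 ¬tv) ℕ.≤-refl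
      ... | _      | no nb  | _      | no nd  = sum₄ (share≥6 ¬tv) (share≥8 ¬tv nb) (share≥6 ¬tv) (share≥8 ¬tv nd) ℕ.≤-refl
      ... | _      | _      | no nc  | no nd  = sum₄ (share≥6 ¬tv) (share≥6 ¬tv) (share≥8 ¬tv nc) (share≥8 ¬tv nd) ℕ.≤-refl

-- Double counting of edges and payments

sumFin-cong : ∀ {m} {f g : Fin m → ℕ} → (∀ i → f i ≡ g i) → sumFin f ≡ sumFin g
sumFin-cong {zero} h = refl
sumFin-cong {suc m} h = cong₂ _+_ (h zero) (sumFin-cong (h ∘ suc))

sumFin-+ : ∀ {m} (f g : Fin m → ℕ) → sumFin (λ i → f i + g i) ≡ sumFin f + sumFin g
sumFin-+ {zero} f g = refl
sumFin-+ {suc m} f g rewrite sumFin-+ (f ∘ suc) (g ∘ suc) =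
  solve 4 (λ a b c d → (a :+ b) :+ (c :+ d) := (a :+ c) :+ (b :+ d)) refl (f zero) (g zero) (sumFin (f ∘ suc)) (sumFin (g ∘ suc))

sum-filter : ∀ {m k} {P : Fin k → Set} (P? : Decidable P) (f : Fin k → ℕ) (g : Fin m → Fin k) →
  sum (map f (filter P? (tabulate g))) ≡ sumFin (λ i → if does (P? (g i)) then f (g i) else 0)
sum-filter {zero} P? f g = refl
sum-filter {suc m} P? f g with does (P? (g zero))
... | true = cong (f (g zero) +_) (sum-filter P? f (g ∘ suc))
... | false = sum-filter P? f (g ∘ suc)

count-cong : ∀ {m} {p q : Fin m → Bool} → (∀ i → p i ≡ q i) → count p ≡ count q
count-cong {zero} h = refl
count-cong {suc m} h = cong₂ _+_ (cong (λ b → if b then 1 else 0) (h zero)) (count-cong (h ∘ suc))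

count-bound : ∀ {m} c (p : Fin m → Bool) (f : Fin m → ℕ) → (∀ i → p i ≡ true → c ≤ f i) → c * count p ≤ sumFin f
count-bound {zero} c p f h rewrite ℕ.*-zeroʳ c = z≤n
count-bound {suc m} c p f h rewrite ℕ.*-distribˡ-+ c (if p zero then 1 else 0) (count (p ∘ suc)) =
  ℕ.+-mono-≤ (head (p zero) refl) (count-bound c (p ∘ suc) (f ∘ suc) (h ∘ suc))
  where
  head : ∀ b → p zero ≡ b → c * (if b then 1 else 0) ≤ f zero
  head true e rewrite ℕ.*-identityʳ c = h zero e
  head false e rewrite ℕ.*-zeroʳ c = z≤n

count-sum : ∀ {m} c (p : Fin m → Bool) (f : Fin m → ℕ) → (∀ i → p i ≡ true → f i ≡ c) → (∀ i → p i ≡ false → f i ≡ 0) →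
  sumFin f ≡ c * count p
count-sum {zero} c p f h h' = sym (ℕ.*-zeroʳ c)
count-sum {suc m} c p f h h' rewrite ℕ.*-distribˡ-+ c (if p zero then 1 else 0) (count (p ∘ suc)) =
  cong₂ _+_ (head (p zero) refl) (count-sum c (p ∘ suc) (f ∘ suc) (h ∘ suc) (h' ∘ suc))
  where
  head : ∀ b → p zero ≡ b → f zero ≡ c * (if b then 1 else 0)
  head true e = trans (h zero e) (sym (ℕ.*-identityʳ c))
  head false e = trans (h' zero e) (sym (ℕ.*-zeroʳ c))

-- Induction on the number of vertices: the row and the column of vertex `zero` are paired entry by
-- entry.
handshake : ∀ {m} c (f : Fin m → Fin m → ℕ) (e : Fin m → Fin m → Bool) → (∀ i → f i i ≡ 0) →
  (∀ i j → e i j ≡ true → f i j + f j i ≡ c) → (∀ i j → e i j ≡ false → f i j + f j i ≡ 0) →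
  (sumFin λ i → sumFin λ j → f i j) ≡ c * (sumFin λ i → count λ j → (toℕ i <ᵇ toℕ j) ∧ e i j)
handshake {zero} c f e h₀ h h' = sym (ℕ.*-zeroʳ c)
handshake {suc m} c f e h₀ h h' = begin
  (f zero zero + sumFin row) + sumFin (λ i → col i + sumFin λ j → f (suc i) (suc j))
    ≡⟨ cong₂ _+_ (cong (_+ sumFin row) (h₀ zero)) (sumFin-+ col _) ⟩
  sumFin row + (sumFin col + rest)
    ≡⟨ sym (ℕ.+-assoc (sumFin row) (sumFin col) rest) ⟩
  (sumFin row + sumFin col) + rest
    ≡⟨ cong₂ _+_ (trans (sym (sumFin-+ row col)) (count-sum c _ _ (λ j → h zero (suc j)) (λ j → h' zero (suc j))))
                 (handshake c (λ i j → f (suc i) (suc j)) (λ i j → e (suc i) (suc j)) (h₀ ∘ suc) (λ i j → h (suc i) (suc j)) (λ i j → h' (suc i) (suc j))) ⟩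
  c * count (λ j → e zero (suc j)) + c * E
    ≡⟨ sym (ℕ.*-distribˡ-+ c _ E) ⟩
  c * (count (λ j → e zero (suc j)) + E) ∎
  where
  open ≡-Reasoning
  row col : Fin m → ℕ
  row j = f zero (suc j)
  col i = f (suc i) zero
  rest E : ℕ
  rest = sumFin λ i → sumFin λ j → f (suc i) (suc j)
  E = sumFin λ i → count λ j → (toℕ i <ᵇ toℕ j) ∧ e (suc i) (suc j)

count-delete : ∀ {m} (T : Fin m → Bool) v → T v ≡ true → suc (count (T [ v ≔ false ])) ≡ count T
count-delete {suc m} T zero e rewrite e = refl
count-delete {suc m} T (suc v) e = begin
  suc ((if T zero then 1 else 0) + count (λ i → (T [ suc v ≔ false ]) (suc i)))
    ≡⟨ cong (λ k → suc ((if T zero then 1 else 0) + k)) (count-cong shift) ⟩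
  suc ((if T zero then 1 else 0) + count ((T ∘ suc) [ v ≔ false ]))
    ≡⟨ sym (ℕ.+-suc (if T zero then 1 else 0) _) ⟩
  (if T zero then 1 else 0) + suc (count ((T ∘ suc) [ v ≔ false ]))
    ≡⟨ cong ((if T zero then 1 else 0) +_) (count-delete (T ∘ suc) v e) ⟩
  count T ∎
  where
  open ≡-Reasoning
  shift : ∀ i → (T [ suc v ≔ false ]) (suc i) ≡ ((T ∘ suc) [ v ≔ false ]) i
  shift i with i ≟ v
  ... | yes _ = refl
  ... | no _ = refl

count≡0 : ∀ {m} (T : Fin m → Bool) → count T ≡ 0 → ∀ i → T i ≡ false
count≡0 {suc m} T e i with T zero in eq
count≡0 {suc m} T () i | true
count≡0 {suc m} T e zero | false = eq
count≡0 {suc m} T e (suc i) | false = count≡0 (T ∘ suc) e i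

-- W is not obviously decidable; working under ¬¬ lets the discharging branch on it, and colourability is decidable.
¬¬-all : ∀ {m} {P : Fin m → Set} → (∀ i → ¬ ¬ P i) → ¬ ¬ (∀ i → P i)
¬¬-all {zero} h k = k λ ()
¬¬-all {suc m} h k = h zero λ p → ¬¬-all (h ∘ suc) λ q → k λ { zero → p ; (suc i) → q i }

¬¬-dec : ∀ {P : Set} → ¬ ¬ Dec P
¬¬-dec k = k (no λ p → k (yes p))

module Contradiction (G : SignedGraph) (T : Fin (n G) → Bool)
  (noncolorable : ¬ Masked.Colorable G T)
  (minimal : ∀ v → T v ≡ true → Masked.Colorable G (T [ v ≔ false ]))
  where

  open Masked G T
  open Minimal G T noncolorable minimal

  module _ (W? : ∀ y z → Dec (W y z)) (WOther? : ∀ y z → Dec (WOther y z)) (Y? : ∀ v → Dec (Y v)) where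

    open Discharge W? WOther? Y?

    income : ∀ v → T v ≡ true → 28 ≤ sum (map (share v) (nbrs v))
    income v Tv = go (nbrs v) refl
      where
      go : ∀ l → nbrs v ≡ l → 28 ≤ sum (map (share v) l)
      go [] e = ⊥-elim (no-isolated Tv e)
      go (a ∷ []) e = ⊥-elim (no-leaf Tv e)
      go (a ∷ b ∷ []) e rewrite share-two a (cong length e) | share-two b (cong length e) = ℕ.≤-refl
      go (a ∷ b ∷ c ∷ []) e rewrite ℕ.+-identityʳ (share v c) = income₃ (λ t → three≢2 (trans (sym (cong length e)) t)) (three e)
        where
        three≢2 : 3 ≢ 2
        three≢2 ()
      go (a ∷ b ∷ c ∷ d ∷ []) e rewrite ℕ.+-identityʳ (share v d) = income₄ (λ t → four≢2 (trans (sym (cong length e)) t)) (four e)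
        where
        four≢2 : 4 ≢ 2
        four≢2 ()
      -- Five shares of at least 6 already make 30.
      go (a ∷ b ∷ c ∷ d ∷ f ∷ l) e = ℕ.≤-trans (ℕ.≤ᵇ⇒≤ 28 30 tt)
        (ℕ.+-mono-≤ (six a) (ℕ.+-mono-≤ (six b) (ℕ.+-mono-≤ (six c) (ℕ.+-mono-≤ (six d) (ℕ.+-mono-≤ (six f) z≤n)))))
        where
        big : ∀ {k} → suc (suc (suc k)) ≢ 2
        big ()
        six : ∀ j → 6 ≤ share v j
        six j = share≥6 (λ t → big (trans (sym (cong length e)) t))

    induced : Subgraph G
    induced = record
      { vs = T
      ; es = λ i j → does (adj? i j)
      ; es-sym = λ i j → sym-does (adj? i j) (adj? j i) (λ { (s , a) → s , A-sym a }) (λ { (s , a) → s , A-sym a })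
      ; es-ok = λ i j e → ok (adj? i j) e }
      where
      sym-does : ∀ {P Q : Set} (p : Dec P) (q : Dec Q) → (P → Q) → (Q → P) → does p ≡ does q
      sym-does (yes p) q f g = sym (dec-true q (f p))
      sym-does (no ¬p) q f g = sym (dec-false q (¬p ∘ g))
      ok : ∀ {i j} (d : Dec (∃ (A i j))) → does d ≡ true → Adj G i j × T i ≡ true × T j ≡ true
      ok (yes (s , adj p q r)) _ = (s , r) , p , q

    pay : V → V → ℕ
    pay i j = if does (adj? i j) then share i j else 0

    paid : (sumFin λ i → sumFin λ j → pay i j) ≡ 20 * |E| induced
    paid = handshake 20 pay (λ i j → does (adj? i j)) diagonal edges non-edges
      where
      pay-yes : ∀ {i j} → ∃ (A i j) → pay i j ≡ share i j
      pay-yes {i} {j} a rewrite dec-true (adj? i j) a = refl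
      pay-no : ∀ {i j} → ¬ ∃ (A i j) → pay i j ≡ 0
      pay-no {i} {j} ¬a rewrite dec-false (adj? i j) ¬a = refl
      edges : ∀ i j → does (adj? i j) ≡ true → pay i j + pay j i ≡ 20
      edges i j e = go (adj? i j) e
        where
        go : ∀ (d : Dec (∃ (A i j))) → does d ≡ true → pay i j + pay j i ≡ 20
        go (yes (s , a)) _ = trans (cong₂ _+_ (pay-yes (s , a)) (pay-yes (s , A-sym a))) (share-sum a)
      non-edges : ∀ i j → does (adj? i j) ≡ false → pay i j + pay j i ≡ 0
      non-edges i j e = go (adj? i j) e
        where
        go : ∀ (d : Dec (∃ (A i j))) → does d ≡ false → pay i j + pay j i ≡ 0
        go (no ¬a) _ = cong₂ _+_ (pay-no ¬a) (pay-no λ { (s , a) → ¬a (s , A-sym a) })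
      diagonal : ∀ i → pay i i ≡ 0
      diagonal i = pay-no λ { (s , a) → A-irr a refl }

    dense : ¬ MadLess G 14 5
    dense mad = ℕ.<-irrefl refl (begin-strict
      -- Doubling the density bound expresses it in units of charge: 20 per edge against 28 per
      -- vertex.
      2 * (2 * |E| induced * 5)     <⟨ ℕ.*-monoʳ-< 2 (mad induced nonempty) ⟩
      2 * (14 * count T)            ≡⟨ solve 1 (λ x → con 2 :* (con 14 :* x) := con 28 :* x) refl (count T) ⟩
      28 * count T                  ≤⟨ count-bound 28 T _ (λ i Ti → ℕ.≤-trans (income i Ti) (ℕ.≤-reflexive (sum-filter (adj? i) (share i) id))) ⟩
      (sumFin λ i → sumFin λ j → pay i j)  ≡⟨ paid ⟩
      20 * |E| induced              ≡⟨ solve 1 (λ x → con 20 :* x := con 2 :* (con 2 :* x :* con 5)) refl (|E| induced) ⟩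
      2 * (2 * |E| induced * 5)     ∎)
      where
      open ℕ.≤-Reasoning
      nonempty : 1 ≤ count T
      nonempty with count T in eq
      ... | suc _ = s≤s z≤n
      ... | zero = ⊥-elim (noncolorable ((λ _ → (zero , pos) , false) , λ { i j s (adj p _ _) → ⊥-elim (in≢out p (count≡0 T eq i)) }))

  sparse-colorable : ¬ MadLess G 14 5
  sparse-colorable mad = ¬¬-all (λ y → ¬¬-all λ z → ¬¬-dec) λ W? → ¬¬-all (λ y → ¬¬-all λ z → ¬¬-dec) λ WOther? →
    ¬¬-all (λ v → ¬¬-dec) λ Y? → dense W? WOther? Y? mad

-- Induction on a bound for the number of vertices: it makes all one-vertex deletions colourable,
-- which is the minimality needed. The density hypothesis stays with `G` and is applied to the
-- subgraph induced by `T`.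
¬¬-colorable : ∀ G → MadLess G 14 5 → ∀ k T → count T ≤ k → ¬ ¬ Masked.Colorable G T
¬¬-colorable G mad k T T≤k nc = ¬¬-all (λ v → smaller k T≤k v (T v) refl) λ minimal →
  Contradiction.sparse-colorable G T nc minimal mad
  where
  smaller : ∀ k → count T ≤ k → ∀ v b → T v ≡ b → ¬ ¬ (T v ≡ true → Masked.Colorable G (T [ v ≔ false ]))
  smaller k le v false e h = h λ t → ⊥-elim (in≢out t e)
  smaller zero le v true e h with trans (count-delete T v e) (ℕ.n≤0⇒n≡0 le)
  ... | ()
  smaller (suc k) le v true e h = ¬¬-colorable G mad k (T [ v ≔ false ])
    (s≤s⁻¹ (ℕ.≤-trans (ℕ.≤-reflexive (count-delete T v e)) le)) λ c → h λ _ → c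

-- Functions that agree pointwise need not be equal, hence the closure condition on `P`.
anyFun? : ∀ {m} {P : (Fin m → Color) → Set} → (∀ {f g} → (∀ i → f i ≡ g i) → P f → P g) → (∀ f → Dec (P f)) → Dec (∃ P)
anyFun? {zero} resp d = map′ (λ p → _ , p) (λ { (f , p) → resp (λ ()) p }) (d λ ())
anyFun? {suc m} {P} resp d = map′ (λ { (c , f , p) → _ , p }) (λ { (f , p) → f zero , f ∘ suc , resp (λ { zero → refl ; (suc i) → refl }) p })
  (any? λ c → anyFun? {m} {λ f → P (cons c f)} (λ e → resp (λ { zero → refl ; (suc i) → e i })) λ f → d (cons c f))
  where
  cons : Color → (Fin m → Color) → Fin (suc m) → Color
  cons c f zero = c
  cons c f (suc i) = f i

colorable? : ∀ G T → Dec (Masked.Colorable G T)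
colorable? G T = anyFun? resp valid?
  where
  open Masked G T
  resp : ∀ {f g} → (∀ i → f i ≡ g i) → Valid f → Valid g
  resp e ok i j s a rewrite sym (e i) | sym (e j) = ok i j s a
  valid? : ∀ f → Dec (Valid f)
  valid? f = F.all? λ i → F.all? λ j → all? λ s → A? i j s →-dec Sat? (plain s) (f i) (f j)

-- From colourings to homomorphisms

code : Color → Fin 6
code ((zero , _) , false) = zero
code ((zero , _) , true) = suc zero
code ((suc zero , _) , false) = suc (suc zero)
code ((suc zero , _) , true) = suc (suc (suc zero))
code ((suc (suc zero) , _) , false) = suc (suc (suc (suc zero)))
code ((suc (suc zero) , _) , true) = suc (suc (suc (suc (suc zero))))

switch : Color → Sign
switch c = proj₂ (cls c)

abstract
  code-edge : ∀ e (x y : Color) → Sat (plain e) x y → k6-sig (code x) (code y) ≡ just (e · (switch x · switch y))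
  code-edge = decided (all? λ e → all? λ x → all? λ y → Sat? (plain e) x y →-dec Maybe.≡-dec _≟ˢ_ _ _) refl

switch-step : ∀ s u v w t → s · (v · (w · t)) ≡ u · (w · ((s · (u · v)) · t))
switch-step = decided (all? λ s → all? λ u → all? λ v → all? λ w → all? λ t → _ ≟ˢ _) refl

switch-cancel : ∀ u t → u · (u · t) ≡ t
switch-cancel = decided (all? λ u → all? λ t → _ ≟ˢ _) refl

-- By `code-edge` an edge and its image differ by the switching signs of both ends. Along a walk the
-- inner signs cancel, and on a closed walk so do the two outer ones.
coloring-hom : ∀ G → Masked.Colorable G (λ _ → true) → Hom G K6M
coloring-hom G (φ , ok) = record { vmap = vm ; emap = em ; closedWalkSign = λ u w → trans (walk w) (switch-cancel (switch (φ u)) _) }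
  where
  vm : Fin (n G) → Fin 6
  vm u = code (φ u)
  em : ∀ {u v} → Adj G u v → Adj K6M (vm u) (vm v)
  em {u} {v} (s , e) = s · (switch (φ u) · switch (φ v)) , code-edge s (φ u) (φ v) (ok u v s (Masked.adj refl refl e))
  walk : ∀ {u v} (w : Walk G u v) → walkSign w ≡ switch (φ u) · (switch (φ v) · walkSign (mapWalk {G} {K6M} vm em w))
  walk [ u ] = sym (switch-cancel (switch (φ u)) pos)
  walk (step {u} {v} {w} s e W) = trans (cong (s ·_) (walk W))
    (switch-step s (switch (φ u)) (switch (φ v)) (switch (φ w)) (walkSign (mapWalk {G} {K6M} vm em W)))

sparse-hom : ∀ G → MadLess G 14 5 → Hom G K6M
sparse-hom G mad with colorable? G (λ _ → true)
... | yes c = coloring-hom G c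
... | no ¬c = ⊥-elim (¬¬-colorable G mad _ (λ _ → true) ℕ.≤-refl ¬c)

-- Sharpness

-- K₄ on 0, 1, 2, 3 with the edge 23 subdivided by 4; only the half-edge 34 is negative.
tight-sig : Fin 5 → Fin 5 → Maybe Sign
tight-sig 0F 1F = just pos
tight-sig 0F 2F = just pos
tight-sig 0F 3F = just pos
tight-sig 1F 0F = just pos
tight-sig 1F 2F = just pos
tight-sig 1F 3F = just pos
tight-sig 2F 0F = just pos
tight-sig 2F 1F = just pos
tight-sig 2F 4F = just pos
tight-sig 3F 0F = just pos
tight-sig 3F 1F = just pos
tight-sig 3F 4F = just neg
tight-sig 4F 2F = just pos
tight-sig 4F 3F = just neg
tight-sig _  _  = nothing

tight : SignedGraph
tight = record
  { n = 5
  ; sig = tight-sig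
  ; sym = decided (F.all? λ i → F.all? λ j → Maybe.≡-dec _≟ˢ_ (tight-sig i j) (tight-sig j i)) refl
  ; noloop = decided (F.all? λ i → Maybe.≡-dec _≟ˢ_ (tight-sig i i) nothing) refl }

spanned : (Fin 5 → Bool) → ℕ
spanned vs = sumFin λ i → count λ j → (toℕ i <ᵇ toℕ j) ∧ (is-just (tight-sig i j) ∧ (vs i ∧ vs j))

count-mono : ∀ {m} {p q : Fin m → Bool} → (∀ i → p i ≡ true → q i ≡ true) → count p ≤ count q
count-mono {zero} h = z≤n
count-mono {suc m} {p} {q} h = ℕ.+-mono-≤ (head (p zero) (q zero) (h zero)) (count-mono (h ∘ suc))
  where
  head : ∀ a b → (a ≡ true → b ≡ true) → (if a then 1 else 0) ≤ (if b then 1 else 0)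
  head false _ _ = z≤n
  head true true _ = s≤s z≤n
  head true false h with h refl
  ... | ()

sumFin-mono : ∀ {m} {f g : Fin m → ℕ} → (∀ i → f i ≤ g i) → sumFin f ≤ sumFin g
sumFin-mono {zero} h = z≤n
sumFin-mono {suc m} h = ℕ.+-mono-≤ (h zero) (sumFin-mono (h ∘ suc))

edges-spanned : ∀ (H : Subgraph tight) → |E| H ≤ spanned (vs H)
edges-spanned H = sumFin-mono λ i → count-mono λ j → inside i j (toℕ i <ᵇ toℕ j) (es H i j) refl
  where
  inside : ∀ i j b c → es H i j ≡ c → b ∧ c ≡ true → b ∧ (is-just (tight-sig i j) ∧ (vs H i ∧ vs H j)) ≡ true
  inside i j true true e _ with es-ok H i j e
  ... | (s , a) , p , q rewrite a | p | q = refl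

five : (b₀ b₁ b₂ b₃ b₄ : Bool) → Fin 5 → Bool
five b₀ b₁ b₂ b₃ b₄ 0F = b₀
five b₀ b₁ b₂ b₃ b₄ 1F = b₁
five b₀ b₁ b₂ b₃ b₄ 2F = b₂
five b₀ b₁ b₂ b₃ b₄ 3F = b₃
five b₀ b₁ b₂ b₃ b₄ 4F = b₄

spanned-bound : ∀ b₀ b₁ b₂ b₃ b₄ → 2 * spanned (five b₀ b₁ b₂ b₃ b₄) * 5 ≤ 14 * count (five b₀ b₁ b₂ b₃ b₄)
spanned-bound = decided (all? λ b₀ → all? λ b₁ → all? λ b₂ → all? λ b₃ → all? λ b₄ → _ ≤? _) refl

-- A subgraph has at most the edges spanned by its vertices, so the 32 vertex sets decide. Equality
-- holds for the whole graph, with 7 edges on 5 vertices.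
tight-mad : MadEq tight 14 5
tight-mad = (λ H _ → ℕ.≤-trans (ℕ.*-monoˡ-≤ 5 (ℕ.*-monoʳ-≤ 2 (edges-spanned H)))
                       (spanned-bound (vs H 0F) (vs H 1F) (vs H 2F) (vs H 3F) (vs H 4F)))
          , whole , s≤s z≤n , refl
  where
  whole : Subgraph tight
  whole = record
    { vs = λ _ → true
    ; es = λ i j → is-just (tight-sig i j)
    ; es-sym = λ i j → cong is-just (SignedGraph.sym tight i j)
    ; es-ok = λ i j e → adjacent (tight-sig i j) e , refl , refl }
    where
    adjacent : ∀ (m : Maybe Sign) → is-just m ≡ true → Σ Sign λ s → m ≡ just s
    adjacent (just s) _ = s , refl

Joined : Fin 6 → Fin 6 → Set
Joined x y = T (is-just (k6-sig x y))

joined? : ∀ x y → Dec (Joined x y)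
joined? x y = T? _

edge-sign : Fin 6 → Fin 6 → Sign
edge-sign x y with k6-sig x y
... | just s = s
... | nothing = pos

abstract
  -- A triangle of `K6M` is positive only on three different pairs. So `a` and `b` lie in the pair
  -- that `c` and `d` miss, and both are joined to `c` positively. The edges from `w` to `a` and `b`
  -- have equal signs: `w` is outside their pair, or it is the partner of `a` and `b`, which then
  -- coincide. Hence the 4-cycle cannot be negative.
  no-placement : ∀ c d → Joined c d → ∀ a → Joined d a → Joined a c →
    edge-sign c d · (edge-sign d a · (edge-sign a c · pos)) ≡ pos →
    ∀ b → Joined d b → Joined b c → edge-sign c d · (edge-sign d b · (edge-sign b c · pos)) ≡ pos →
    ∀ w → Joined a w → Joined w b → edge-sign c a · (edge-sign a w · (edge-sign w b · (edge-sign b c · pos))) ≡ neg → ⊥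
  no-placement = decided
    (F.all? λ c → F.all? λ d → joined? c d →-dec F.all? λ a → joined? d a →-dec (joined? a c →-dec ((_ ≟ˢ pos) →-dec
     F.all? λ b → joined? d b →-dec (joined? b c →-dec ((_ ≟ˢ pos) →-dec
     F.all? λ w → joined? a w →-dec (joined? w b →-dec ((_ ≟ˢ neg) →-dec no id))))))) refl

tight-no-hom : ¬ Hom tight K6M
tight-no-hom h = no-placement (vmap 0F) (vmap 1F) (joined {0F} {1F} refl) (vmap 2F) (joined {1F} {2F} refl) (joined {2F} {0F} refl)
  (cycle (step {v = 1F} pos refl (step {v = 2F} pos refl (step pos refl [ 0F ]))) (hop refl (hop refl (hop refl stop))))
  (vmap 3F) (joined {1F} {3F} refl) (joined {3F} {0F} refl)
  (cycle (step {v = 1F} pos refl (step {v = 3F} pos refl (step pos refl [ 0F ]))) (hop refl (hop refl (hop refl stop))))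
  (vmap 4F) (joined {2F} {4F} refl) (joined {4F} {3F} refl)
  (cycle (step {v = 2F} pos refl (step {v = 4F} pos refl (step {v = 3F} neg refl (step pos refl [ 0F ]))))
         (hop refl (hop refl (hop refl (hop refl stop)))))
  where
  open Hom h
  joined : ∀ {u v s} → tight-sig u v ≡ just s → Joined (vmap u) (vmap v)
  joined {u} {v} {s} e with emap {u} {v} (s , e)
  ... | _ , e' rewrite e' = tt
  edge-sign-image : ∀ {u v s} (e : tight-sig u v ≡ just s) → proj₁ (emap {u} {v} (s , e)) ≡ edge-sign (vmap u) (vmap v)
  edge-sign-image {u} {v} {s} e with emap {u} {v} (s , e)
  ... | _ , e' rewrite e' = refl
  map-step : ∀ {u v w s} (e : tight-sig u v ≡ just s) (W : Walk tight v w) →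
    walkSign (mapWalk {tight} {K6M} vmap emap (step s e W)) ≡ edge-sign (vmap u) (vmap v) · walkSign (mapWalk {tight} {K6M} vmap emap W)
  map-step {u} {v} {w} {s} e W = trans (unfold e W) (cong (_· _) (edge-sign-image e))
    where
    unfold : ∀ {u v w s} (e : tight-sig u v ≡ just s) (W : Walk tight v w) →
      walkSign (mapWalk {tight} {K6M} vmap emap (step s e W)) ≡ proj₁ (emap {u} {v} (s , e)) · walkSign (mapWalk {tight} {K6M} vmap emap W)
    unfold {u} {v} {w} {s} e W with emap {u} {v} (s , e)
    ... | _ , _ = refl
  -- The sign picked by `emap` is not given in advance, but two vertices of `K6M` admit only one.
  -- `Image` thus expresses the sign of an image walk by its vertices alone, as `no-placement`
  -- requires.
  data Image : ∀ {u v} → Walk tight u v → Sign → Set where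
    stop : ∀ {u} → Image [ u ] pos
    hop  : ∀ {u v w s t} {W : Walk tight v w} (e : tight-sig u v ≡ just s) → Image W t → Image (step s e W) (edge-sign (vmap u) (vmap v) · t)
  image : ∀ {u v t} {W : Walk tight u v} → Image W t → walkSign (mapWalk {tight} {K6M} vmap emap W) ≡ t
  image stop = refl
  image (hop {u} {v} {W = W} e i) = trans (map-step e W) (cong (edge-sign (vmap u) (vmap v) ·_) (image i))
  cycle : ∀ {u t} (W : Walk tight u u) → Image W t → t ≡ walkSign W
  cycle {u} W i = trans (sym (image i)) (sym (closedWalkSign u W))

theorem2p6 : (∀ (G : SignedGraph) → MadLess G 14 5 → Hom G K6M)
    × (Σ SignedGraph λ G → MadEq G 14 5 × ¬ Hom G K6M)
theorem2p6 = sparse-hom , tight , tight-mad , tight-no-hom
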